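{- Let $n \geq 1$ and $l \geq 2$ be integers, let $V(G)$ be a vertex set with distinguished vertices $s \ne t$ and $|V(G)\setminus\{s,t\}| = n$. Then (1) $\frac{1}{2}\left(\frac{n}{64(l-1)^2}\right)^{\frac{\lceil \lg l\rceil}{2}} \leq m(\mathcal{P}_{n,l}) \leq m(\mathcal{P}_{n,\leq l}) \leq n^{\lceil \lg l\rceil} + 2$; (2) $\frac{1}{2} n^{\frac{\lg n}{16} - \frac{3}{4}} \leq m(\mathcal{P}_n) \leq n^{\lg n + 1} + 2$.
   Context: $\lg$ is the base-2 logarithm. Fix a finite vertex set $V(G)$ with distinguished vertices $s,t$. Input graphs are directed graphs with vertex set $V(G)$. A monotone switching network is a tuple $\langle G',s',t',\mu'\rangle$ where $G'$ is an undirected multigraph with distinguished vertices $s',t'$, and $\mu'$ assigns to each edge of $G'$ a label of the form $v_1\to v_2$ with $v_1\neq v_2$ in $V(G)$. It accepts an input graph $G$ if there is a path in $G'$ from $s'$ to $t'$ all of whose edge labels are edges of $G$. It is sound if it accepts no input graph without a directed path from $s$ to $t$. Its size is $|V(G')|$. For a set $I$ of input graphs, each containing a directed path from $s$ to $t$, $m(I)$ is the smallest size of a sound monotone switching network accepting every graph in $I$. $\mathcal{P}_{n,l}$ is the set of input graphs $G$ with $E(G)=\{v_0\to v_1, v_1\to v_2,\dots,v_{l-1}\to v_l\}$, where $v_0=s$, $v_l=t$ and $v_0,\dots,v_l$ are distinct vertices of $V(G)$. $\mathcal{P}_{n,\leq l}=\bigcup_{j=1}^{l}\mathcal{P}_{n,j}$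 and $\mathcal{P}_n=\mathcal{P}_{n,\leq n+1}$. -}

module Defs where

open import Algebra.Bundles using (CommutativeRing)
open import Data.Bool using (Bool; T)
open import Data.Empty using (⊥-elim)
open import Data.Fin as Fin using (Fin; zero; suc; inject₁)
open import Data.Integer as ℤ using (ℤ; +_; -[1+_])
import Data.Integer.Properties as ℤ
open import Data.Nat as ℕ using (ℕ; zero; suc; NonZero; NonTrivial)
import Data.Nat.Properties as ℕ
open import Data.Product using (Σ; ∃; ∃-syntax; _×_; _,_; proj₁; proj₂)
open import Data.Rational.Unnormalised as ℚ using (ℚᵘ; mkℚᵘ; 0ℚᵘ; 1ℚᵘ; ↥_; ↧_; ↧ₙ_; Positive; *≤*; *<*)
import Data.Rational.Unnormalised.Properties as ℚ
open import Data.Sum using (_⊎_; inj₁; inj₂)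
open import Function using (_∘_; _⇔_)
open import Function.Definitions using (Injective)
open import Level using (0ℓ)
open import Relation.Binary.Construct.Closure.ReflexiveTransitive using (Star)
open import Relation.Binary.PropositionalEquality using (_≡_; _≢_; refl; sym; cong; subst)
open import Relation.Nullary using (¬_; yes; no)
open import Relation.Unary using (Pred; _⊆_)

-- A real is given by the set of rationals strictly below it.  Classically
-- these are exactly the Dedekind reals; constructively they are the
-- (finite) lower reals, since no locatedness is required.
record ℝ : Set₁ where
  field
    Below    : Pred ℚᵘ 0ℓ
    nonempty : ∃[ q ] Below q
    bounded  : ∃[ u ] (∀ {q} → Below q → q ℚ.≤ u)
    closed   : ∀ {p q} → p ℚ.< q → Below q → Below p
    open′    : ∀ {p} → Below p → ∃[ q ] (p ℚ.< q × Below q)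

open ℝ public

infix 4 _≤ʳ_
_≤ʳ_ : ℝ → ℝ → Set
x ≤ʳ y = Below x ⊆ Below y

private
  pred< : ∀ q → ∃[ p ] p ℚ.< q
  pred< q = q ℚ.- 1ℚᵘ ,
    ℚ.<-respʳ-≃ (ℚ.+-identityʳ q) (ℚ.+-monoʳ-< q (*<* ℤ.-<+))

sup : (S : Pred ℚᵘ 0ℓ) → ∃[ a ] S a → ∃[ u ] (∀ {a} → S a → a ℚ.≤ u) → ℝ
sup S (a , a∈S) (u , S≤u) = record
  { Below    = λ q → ∃[ b ] (S b × q ℚ.< b)
  ; nonempty = proj₁ (pred< a) , a , a∈S , proj₂ (pred< a)
  ; bounded  = u , λ (b , b∈S , q<b) → ℚ.≤-trans (ℚ.<⇒≤ q<b) (S≤u b∈S)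
  ; closed   = λ p<q (b , b∈S , q<b) → b , b∈S , ℚ.<-trans p<q q<b
  ; open′    = λ (b , b∈S , p<b) → let (m , p<m , m<b) = ℚ.<-dense p<b
                                   in m , p<m , b , b∈S , m<b
  }

fromℚ : ℚᵘ → ℝ
fromℚ r = record
  { Below    = ℚ._< r
  ; nonempty = pred< r
  ; bounded  = r , ℚ.<⇒≤
  ; closed   = ℚ.<-trans
  ; open′    = ℚ.<-dense
  }

fromℕ : ℕ → ℝ
fromℕ n = fromℚ (+ n ℚ./ 1)

infixl 6 _+ʳ_
_+ʳ_ : ℝ → ℝ → ℝ
x +ʳ y =
  let (a , a<x) = nonempty x ; (u , x≤u) = bounded x
      (b , b<y) = nonempty y ; (v , y≤v) = bounded y
  in sup (λ c → ∃[ a ] ∃[ b ] (Below x a × Below y b × c ≡ a ℚ.+ b))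
         (a ℚ.+ b , a , b , a<x , b<y , refl)
         (u ℚ.+ v , λ { (a , b , a<x , b<y , refl) → ℚ.+-mono-≤ (x≤u a<x) (y≤v b<y) })

-- Multiplication of a real by a positive rational.
infixl 7 _*ʳ_
_*ʳ_ : (c : ℚᵘ) → .{{Positive c}} → ℝ → ℝ
c *ʳ x =
  let (a , a<x) = nonempty x ; (u , x≤u) = bounded x
  in sup (λ b → ∃[ a ] (Below x a × b ≡ c ℚ.* a))
         (c ℚ.* a , a , a<x , refl)
         (c ℚ.* u , λ { (a , a<x , refl) →
            ℚ.*-monoʳ-≤-nonNeg c {{ℚ.pos⇒nonNeg c}} (x≤u a<x) })

open import Algebra.Properties.Semiring.Exp
  (CommutativeRing.semiring ℚ.+-*-commutativeRing)
  using (^-assocʳ) renaming (_^_ to infixr 8 _^_)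

infixr 8 _^ᶻ_
_^ᶻ_ : (b : ℚᵘ) → .{{Positive b}} → ℤ → ℚᵘ
b ^ᶻ (+ k)    = b ^ k
b ^ᶻ -[1+ k ] = (ℚ.1/ b) {{ℚ.pos⇒nonZero b}} ^ suc k

private
  ^-nonNeg : ∀ {a} k → 0ℚᵘ ℚ.≤ a → 0ℚᵘ ℚ.≤ a ^ k
  ^-nonNeg         zero    0≤a = *≤* (ℤ.+≤+ ℕ.z≤n)
  ^-nonNeg {a} (suc k) 0≤a =
    ℚ.nonNegative⁻¹ _ {{ℚ.nonNeg*nonNeg⇒nonNeg a {{ℚ.nonNegative 0≤a}}
                         (a ^ k) {{ℚ.nonNegative (^-nonNeg k 0≤a)}}}}

  ^-mono : ∀ {a b} k → 0ℚᵘ ℚ.≤ a → a ℚ.≤ b → a ^ k ℚ.≤ b ^ k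
  ^-mono             zero    0≤a a≤b = ℚ.≤-refl
  ^-mono {a} {b} (suc k) 0≤a a≤b =
    ℚ.*-mono-≤-nonNeg {{ℚ.nonNegative 0≤a}} {{ℚ.nonNegative (^-nonNeg k 0≤a)}}
      a≤b (^-mono k 0≤a a≤b)

  ^-mono-< : ∀ {a b} k → 0ℚᵘ ℚ.≤ a → a ℚ.< b → a ^ suc k ℚ.< b ^ suc k
  ^-mono-< {a} {b} k 0≤a a<b = ℚ.≤-<-trans
    (ℚ.*-monoʳ-≤-nonNeg a {{ℚ.nonNegative 0≤a}} (^-mono k 0≤a (ℚ.<⇒≤ a<b)))
    (ℚ.*-monoˡ-<-pos (b ^ k) {{^-pos k}} a<b)
    where
    0<b = ℚ.≤-<-trans 0≤a a<b
    ^-pos : ∀ k → Positive (b ^ k)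
    ^-pos zero    = _
    ^-pos (suc k) = ℚ.pos*pos⇒pos b {{ℚ.positive 0<b}} (b ^ k) {{^-pos k}}

  0≤1 : 0ℚᵘ ℚ.≤ 1ℚᵘ
  0≤1 = *≤* (ℤ.+≤+ ℕ.z≤n)

  1≤^ : ∀ {b} k → 1ℚᵘ ℚ.≤ b → 1ℚᵘ ℚ.≤ b ^ k
  1≤^     zero    1≤b = ℚ.≤-refl
  1≤^ {b} (suc k) 1≤b = ℚ.≤-trans 1≤b (ℚ.≤-trans
    (ℚ.≤-reflexive (ℚ.≃-sym (ℚ.*-identityʳ b)))
    (ℚ.*-monoʳ-≤-nonNeg b {{ℚ.nonNegative (ℚ.≤-trans 0≤1 1≤b)}} (1≤^ k 1≤b)))

  ^≤1 : ∀ {b} k → 0ℚᵘ ℚ.≤ b → b ℚ.≤ 1ℚᵘ → b ^ k ℚ.≤ 1ℚᵘ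
  ^≤1     zero    0≤b b≤1 = ℚ.≤-refl
  ^≤1 {b} (suc k) 0≤b b≤1 = ℚ.≤-trans
    (ℚ.*-monoʳ-≤-nonNeg b {{ℚ.nonNegative 0≤b}} (^≤1 k 0≤b b≤1))
    (ℚ.≤-trans (ℚ.≤-reflexive (ℚ.*-identityʳ b)) b≤1)

  ^-exp-mono : ∀ {b j k} → 1ℚᵘ ℚ.≤ b → j ℕ.≤ k → b ^ j ℚ.≤ b ^ k
  ^-exp-mono     {k = k} 1≤b ℕ.z≤n       = 1≤^ k 1≤b
  ^-exp-mono {b}         1≤b (ℕ.s≤s j≤k) =
    ℚ.*-monoʳ-≤-nonNeg b {{ℚ.nonNegative (ℚ.≤-trans 0≤1 1≤b)}} (^-exp-mono 1≤b j≤k)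

  root-≤ : ∀ {a b} k → 0ℚᵘ ℚ.≤ b → a ^ suc k ℚ.≤ b ^ suc k → a ℚ.≤ b
  root-≤ {a} {b} k 0≤b aᵏ≤bᵏ with a ℚ.≤? b
  ... | yes a≤b = a≤b
  ... | no  a≰b = ⊥-elim (ℚ.<⇒≱ (^-mono-< k 0≤b (ℚ.≰⇒> a≰b)) aᵏ≤bᵏ)

  ^ᶻ-nonNeg : ∀ b .{{_ : Positive b}} p → 0ℚᵘ ℚ.≤ b ^ᶻ p
  ^ᶻ-nonNeg b (+ k)    = ^-nonNeg k (ℚ.<⇒≤ (ℚ.positive⁻¹ b))
  ^ᶻ-nonNeg b -[1+ k ] = 
    ^-nonNeg {ℚ.1/ b} (suc k) (ℚ.<⇒≤ (ℚ.positive⁻¹ (ℚ.1/ b) {{ℚ.1/pos⇒pos b}}))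
    where instance _ = ℚ.pos⇒nonZero b

infix 4 _∈[0,_^_]
_∈[0,_^_] : ℚᵘ → (b : ℚᵘ) → .{{Positive b}} → ℚᵘ → Set
a ∈[0, b ^ r ] = 0ℚᵘ ℚ.≤ a × a ^ ↧ₙ r ℚ.≤ b ^ᶻ ↥ r

private
  0∈[0,^] : ∀ b .{{_ : Positive b}} r → 0ℚᵘ ∈[0, b ^ r ]
  0∈[0,^] b r@record{} = ℚ.≤-refl ,
    ℚ.≤-trans (ℚ.≤-reflexive (ℚ.*-zeroˡ (0ℚᵘ ^ ℚᵘ.denominator-1 r))) (^ᶻ-nonNeg b (↥ r))

-- b ^ᑫ (p / d) is the d-th root of b ^ᶻ p, the supremum of the a ≥ 0 with
-- a ^ d ≤ b ^ᶻ p.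
infixr 8 _^ᑫ_
_^ᑫ_ : (b : ℚᵘ) → .{{Positive b}} → ℚᵘ → ℝ
b ^ᑫ r = sup (_∈[0, b ^ r ]) (0ℚᵘ , 0∈[0,^] b r) (1ℚᵘ ℚ.+ c , bound r)
  where
  c = b ^ᶻ ↥ r
  0≤c = ^ᶻ-nonNeg b (↥ r)
  1≤1+c = ℚ.p≤p+q 1ℚᵘ c {{ℚ.nonNegative 0≤c}}
  c≤1+c = ℚ.p≤q+p c 1ℚᵘ
  bound : ∀ r' {a} → 0ℚᵘ ℚ.≤ a × a ^ ↧ₙ r' ℚ.≤ c → a ℚ.≤ 1ℚᵘ ℚ.+ c
  bound (mkℚᵘ _ d-1) {a} (0≤a , aᵈ≤c) with a ℚ.≤? 1ℚᵘ
  ... | yes a≤1 = ℚ.≤-trans a≤1 1≤1+c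
  ... | no  a≰1 = ℚ.≤-trans
    (ℚ.≤-trans (ℚ.≤-reflexive (ℚ.≃-sym (ℚ.*-identityʳ a)))
      (ℚ.≤-trans (^-exp-mono {a} {1} {suc d-1} (ℚ.<⇒≤ (ℚ.≰⇒> a≰1)) (ℕ.s≤s ℕ.z≤n)) aᵈ≤c))
    c≤1+c

ℕ⇒ℚ : ℕ → ℚᵘ
ℕ⇒ℚ n = + n ℚ./ 1

/-pos : ∀ n d .{{_ : NonZero n}} .{{_ : NonZero d}} → Positive (+ n ℚ./ d)
/-pos (suc _) (suc _) = _

private
  1≤ℕ⇒ℚ : ∀ n .{{_ : NonZero n}} → 1ℚᵘ ℚ.≤ ℕ⇒ℚ n
  1≤ℕ⇒ℚ (suc n) = *≤* (ℤ.+≤+ (ℕ.s≤s ℕ.z≤n))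

  numerator-bound : ∀ r m → r ℚ.≤ ℕ⇒ℚ m → ↥ r ℤ.≤ + (m ℕ.* ↧ₙ r)
  numerator-bound r@record{} m (*≤* h)
    rewrite ℤ.*-identityʳ (↥ r) | sym (ℤ.pos-* m (↧ₙ r)) = h

  ≤ℕ⇒ℚ : ∀ u → u ℚ.≤ ℕ⇒ℚ ℤ.∣ ↥ u ∣
  ≤ℕ⇒ℚ (mkℚᵘ -[1+ _ ] _) = *≤* ℤ.-≤+
  ≤ℕ⇒ℚ (mkℚᵘ (+ k) d-1) = *≤* (subst (ℤ._≤ + k ℤ.* + suc d-1) (sym (ℤ.*-identityʳ (+ k)))
    (subst (+ k ℤ.≤_) (ℤ.pos-* k (suc d-1)) (ℤ.+≤+ (ℕ.m≤m*n k (suc d-1)))))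

  ^ᶻ-≤ : ∀ b .{{_ : Positive b}} {p} k → 1ℚᵘ ℚ.≤ b → p ℤ.≤ + k → b ^ᶻ p ℚ.≤ b ^ k
  ^ᶻ-≤ b {+ j}      k 1≤b (ℤ.+≤+ j≤k) = ^-exp-mono 1≤b j≤k
  ^ᶻ-≤ b { -[1+ j ]} k 1≤b _ = ℚ.≤-trans (^≤1 {ℚ.1/ b} (suc j) 0≤1/b 1/b≤1) (1≤^ k 1≤b)
    where
    instance _ = ℚ.pos⇒nonZero b
    0≤1/b = ℚ.<⇒≤ (ℚ.positive⁻¹ (ℚ.1/ b) {{ℚ.1/pos⇒pos b}})
    1/b≤1 : ℚ.1/ b ℚ.≤ 1ℚᵘ
    1/b≤1 = ℚ.≤-trans (ℚ.≤-reflexive (ℚ.≃-sym (ℚ.*-identityʳ (ℚ.1/ b))))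
      (ℚ.≤-trans (ℚ.*-monoʳ-≤-nonNeg (ℚ.1/ b) {{ℚ.nonNegative 0≤1/b}} 1≤b)
        (ℚ.≤-reflexive (ℚ.*-inverseˡ b)))

-- n ^ʳ x is the supremum of the n ^ᑫ r over the rationals r ≤ x.
infixr 8 _^ʳ_
_^ʳ_ : (n : ℕ) → .{{NonZero n}} → ℝ → ℝ
n ^ʳ x = sup S nonempty-S (b ^ N , bound)
  where
  b = ℕ⇒ℚ n
  instance _ = /-pos n 1
  S : Pred ℚᵘ 0ℓ
  S a = ∃[ r ] (fromℚ r ≤ʳ x × a ∈[0, b ^ r ])
  u = proj₁ (bounded x)
  N = ℤ.∣ ↥ u ∣
  nonempty-S : ∃[ a ] S a
  nonempty-S = let (r , r<x) = nonempty x in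
    0ℚᵘ , r , (λ q<r → closed x q<r r<x) , 0∈[0,^] b r
  r≤u : ∀ r → fromℚ r ≤ʳ x → r ℚ.≤ u
  r≤u r r≤x with r ℚ.≤? u
  ... | yes r≤u = r≤u
  ... | no  r≰u = let (m , u<m , m<r) = ℚ.<-dense (ℚ.≰⇒> r≰u) in
    ⊥-elim (ℚ.<⇒≱ u<m (proj₂ (bounded x) (r≤x m<r)))
  bound : ∀ {a} → S a → a ℚ.≤ b ^ N
  bound {a} (r@record{} , r≤x , _ , aᵈ≤bᵖ) =
    root-≤ (ℚᵘ.denominator-1 r) (^-nonNeg N (ℚ.<⇒≤ (ℚ.positive⁻¹ b)))
      (ℚ.≤-trans aᵈ≤bᵖ
        (ℚ.≤-trans (^ᶻ-≤ b (N ℕ.* ↧ₙ r) (1≤ℕ⇒ℚ n)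
                     (numerator-bound r N (ℚ.≤-trans (r≤u r r≤x) (≤ℕ⇒ℚ u))))
          (ℚ.≤-reflexive (ℚ.≃-sym (^-assocʳ b N (↧ₙ r))))))

private
  ℕ⇒ℚ-^ : ∀ n k → ℕ⇒ℚ n ^ k ℚ.≃ ℕ⇒ℚ (n ℕ.^ k)
  ℕ⇒ℚ-^ n zero    = ℚ.≃-refl
  ℕ⇒ℚ-^ n (suc k) = ℚ.≃-trans (ℚ.*-congˡ (ℕ⇒ℚ-^ n k))
    (ℚ.≃-reflexive (cong (λ i → mkℚᵘ i 0) (sym (ℤ.pos-* n (n ℕ.^ k)))))

  ℕ⇒ℚ-cancel-≤ : ∀ {i j} → ℕ⇒ℚ i ℚ.≤ ℕ⇒ℚ j → i ℕ.≤ j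
  ℕ⇒ℚ-cancel-≤ {i} {j} (*≤* h)
    rewrite ℤ.*-identityʳ (+ i) | ℤ.*-identityʳ (+ j) = ℤ.drop‿+≤+ h

  n<2^n : ∀ n → n ℕ.< 2 ℕ.^ n
  n<2^n zero    = ℕ.s≤s ℕ.z≤n
  n<2^n (suc n) = ℕ.+-mono-≤ (ℕ.m^n>0 2 n) (ℕ.≤-trans (n<2^n n) (ℕ.m≤m+n _ 0))

  2^p≤n^d⇒p≤n*d : ∀ n p d → 2 ℕ.^ p ℕ.≤ n ℕ.^ d → p ℕ.≤ n ℕ.* d
  2^p≤n^d⇒p≤n*d n p d h with p ℕ.≤? n ℕ.* d
  ... | yes p≤nd = p≤nd
  ... | no  p≰nd = ⊥-elim (ℕ.<⇒≱ (ℕ.^-monoʳ-< 2 (ℕ.s≤s (ℕ.s≤s ℕ.z≤n)) (ℕ.≰⇒> p≰nd))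
    (ℕ.≤-trans h (ℕ.≤-trans (ℕ.^-monoˡ-≤ d (ℕ.<⇒≤ (n<2^n n)))
      (ℕ.≤-reflexive (ℕ.^-*-assoc 2 n d)))))

-- lg n is the supremum of the rationals p / d with 2 ^ᶻ p ≤ n ^ d.
lg : (n : ℕ) → .{{NonZero n}} → ℝ
lg n = sup S (0ℚᵘ , 1≤^ 1 (1≤ℕ⇒ℚ n)) (ℕ⇒ℚ n , λ {r} → bound r)
  where
  S : Pred ℚᵘ 0ℓ
  S r = ℕ⇒ℚ 2 ^ᶻ ↥ r ℚ.≤ ℕ⇒ℚ n ^ ↧ₙ r
  bound : ∀ r → S r → r ℚ.≤ ℕ⇒ℚ n
  bound (mkℚᵘ -[1+ k ] d-1) _ = ℚ.≤-trans {j = 0ℚᵘ} (*≤* ℤ.-≤+) (ℚ.≤-trans 0≤1 (1≤ℕ⇒ℚ n))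
  bound (mkℚᵘ (+ p) d-1) 2ᵖ≤nᵈ = *≤* (subst (ℤ._≤ + n ℤ.* + d) (sym (ℤ.*-identityʳ (+ p)))
    (subst (+ p ℤ.≤_) (ℤ.pos-* n d) (ℤ.+≤+ (2^p≤n^d⇒p≤n*d n p d
      (ℕ⇒ℚ-cancel-≤ (ℚ.≤-trans (ℚ.≤-reflexive (ℚ.≃-sym (ℕ⇒ℚ-^ 2 p)))
        (ℚ.≤-trans 2ᵖ≤nᵈ (ℚ.≤-reflexive (ℕ⇒ℚ-^ n d)))))))))
    where d = suc d-1

-- Edges are given by a Boolean adjacency matrix, so graphs are finite objects
-- and adjacency is decidable.
Graph : ℕ → Set
Graph N = Fin N → Fin N → Bool

Edge : ∀ {N} → Graph N → Fin N → Fin N → Set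
Edge G u v = T (G u v)

record Network (N : ℕ) : Set where
  field
    size    : ℕ
    #edges  : ℕ
    ends    : Fin #edges → Fin size × Fin size
    source  : Fin size
    target  : Fin size
    label   : Fin #edges → Σ (Fin N × Fin N) λ (v₁ , v₂) → v₁ ≢ v₂

  Joins : Fin #edges → Fin size → Fin size → Set
  Joins e x y = ends e ≡ (x , y) ⊎ ends e ≡ (y , x)

  Traversable : Graph N → Fin size → Fin size → Set
  Traversable G x y =
    ∃[ e ] (Joins e x y × Edge G (proj₁ (proj₁ (label e))) (proj₂ (proj₁ (label e))))

  Accepts : Graph N → Set
  Accepts G = Star (Traversable G) source target

open Network public using (size; Accepts)

module _ {N : ℕ} (s t : Fin N) where

  Sound : Network N → Set
  Sound net = ∀ G → ¬ Star (Edge G) s t → ¬ Accepts net G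

  Solves : Pred (Graph N) 0ℓ → Network N → Set
  Solves I net = Sound net × (∀ {G} → I G → Accepts net G)

  -- The relation m(I) = k.
  record IsMinimumSize (I : Pred (Graph N) 0ℓ) (k : ℕ) : Set where
    field
      attained : ∃[ net ] (Solves I net × size net ≡ k)
      minimal  : ∀ net → Solves I net → k ℕ.≤ size net

  record 𝒫 (l : ℕ) (G : Graph N) : Set where
    field
      v         : Fin (suc l) → Fin N
      starts    : v zero ≡ s
      finishes  : v (Fin.fromℕ l) ≡ t
      distinct  : Injective _≡_ _≡_ v
      edges     : ∀ a b → Edge G a b ⇔ (∃[ i ] (a ≡ v (inject₁ i) × b ≡ v (suc i)))

  𝒫≤ : ℕ → Pred (Graph N) 0ℓ
  𝒫≤ l G = ∃[ j ] (1 ℕ.≤ j × j ℕ.≤ l × 𝒫 j G)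

64[l-1]²≢0 : ∀ l .{{_ : NonTrivial l}} → NonZero (64 ℕ.* (l ℕ.∸ 1) ℕ.^ 2)
64[l-1]²≢0 (ℕ.2+ _) = _

-- Lower bound.  Fix a sound network with z vertices that accepts all paths of
-- length l.  For a vertex x of it and a cut y of the inner vertices into a left
-- and a right side, let J x y ∈ {0, 1} tell whether x is reached on the input that
-- has every edge except those from left to right.  Then J is 1 at the source and 0
-- at the target, and along an edge labelled u → v it changes only on cuts with u on
-- the left and v on the right.  Arrange the inner vertices in L = l - 1 columns of
-- m vertices and let φ pick a path through one vertex of each column.  Let
-- 2 ^ k ≤ L.  Configurations of the reversible pebble game with k pebbles on φ
-- yield a linear functional that separates the constants 1 and 0, and that changes
-- along the accepting walk only by mixed differences of J of order k + 1 in the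
-- directions of φ.  These are Fourier coefficients of J: Bessel's inequality for
-- the single vertices of a column, tensored over the columns, makes their mean
-- square over φ of order m ^ -(k + 1).  A simple walk meets each vertex once, so z
-- must be of order m ^ ((k + 1) / 2).
--
-- Upper bound.  With k = ⌈ lg l ⌉ pebbles the reversible pebble game reaches
-- distance 2 ^ k.  Its nonempty configurations are the sets of entries of the
-- n ^ k tuples of k inner vertices; s′ is the empty one and t′ the accepting one.
--
-- Minimal sizes exist because networks with a given number of vertices are,
-- up to the inputs they accept, finitely many Boolean tables.
--
-- For paths of all lengths, take l = ⌊ n ^ (1/4) ⌋ + 1 below and l = n + 1 above.

module Submission where

-- Let `H` be the change of `J` along a path edge into vertex `j`. `H` vanishes on cuts with `j` on
-- the left, so its mixed differences at `U` and `U ∪ {j}` are opposite; it vanishes on cuts with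
-- the predecessor on the right, so they are zero unless the predecessor lies in `U`. Coefficients
-- that are constant under reversible pebble moves therefore annihilate `H`. With unlimited pebbles
-- every `U` would be reachable and the edge into `t` need not be annihilated; the limit `k` keeps
-- the last column empty, as `2 ^ k ≤ L`, and the moves it forbids cost differences of order
-- `k + 1`. This cost involves `J` at single network vertices, so a simple walk can charge it to its
-- vertices. For one `φ` a few vertices might carry all of it; Bessel's inequality excludes this on
-- average over `φ`. In `64 (l - 1)²` one factor `L` stems from the at most `L ^ (k + 1)` sets `U`
-- of size `k + 1`, the other from `m = n / L`. The number 64 is `8 · 2 · 4`: 8 is the weight of a
-- face sum, 2 pays for rounding `n / L`, and 4 absorbs the factor 2 by which `(m + 2) ^ L` may
-- exceed `m ^ L`.

-- Finite sums of integers

module CubeSums where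

  open import Data.Bool using (Bool; true; false)
  open import Data.Fin using (Fin; zero; suc)
  open import Data.Integer using (ℤ; +_; -[1+_]; 0ℤ; 1ℤ; _+_; _*_; _-_; -_; _≤_; +≤+)
  open import Data.Integer.Properties
  open import Data.Integer.Tactic.RingSolver using (solve-∀)
  open import Data.List using (List; []; _∷_; map; concatMap; length; allFin; _++_)
  open import Data.List.Properties using (map-tabulate; length-tabulate)
  open import Data.Nat as ℕ using (ℕ; zero; suc)
  open import Data.Vec using (Vec; []; _∷_; lookup; _[_]≔_; replicate)
  open import Function using (_∘_; id)
  open import Relation.Binary.PropositionalEquality

  ∑ : {A : Set} → List A → (A → ℤ) → ℤ
  ∑ []       f = 0ℤ
  ∑ (x ∷ xs) f = f x + ∑ xs f

  infix 10 _²
  _² : ℤ → ℤ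
  i ² = i * i

  module _ {A : Set} where

    ∑-cong : ∀ (xs : List A) {f g} → (∀ x → f x ≡ g x) → ∑ xs f ≡ ∑ xs g
    ∑-cong []       f≡g = refl
    ∑-cong (x ∷ xs) f≡g = cong₂ _+_ (f≡g x) (∑-cong xs f≡g)

    ∑-mono : ∀ (xs : List A) {f g} → (∀ x → f x ≤ g x) → ∑ xs f ≤ ∑ xs g
    ∑-mono []       f≤g = ≤-refl
    ∑-mono (x ∷ xs) f≤g = +-mono-≤ (f≤g x) (∑-mono xs f≤g)

    ∑-zero : ∀ (xs : List A) {f} → (∀ x → f x ≡ 0ℤ) → ∑ xs f ≡ 0ℤ
    ∑-zero []       f≡0 = refl
    ∑-zero (x ∷ xs) f≡0 = cong₂ _+_ (f≡0 x) (∑-zero xs f≡0)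

    ∑-nonNeg : ∀ (xs : List A) {f} → (∀ x → 0ℤ ≤ f x) → 0ℤ ≤ ∑ xs f
    ∑-nonNeg xs {f} 0≤f = subst (_≤ ∑ xs f) (∑-zero xs {λ _ → 0ℤ} (λ _ → refl)) (∑-mono xs 0≤f)

    ∑-+ : ∀ (xs : List A) (f g : A → ℤ) → ∑ xs (λ x → f x + g x) ≡ ∑ xs f + ∑ xs g
    ∑-+ []       f g = refl
    ∑-+ (x ∷ xs) f g = trans (cong (_+_ (f x + g x)) (∑-+ xs f g)) (lemma (f x) (g x) (∑ xs f) (∑ xs g))
      where
      lemma : ∀ a b c d → a + b + (c + d) ≡ a + c + (b + d)
      lemma = solve-∀

    ∑-* : ∀ (xs : List A) c (f : A → ℤ) → ∑ xs (λ x → c * f x) ≡ c * ∑ xs f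
    ∑-* []       c f = sym (*-zeroʳ c)
    ∑-* (x ∷ xs) c f = trans (cong (_+_ (c * f x)) (∑-* xs c f)) (sym (*-distribˡ-+ c (f x) _))

    ∑-minus : ∀ (xs : List A) (f g : A → ℤ) → ∑ xs (λ x → f x - g x) ≡ ∑ xs f - ∑ xs g
    ∑-minus []       f g = refl
    ∑-minus (x ∷ xs) f g = trans (cong (_+_ (f x - g x)) (∑-minus xs f g)) (lemma (f x) (g x) (∑ xs f) (∑ xs g))
      where
      lemma : ∀ a b c d → a - b + (c - d) ≡ a + c - (b + d)
      lemma = solve-∀

    ∑-const : ∀ (xs : List A) c → ∑ xs (λ _ → c) ≡ + length xs * c
    ∑-const []       c = refl
    ∑-const (x ∷ xs) c = trans (cong (_+_ c) (∑-const xs c)) (sym (suc-* (+ length xs) c))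

    ∑-++ : ∀ (xs ys : List A) f → ∑ (xs ++ ys) f ≡ ∑ xs f + ∑ ys f
    ∑-++ []       ys f = sym (+-identityˡ _)
    ∑-++ (x ∷ xs) ys f = trans (cong (_+_ (f x)) (∑-++ xs ys f)) (sym (+-assoc (f x) _ _))

  ∑-map : ∀ {A B : Set} (h : A → B) xs f → ∑ (map h xs) f ≡ ∑ xs (f ∘ h)
  ∑-map h []       f = refl
  ∑-map h (x ∷ xs) f = cong (_+_ (f (h x))) (∑-map h xs f)

  ∑-concatMap : ∀ {A B : Set} (h : A → List B) xs f → ∑ (concatMap h xs) f ≡ ∑ xs (λ x → ∑ (h x) f)
  ∑-concatMap h []       f = refl
  ∑-concatMap h (x ∷ xs) f = trans (∑-++ (h x) _ f) (cong (_+_ (∑ (h x) f)) (∑-concatMap h xs f))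

  ∑-swap : ∀ {A B : Set} (xs : List A) (ys : List B) (f : A → B → ℤ) →
           ∑ xs (λ x → ∑ ys (f x)) ≡ ∑ ys (λ y → ∑ xs (λ x → f x y))
  ∑-swap []       ys f = sym (∑-zero ys λ _ → refl)
  ∑-swap (x ∷ xs) ys f = trans (cong (_+_ (∑ ys (f x))) (∑-swap xs ys f))
    (sym (∑-+ ys (f x) (λ y → ∑ xs (λ x → f x y))))

  0≤i² : ∀ i → 0ℤ ≤ i ²
  0≤i² (+ zero)  = +≤+ ℕ.z≤n
  0≤i² (+ suc n) = +≤+ ℕ.z≤n
  0≤i² -[1+ n ]  = +≤+ ℕ.z≤n

  2ab≤a²+b² : ∀ a b → + 2 * a * b ≤ a ² + b ²
  2ab≤a²+b² a b = 0≤i-j⇒j≤i (subst (0ℤ ≤_) (lemma a b) (0≤i² (a - b)))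
    where
    lemma : ∀ a b → (a - b) * (a - b) ≡ a * a + b * b - + 2 * a * b
    lemma = solve-∀

  -- In the induction the cross term is split summand by summand with `2ab≤a²+b²`, so neither
  -- division nor square roots occur.
  cauchy-schwarz : ∀ {A : Set} (xs : List A) (f g : A → ℤ) →
                   (∑ xs (λ x → f x * g x)) ² ≤ ∑ xs (λ x → f x ²) * ∑ xs (λ x → g x ²)
  cauchy-schwarz []       f g = ≤-refl
  cauchy-schwarz {A} (x ∷ xs) f g = begin
    (a * b + s) ²                             ≡⟨ e₁ a b s ⟩
    (a * b) ² + (+ 2 * a * b * s + s ²)       ≤⟨ +-monoʳ-≤ ((a * b) ²) (+-mono-≤ cross (cauchy-schwarz xs f g)) ⟩
    (a * b) ² + (a ² * q + b ² * p + p * q)   ≡⟨ e₂ a b p q ⟩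
    (a ² + p) * (b ² + q)                     ∎
    where
    open ≤-Reasoning
    a = f x
    b = g x
    s = ∑ xs (λ x → f x * g x)
    p = ∑ xs (λ x → f x ²)
    q = ∑ xs (λ x → g x ²)
    e₁ : ∀ a b s → (a * b + s) * (a * b + s) ≡ (a * b) * (a * b) + (+ 2 * a * b * s + s * s)
    e₁ = solve-∀
    e₂ : ∀ a b p q → (a * b) * (a * b) + (a * a * q + b * b * p + p * q) ≡ (a * a + p) * (b * b + q)
    e₂ = solve-∀
    e₃ : ∀ a b u v → + 2 * a * b * (u * v) ≡ + 2 * (a * v) * (b * u)
    e₃ = solve-∀
    e₄ : ∀ a v → (a * v) * (a * v) ≡ a * a * (v * v)
    e₄ = solve-∀
    cross : + 2 * a * b * s ≤ a ² * q + b ² * p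
    cross = begin
      + 2 * a * b * s                                      ≡⟨ ∑-* xs (+ 2 * a * b) (λ x → f x * g x) ⟨
      ∑ xs (λ y → + 2 * a * b * (f y * g y))               ≤⟨ ∑-mono xs (λ y → ≤-trans
                                                                (≤-reflexive (e₃ a b (f y) (g y)))
                                                                (2ab≤a²+b² (a * g y) (b * f y))) ⟩
      ∑ xs (λ y → (a * g y) ² + (b * f y) ²)               ≡⟨ ∑-cong xs (λ y → cong₂ _+_ (e₄ a (g y)) (e₄ b (f y))) ⟩
      ∑ xs (λ y → a ² * (g y) ² + b ² * (f y) ²)           ≡⟨ ∑-+ xs _ _ ⟩
      ∑ xs (λ y → a ² * (g y) ²) + ∑ xs (λ y → b ² * (f y) ²) ≡⟨ cong₂ _+_ (∑-* xs (a ²) _) (∑-* xs (b ²) _) ⟩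
      a ² * q + b ² * p                                    ∎

  ∑²≤length*∑² : ∀ {A : Set} (xs : List A) (f : A → ℤ) → (∑ xs f) ² ≤ + length xs * ∑ xs (λ x → f x ²)
  ∑²≤length*∑² xs f = begin
    (∑ xs f) ²                                    ≡⟨ cong _² (∑-cong xs (λ x → *-identityˡ (f x))) ⟨
    (∑ xs (λ x → 1ℤ * f x)) ²                     ≤⟨ cauchy-schwarz xs (λ _ → 1ℤ) f ⟩
    ∑ xs (λ _ → 1ℤ) * ∑ xs (λ x → f x ²)          ≡⟨ cong (_* ∑ xs (λ x → f x ²)) (trans (∑-const xs 1ℤ) (*-identityʳ (+ length xs))) ⟩
    + length xs * ∑ xs (λ x → f x ²)              ∎
    where open ≤-Reasoning

  bools : List Bool
  bools = false ∷ true ∷ []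

  vecs : ∀ {A : Set} → List A → ∀ n → List (Vec A n)
  vecs xs zero    = [] ∷ []
  vecs xs (suc n) = concatMap (λ x → map (x ∷_) (vecs xs n)) xs

  ∑-vecs : ∀ {A : Set} (xs : List A) n f →
           ∑ (vecs xs (suc n)) f ≡ ∑ xs (λ x → ∑ (vecs xs n) (λ v → f (x ∷ v)))
  ∑-vecs xs n f = trans (∑-concatMap _ xs f) (∑-cong xs (λ x → ∑-map (x ∷_) (vecs xs n) f))

  ∑-allFin : ∀ m f → ∑ (allFin (suc m)) f ≡ f zero + ∑ (allFin m) (f ∘ suc)
  ∑-allFin m f = cong (_+_ (f zero))
    (trans (cong (λ xs → ∑ xs f) (sym (map-tabulate id suc))) (∑-map suc (allFin m) f))

  -- Bessel's inequality for the single vertices of one column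

  cube : ∀ m → List (Vec Bool m)
  cube = vecs bools

  ∑-cube : ∀ m f → ∑ (cube (suc m)) f ≡ ∑ (cube m) (f ∘ (false ∷_)) + ∑ (cube m) (f ∘ (true ∷_))
  ∑-cube m f = trans (∑-vecs bools m f) (cong (_+_ (∑ (cube m) (f ∘ (false ∷_)))) (+-identityʳ _))

  2^_ : ℕ → ℤ
  2^ m = + (2 ℕ.^ m)

  2^-suc : ∀ m → 2^ (suc m) ≡ + 2 * 2^ m
  2^-suc m = pos-* 2 (2 ℕ.^ m)

  δ : Bool → Bool → ℤ
  δ false false = 1ℤ
  δ false true  = 0ℤ
  δ true  false = 0ℤ
  δ true  true  = 1ℤ

  face : ∀ {m} → Bool → Fin m → (Vec Bool m → ℤ) → ℤ
  face {m} b p h = ∑ (cube m) (λ y → δ b (lookup y p) * h y)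

  face-false-zero : ∀ {m} (h : Vec Bool (suc m) → ℤ) → face false zero h ≡ ∑ (cube m) (h ∘ (false ∷_))
  face-false-zero {m} h = trans (∑-cube m _) (trans
    (cong₂ _+_ (∑-cong (cube m) (λ y → *-identityˡ (h (false ∷ y)))) (∑-zero (cube m) (λ y → *-zeroˡ (h (true ∷ y)))))
    (+-identityʳ (∑ (cube m) (h ∘ (false ∷_)))))

  face-true-zero : ∀ {m} (h : Vec Bool (suc m) → ℤ) → face true zero h ≡ ∑ (cube m) (h ∘ (true ∷_))
  face-true-zero {m} h = trans (∑-cube m _) (trans
    (cong₂ _+_ (∑-zero (cube m) (λ y → *-zeroˡ (h (false ∷ y)))) (∑-cong (cube m) (λ y → *-identityˡ (h (true ∷ y)))))
    (+-identityˡ (∑ (cube m) (h ∘ (true ∷_)))))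

  face-suc : ∀ {m} b (p : Fin m) h → face b (suc p) h ≡ face b p (h ∘ (false ∷_)) + face b p (h ∘ (true ∷_))
  face-suc {m} b p h = ∑-cube m _

  faces-total : ∀ {m} (p : Fin m) h → face false p h + face true p h ≡ ∑ (cube m) h
  faces-total {m} p h = trans (sym (∑-+ (cube m) _ _)) (∑-cong (cube m) (λ y → split (lookup y p) (h y)))
    where
    split : ∀ b i → δ false b * i + δ true b * i ≡ i
    split false i = trans (cong₂ _+_ (*-identityˡ i) (*-zeroˡ i)) (+-identityʳ i)
    split true  i = trans (cong₂ _+_ (*-zeroˡ i) (*-identityˡ i)) (+-identityˡ i)

  -- The unnormalised Fourier coefficient at the character of the single vertex `p`.
  χ̂ : ∀ {m} → Fin m → (Vec Bool m → ℤ) → ℤ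
  χ̂ p h = face false p h - face true p h

  -- Split the cube at its first coordinate. The sum and the coefficient at `zero` are `S₀ + S₁` and
  -- `S₀ - S₁`, whose squares add up to `2 (S₀² + S₁²)`; every other coefficient is the sum of those
  -- of the halves, so its square is at most twice the sum of theirs. The factor 2 is the one in
  -- `2^ (suc m)`.
  bessel : ∀ m (h : Vec Bool m → ℤ) →
           (∑ (cube m) h) ² + ∑ (allFin m) (λ p → (χ̂ p h) ²) ≤ 2^ m * ∑ (cube m) (λ y → h y ²)
  bessel zero    h = ≤-reflexive (lemma (h []))
    where
    lemma : ∀ a → (a + 0ℤ) * (a + 0ℤ) + 0ℤ ≡ 1ℤ * (a * a + 0ℤ)
    lemma = solve-∀
  bessel (suc m) h = begin
    (∑ (cube (suc m)) h) ² + ∑ (allFin (suc m)) (λ p → (χ̂ p h) ²)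
      ≡⟨ cong₂ _+_ (cong _² (∑-cube m h)) (∑-allFin m (λ p → (χ̂ p h) ²)) ⟩
    (S₀ + S₁) ² + ((χ̂ zero h) ² + ∑ (allFin m) (λ p → (χ̂ (suc p) h) ²))
      ≡⟨ cong (_+_ ((S₀ + S₁) ²)) (cong₂ _+_
           (cong _² (cong₂ _-_ (face-false-zero h) (face-true-zero h)))
           (∑-cong (allFin m) (λ p → cong _² (χ̂-suc p)))) ⟩
    (S₀ + S₁) ² + ((S₀ - S₁) ² + ∑ (allFin m) (λ p → (χ̂ p h₀ + χ̂ p h₁) ²))
      ≤⟨ +-monoʳ-≤ ((S₀ + S₁) ²) (+-monoʳ-≤ ((S₀ - S₁) ²) (∑-mono (allFin m) (λ p → sq (χ̂ p h₀) (χ̂ p h₁)))) ⟩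
    (S₀ + S₁) ² + ((S₀ - S₁) ² + ∑ (allFin m) (λ p → + 2 * (χ̂ p h₀) ² + + 2 * (χ̂ p h₁) ²))
      ≡⟨ cong (λ z → (S₀ + S₁) ² + ((S₀ - S₁) ² + z)) (trans (∑-+ (allFin m) _ _)
           (cong₂ _+_ (∑-* (allFin m) (+ 2) (λ p → (χ̂ p h₀) ²)) (∑-* (allFin m) (+ 2) (λ p → (χ̂ p h₁) ²)))) ⟩
    (S₀ + S₁) ² + ((S₀ - S₁) ² + (+ 2 * C₀ + + 2 * C₁))
      ≡⟨ e₁ S₀ S₁ C₀ C₁ ⟩
    + 2 * (S₀ ² + C₀) + + 2 * (S₁ ² + C₁)
      ≤⟨ +-mono-≤ (*-monoˡ-≤-nonNeg (+ 2) (bessel m h₀)) (*-monoˡ-≤-nonNeg (+ 2) (bessel m h₁)) ⟩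
    + 2 * (2^ m * Q₀) + + 2 * (2^ m * Q₁)
      ≡⟨ e₂ (2^ m) Q₀ Q₁ ⟩
    + 2 * 2^ m * (Q₀ + Q₁)
      ≡⟨ cong₂ _*_ (2^-suc m) (∑-cube m (λ y → h y ²)) ⟨
    2^ (suc m) * ∑ (cube (suc m)) (λ y → h y ²) ∎
    where
    open ≤-Reasoning
    h₀ = h ∘ (false ∷_)
    h₁ = h ∘ (true ∷_)
    S₀ = ∑ (cube m) h₀
    S₁ = ∑ (cube m) h₁
    C₀ = ∑ (allFin m) (λ p → (χ̂ p h₀) ²)
    C₁ = ∑ (allFin m) (λ p → (χ̂ p h₁) ²)
    Q₀ = ∑ (cube m) (λ y → h₀ y ²)
    Q₁ = ∑ (cube m) (λ y → h₁ y ²)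
    e₀ : ∀ a b c d → (a + b) - (c + d) ≡ (a - c) + (b - d)
    e₀ = solve-∀
    χ̂-suc : ∀ p → χ̂ (suc p) h ≡ χ̂ p h₀ + χ̂ p h₁
    χ̂-suc p = trans (cong₂ _-_ (face-suc false p h) (face-suc true p h)) (e₀ (face false p h₀) (face false p h₁) (face true p h₀) (face true p h₁))
    e₁ : ∀ a b c d → (a + b) * (a + b) + ((a - b) * (a - b) + (+ 2 * c + + 2 * d)) ≡ + 2 * (a * a + c) + + 2 * (b * b + d)
    e₁ = solve-∀
    e₂ : ∀ a b c → + 2 * (a * b) + + 2 * (a * c) ≡ + 2 * a * (b + c)
    e₂ = solve-∀
    e₃ : ∀ a b → a * a + b * b + (a * a + b * b) ≡ + 2 * (a * a) + + 2 * (b * b)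
    e₃ = solve-∀
    e₄ : ∀ a b → (a + b) * (a + b) ≡ a * a + b * b + + 2 * a * b
    e₄ = solve-∀
    sq : ∀ a b → (a + b) ² ≤ + 2 * a ² + + 2 * b ²
    sq a b = begin
      (a + b) ²                          ≡⟨ e₄ a b ⟩
      a ² + b ² + + 2 * a * b            ≤⟨ +-monoʳ-≤ (a ² + b ²) (2ab≤a²+b² a b) ⟩
      a ² + b ² + (a ² + b ²)            ≡⟨ e₃ a b ⟩
      + 2 * a ² + + 2 * b ²              ∎

  length-allFin : ∀ m → length (allFin m) ≡ m
  length-allFin m = length-tabulate {n = m} id

  op : ∀ {m} → Bool → Fin m → (Vec Bool m → ℤ) → ℤ
  op false p h = face false p h
  op true  p h = face true p h - face false p h

  -- Up to a constant, Bessel bounds the sum over all `p` of the squared differences by what bounds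
  -- a single squared face sum; hence differences can carry the weight `m`. The 8 is `2 · 2²` and
  -- clears the halves in the face sums.
  weight : ℕ → Bool → ℤ
  weight m false = + 8
  weight m true  = + m

  -- a denotes the sum of h over the cube and bₚ = χ̂ p h, so that
  -- face false p h = (a + bₚ) / 2 and op true p h = - bₚ.
  column-bound : ∀ m (h : Vec Bool m → ℤ) →
    ∑ (allFin m) (λ p → ∑ bools (λ b → weight m b * (op b p h) ²)) ≤
    + (2 ℕ.* m ℕ.+ 4) * 2^ m * ∑ (cube m) (λ y → h y ²)
  column-bound m h = begin
    ∑ (allFin m) (λ p → ∑ bools (λ b → weight m b * (op b p h) ²))
      ≡⟨ ∑-cong (allFin m) (λ p → e₁ (face false p h) (face true p h) (+ m) a (faces-total p h)) ⟩
    ∑ (allFin m) (λ p → + 2 * a ² + (+ 4 * a * χ̂ p h + (+ m + + 2) * (χ̂ p h) ²))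
      ≡⟨ trans (∑-+ (allFin m) _ _) (cong₂ _+_ (∑-const (allFin m) (+ 2 * a ²))
           (trans (∑-+ (allFin m) _ _) (cong₂ _+_ (∑-* (allFin m) (+ 4 * a) (λ p → χ̂ p h))
             (∑-* (allFin m) (+ m + + 2) (λ p → (χ̂ p h) ²))))) ⟩
    + length (allFin m) * (+ 2 * a ²) + (+ 4 * a * B₁ + (+ m + + 2) * B₂)
      ≤⟨ +-mono-≤ (≤-reflexive (cong (λ k → + k * (+ 2 * a ²)) (length-allFin m)))
           (+-monoˡ-≤ ((+ m + + 2) * B₂) cross) ⟩
    + m * (+ 2 * a ²) + (+ 4 * a ² + + m * B₂ + (+ m + + 2) * B₂)
      ≡⟨ e₃ (+ m) a B₂ ⟩
    (+ 2 * + m + + 4) * a ² + (+ 2 * + m + + 2) * B₂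
      ≤⟨ +-monoʳ-≤ ((+ 2 * + m + + 4) * a ²) (≤-trans (≤-reflexive (sym (+-identityʳ ((+ 2 * + m + + 2) * B₂))))
           (≤-trans (+-monoʳ-≤ ((+ 2 * + m + + 2) * B₂)
             (*-monoˡ-≤-nonNeg (+ 2) (∑-nonNeg (allFin m) (λ p → 0≤i² (χ̂ p h))))) (≤-reflexive (e₄ (+ m) B₂)))) ⟩
    (+ 2 * + m + + 4) * a ² + (+ 2 * + m + + 4) * B₂
      ≡⟨ *-distribˡ-+ (+ 2 * + m + + 4) (a ²) B₂ ⟨
    (+ 2 * + m + + 4) * (a ² + B₂)
      ≡⟨ cong (λ z → (z + + 4) * (a ² + B₂)) (pos-* 2 m) ⟨
    + (2 ℕ.* m ℕ.+ 4) * (a ² + B₂)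
      ≤⟨ *-monoˡ-≤-nonNeg (+ (2 ℕ.* m ℕ.+ 4)) (bessel m h) ⟩
    + (2 ℕ.* m ℕ.+ 4) * (2^ m * ∑ (cube m) (λ y → h y ²))
      ≡⟨ *-assoc (+ (2 ℕ.* m ℕ.+ 4)) (2^ m) (∑ (cube m) (λ y → h y ²)) ⟨
    + (2 ℕ.* m ℕ.+ 4) * 2^ m * ∑ (cube m) (λ y → h y ²) ∎
    where
    open ≤-Reasoning
    a = ∑ (cube m) h
    B₁ = ∑ (allFin m) (λ p → χ̂ p h)
    B₂ = ∑ (allFin m) (λ p → (χ̂ p h) ²)
    e₁′ : ∀ f t m → + 8 * (f * f) + (m * ((t - f) * (t - f)) + 0ℤ) ≡
          + 2 * ((f + t) * (f + t)) + (+ 4 * (f + t) * (f - t) + (m + + 2) * ((f - t) * (f - t)))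
    e₁′ = solve-∀
    e₁ : ∀ f t m a → f + t ≡ a → + 8 * f ² + (m * (t - f) ² + 0ℤ) ≡
         + 2 * a ² + (+ 4 * a * (f - t) + (m + + 2) * (f - t) ²)
    e₁ f t m .(f + t) refl = e₁′ f t m
    e₂ : ∀ a b → + 4 * a * b ≡ + 2 * (+ 2 * a) * b
    e₂ = solve-∀
    e₂′ : ∀ a → (+ 2 * a) * (+ 2 * a) ≡ + 4 * (a * a)
    e₂′ = solve-∀
    e₃ : ∀ m a b → m * (+ 2 * (a * a)) + (+ 4 * (a * a) + m * b + (m + + 2) * b) ≡ (+ 2 * m + + 4) * (a * a) + (+ 2 * m + + 2) * b
    e₃ = solve-∀
    e₄ : ∀ m b → (+ 2 * m + + 2) * b + + 2 * b ≡ (+ 2 * m + + 4) * b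
    e₄ = solve-∀
    -- The mixed term adds 4 to the coefficient `2 m` of `a ²`. This excess is the source of the
    -- loss `(1 + 2/m) ^ L` after tensoring.
    cross : + 4 * a * B₁ ≤ + 4 * a ² + + m * B₂
    cross = begin
      + 4 * a * B₁                        ≡⟨ e₂ a B₁ ⟩
      + 2 * (+ 2 * a) * B₁                ≤⟨ 2ab≤a²+b² (+ 2 * a) B₁ ⟩
      (+ 2 * a) ² + B₁ ²                  ≤⟨ +-mono-≤ (≤-reflexive (e₂′ a)) (∑²≤length*∑² (allFin m) (λ p → χ̂ p h)) ⟩
      + 4 * a ² + + length (allFin m) * B₂ ≡⟨ cong (λ k → + 4 * a ² + + k * B₂) (length-allFin m) ⟩
      + 4 * a ² + + m * B₂                ∎

  -- Tensoring over the columns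

  Cut : ℕ → ℕ → Set
  Cut m L = Vec (Vec Bool m) L

  -- The mixed difference of J at the vertices of φ selected by U, with the other
  -- vertices of φ on the right of the cut (bit false), summed over the sides of
  -- all vertices outside φ.
  coeff : ∀ {m L} → Vec Bool L → Vec (Fin m) L → (Cut m L → ℤ) → ℤ
  coeff []      []      J = J []
  coeff (b ∷ U) (p ∷ φ) J = coeff U φ (λ y → op b p (λ y₀ → J (y₀ ∷ y)))

  weights : ∀ {L} → ℕ → Vec Bool L → ℤ
  weights m []      = 1ℤ
  weights m (b ∷ U) = weight m b * weights m U

  -- For fixed `p` and `b` in the first column the induction hypothesis applies to `J′ p b`, a
  -- function of the other columns. After exchanging the sums, `column-bound` applies for each fixed
  -- cut `y` of the other columns.
  tensor-bound : ∀ m L (J : Cut m L → ℤ) →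
    ∑ (vecs (allFin m) L) (λ φ → ∑ (cube L) (λ U → weights m U * (coeff U φ J) ²)) ≤
    + (((2 ℕ.* m ℕ.+ 4) ℕ.* 2 ℕ.^ m) ℕ.^ L) * ∑ (vecs (cube m) L) (λ y → J y ²)
  tensor-bound m zero    J = ≤-reflexive (lemma (J []))
    where
    lemma : ∀ a → 1ℤ * (a * a) + 0ℤ + 0ℤ ≡ 1ℤ * (a * a + 0ℤ)
    lemma = solve-∀
  tensor-bound m (suc L) J = begin
    ∑ (vecs (allFin m) (suc L)) (λ φ → ∑ (cube (suc L)) (λ U → weights m U * (coeff U φ J) ²))
      ≡⟨ ∑-vecs (allFin m) L _ ⟩
    ∑ (allFin m) (λ p → ∑ Φ (λ φ → ∑ (cube (suc L)) (λ U → weights m U * (coeff U (p ∷ φ) J) ²)))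
      ≡⟨ ∑-cong (allFin m) (λ p → trans (∑-cong Φ (λ φ → trans (∑-vecs bools L _)
           (∑-cong bools (λ b → trans
             (∑-cong (cube L) (λ U → *-assoc (weight m b) (weights m U) ((coeff U φ (J′ p b)) ²)))
             (∑-* (cube L) (weight m b) (Q p b φ))))))
           (trans (∑-swap Φ bools (λ φ b → weight m b * ∑ (cube L) (Q p b φ)))
             (∑-cong bools (λ b → ∑-* Φ (weight m b) (λ φ → ∑ (cube L) (Q p b φ)))))) ⟩
    ∑ (allFin m) (λ p → ∑ bools (λ b → weight m b * ∑ Φ (λ φ → ∑ (cube L) (Q p b φ))))
      ≤⟨ ∑-mono (allFin m) (λ p → ∑-mono bools (λ b → weight-mono b (tensor-bound m L (J′ p b)))) ⟩
    ∑ (allFin m) (λ p → ∑ bools (λ b → weight m b * (+ (c ℕ.^ L) * ∑ Y (λ y → (J′ p b y) ²))))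
      ≡⟨ ∑-cong (allFin m) (λ p → trans
           (∑-cong bools (λ b → lemma (weight m b) (+ (c ℕ.^ L)) (∑ Y (λ y → (J′ p b y) ²))))
           (trans (∑-* bools (+ (c ℕ.^ L)) (λ b → weight m b * ∑ Y (λ y → (J′ p b y) ²)))
             (cong (_*_ (+ (c ℕ.^ L))) (trans
               (∑-cong bools (λ b → sym (∑-* Y (weight m b) (λ y → (J′ p b y) ²))))
               (∑-swap bools Y (λ b y → E y p b)))))) ⟩
    ∑ (allFin m) (λ p → + (c ℕ.^ L) * ∑ Y (λ y → ∑ bools (E y p)))
      ≡⟨ trans (∑-* (allFin m) (+ (c ℕ.^ L)) (λ p → ∑ Y (λ y → ∑ bools (E y p))))
           (cong (_*_ (+ (c ℕ.^ L))) (∑-swap (allFin m) Y (λ p y → ∑ bools (E y p)))) ⟩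
    + (c ℕ.^ L) * ∑ Y (λ y → ∑ (allFin m) (λ p → ∑ bools (E y p)))
      ≤⟨ *-monoˡ-≤-nonNeg (+ (c ℕ.^ L)) (∑-mono Y (λ y → column-bound m (λ y₀ → J (y₀ ∷ y)))) ⟩
    + (c ℕ.^ L) * ∑ Y (λ y → + (2 ℕ.* m ℕ.+ 4) * 2^ m * ∑ (cube m) (λ y₀ → J (y₀ ∷ y) ²))
      ≡⟨ cong (_*_ (+ (c ℕ.^ L))) (trans
           (∑-* Y (+ (2 ℕ.* m ℕ.+ 4) * 2^ m) (λ y → ∑ (cube m) (λ y₀ → J (y₀ ∷ y) ²)))
           (cong₂ _*_ (sym (pos-* (2 ℕ.* m ℕ.+ 4) (2 ℕ.^ m)))
             (trans (∑-swap Y (cube m) (λ y y₀ → J (y₀ ∷ y) ²)) (sym (∑-vecs (cube m) L _))))) ⟩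
    + (c ℕ.^ L) * (+ c * R)
      ≡⟨ trans (lemma (+ (c ℕ.^ L)) (+ c) R) (trans (sym (*-assoc (+ c) (+ (c ℕ.^ L)) R))
           (cong (_* R) (sym (pos-* c (c ℕ.^ L))))) ⟩
    + (c ℕ.^ suc L) * R ∎
    where
    open ≤-Reasoning
    c = (2 ℕ.* m ℕ.+ 4) ℕ.* 2 ℕ.^ m
    Φ = vecs (allFin m) L
    Y = vecs (cube m) L
    J′ : Fin m → Bool → Cut m L → ℤ
    J′ p b y = op b p (λ y₀ → J (y₀ ∷ y))
    R = ∑ (vecs (cube m) (suc L)) (λ y → J y ²)
    Q : Fin m → Bool → Vec (Fin m) L → Vec Bool L → ℤ
    Q p b φ U = weights m U * (coeff U φ (J′ p b)) ²
    E : Cut m L → Fin m → Bool → ℤ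
    E y p b = weight m b * (J′ p b y) ²
    lemma : ∀ a b c → a * (b * c) ≡ b * (a * c)
    lemma = solve-∀
    weight-mono : ∀ b {i j} → i ≤ j → weight m b * i ≤ weight m b * j
    weight-mono false = *-monoˡ-≤-nonNeg (+ 8)
    weight-mono true  = *-monoˡ-≤-nonNeg (+ m)

  -- Mixed differences of constants and of functions with restricted support

  face-cong : ∀ {m} b (p : Fin m) {h g} → (∀ y → h y ≡ g y) → face b p h ≡ face b p g
  face-cong {m} b p h≡g = ∑-cong (cube m) (λ y → cong (_*_ (δ b (lookup y p))) (h≡g y))

  op-cong : ∀ {m} b (p : Fin m) {h g} → (∀ y → h y ≡ g y) → op b p h ≡ op b p g
  op-cong false p h≡g = face-cong false p h≡g
  op-cong true  p h≡g = cong₂ _-_ (face-cong true p h≡g) (face-cong false p h≡g)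

  face-zero : ∀ {m} b (p : Fin m) {h} → (∀ y → lookup y p ≡ b → h y ≡ 0ℤ) → face b p h ≡ 0ℤ
  face-zero {m} b p {h} h≡0 = ∑-zero (cube m) (λ y → lemma b (lookup y p) (h≡0 y))
    where
    lemma : ∀ b c {i} → (c ≡ b → i ≡ 0ℤ) → δ b c * i ≡ 0ℤ
    lemma false false i≡0 = cong (_*_ 1ℤ) (i≡0 refl)
    lemma false true  {i} i≡0 = *-zeroˡ i
    lemma true  false {i} i≡0 = *-zeroˡ i
    lemma true  true  i≡0 = cong (_*_ 1ℤ) (i≡0 refl)

  op-zero : ∀ {m} b (p : Fin m) {h} → (∀ y → h y ≡ 0ℤ) → op b p h ≡ 0ℤ
  op-zero false p h≡0 = face-zero false p (λ y _ → h≡0 y)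
  op-zero true  p h≡0 = cong₂ _-_ (face-zero true p (λ y _ → h≡0 y)) (face-zero false p (λ y _ → h≡0 y))

  face-minus : ∀ {m} b (p : Fin m) h g → face b p (λ y → h y - g y) ≡ face b p h - face b p g
  face-minus {m} b p h g = trans
    (∑-cong (cube m) (λ y → distrib (δ b (lookup y p)) (h y) (g y)))
    (∑-minus (cube m) (λ y → δ b (lookup y p) * h y) (λ y → δ b (lookup y p) * g y))
    where
    distrib : ∀ d a b → d * (a - b) ≡ d * a - d * b
    distrib = solve-∀

  op-minus : ∀ {m} b (p : Fin m) h g → op b p (λ y → h y - g y) ≡ op b p h - op b p g
  op-minus false p h g = face-minus false p h g
  op-minus true  p h g = trans (cong₂ _-_ (face-minus true p h g) (face-minus false p h g))
    (rearrange (face true p h) (face true p g) (face false p h) (face false p g))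
    where
    rearrange : ∀ a b c d → (a - b) - (c - d) ≡ (a - c) - (b - d)
    rearrange = solve-∀

  coeff-cong : ∀ {m L} U (φ : Vec (Fin m) L) {J K} → (∀ y → J y ≡ K y) → coeff U φ J ≡ coeff U φ K
  coeff-cong []      []      J≡K = J≡K []
  coeff-cong (b ∷ U) (p ∷ φ) J≡K = coeff-cong U φ (λ y → op-cong b p (λ y₀ → J≡K (y₀ ∷ y)))

  coeff-zero : ∀ {m L} U (φ : Vec (Fin m) L) {J} → (∀ y → J y ≡ 0ℤ) → coeff U φ J ≡ 0ℤ
  coeff-zero []      []      J≡0 = J≡0 []
  coeff-zero (b ∷ U) (p ∷ φ) J≡0 = coeff-zero U φ (λ y → op-zero b p (λ y₀ → J≡0 (y₀ ∷ y)))

  coeff-minus : ∀ {m L} U (φ : Vec (Fin m) L) J K →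
            coeff U φ (λ y → J y - K y) ≡ coeff U φ J - coeff U φ K
  coeff-minus []      []      J K = refl
  coeff-minus (b ∷ U) (p ∷ φ) J K = trans
    (coeff-cong U φ (λ y → op-minus b p (λ y₀ → J (y₀ ∷ y)) (λ y₀ → K (y₀ ∷ y))))
    (coeff-minus U φ _ _)

  coeff-neg : ∀ {m L} U (φ : Vec (Fin m) L) J → coeff U φ (λ y → - J y) ≡ - coeff U φ J
  coeff-neg U φ J = trans (coeff-cong U φ (λ y → sym (+-identityˡ (- J y)))) (trans
    (coeff-minus U φ (λ _ → 0ℤ) J) (trans
    (cong (_- coeff U φ J) (coeff-zero U φ (λ _ → refl)))
    (+-identityˡ (- coeff U φ J))))

  bit : ∀ {m L} → Vec (Fin m) L → Cut m L → Fin L → Bool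
  bit φ y i = lookup (lookup y i) (lookup φ i)

  -- At a column outside `U` only cuts with the chosen vertex on the right are summed, and there `H`
  -- is zero.
  coeff-vanishes : ∀ {m L} U (φ : Vec (Fin m) L) i {H} → lookup U i ≡ false →
                   (∀ y → bit φ y i ≡ false → H y ≡ 0ℤ) → coeff U φ H ≡ 0ℤ
  coeff-vanishes (false ∷ U) (p ∷ φ) zero    refl H≡0 =
    coeff-zero U φ (λ y → face-zero false p (λ y₀ → H≡0 (y₀ ∷ y)))
  coeff-vanishes (b ∷ U)     (p ∷ φ) (suc i) Uᵢ   H≡0 =
    coeff-vanishes U φ i Uᵢ (λ y yᵢ → op-zero b p (λ y₀ → H≡0 (y₀ ∷ y) yᵢ))

  -- The left face at `j` contributes nothing, so the difference at `j` is minus the right face.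
  coeff-toggle : ∀ {m L} U (φ : Vec (Fin m) L) j {H} → lookup U j ≡ false →
                 (∀ y → bit φ y j ≡ true → H y ≡ 0ℤ) →
                 coeff (U [ j ]≔ true) φ H ≡ - coeff U φ H
  coeff-toggle (false ∷ U) (p ∷ φ) zero    {H} refl H≡0 = trans
    (coeff-cong U φ (λ y → trans
      (cong (_- face false p (λ y₀ → H (y₀ ∷ y))) (face-zero true p (λ y₀ → H≡0 (y₀ ∷ y))))
      (+-identityˡ (- face false p (λ y₀ → H (y₀ ∷ y))))))
    (coeff-neg U φ _)
  coeff-toggle (b ∷ U)     (p ∷ φ) (suc j) Uⱼ   H≡0 =
    coeff-toggle U φ j Uⱼ (λ y yⱼ → op-zero b p (λ y₀ → H≡0 (y₀ ∷ y) yⱼ))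

  ∑-vecs-const : ∀ {A : Set} (xs : List A) n c → ∑ (vecs xs n) (λ _ → c) ≡ + (length xs ℕ.^ n) * c
  ∑-vecs-const xs zero    c = trans (+-identityʳ c) (sym (*-identityˡ c))
  ∑-vecs-const xs (suc n) c = trans (∑-vecs xs n _) (trans
    (∑-cong xs (λ _ → ∑-vecs-const xs n c)) (trans
    (∑-const xs (+ (length xs ℕ.^ n) * c)) (trans
    (sym (*-assoc (+ length xs) (+ (length xs ℕ.^ n)) c))
    (cong (_* c) (sym (pos-* (length xs) (length xs ℕ.^ n)))))))

  face-const : ∀ {m} b (p : Fin m) c → + 2 * face b p (λ _ → c) ≡ 2^ m * c
  face-const {suc m} b zero c = trans (cong (_*_ (+ 2)) (trans (face-zero′ b) (∑-vecs-const bools m c)))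
    (trans (sym (*-assoc (+ 2) (2^ m) c)) (cong (_* c) (sym (2^-suc m))))
    where
    face-zero′ : ∀ b → face b (zero {m}) (λ _ → c) ≡ ∑ (cube m) (λ _ → c)
    face-zero′ false = face-false-zero {m} (λ _ → c)
    face-zero′ true  = face-true-zero {m} (λ _ → c)
  face-const {suc m} b (suc p) c = trans (cong (_*_ (+ 2)) (face-suc b p (λ _ → c))) (trans
    (*-distribˡ-+ (+ 2) (face b p (λ _ → c)) (face b p (λ _ → c))) (trans
    (cong₂ _+_ (face-const b p c) (face-const b p c)) (trans
    (double (2^ m) c) (cong (_* c) (sym (2^-suc m))))))
    where
    double : ∀ a c → a * c + a * c ≡ + 2 * a * c
    double = solve-∀

  op-true-const : ∀ {m} (p : Fin m) c → op true p (λ _ → c) ≡ 0ℤ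
  op-true-const p c = trans (cong (_- face false p (λ _ → c))
    (*-cancelˡ-≡ (+ 2) _ _ (trans (face-const true p c) (sym (face-const false p c)))))
    (+-inverseʳ (face false p (λ _ → c)))

  -- Differences of a constant vanish, so only the empty `U` survives; `2^ L` compensates for each
  -- column being summed over half of its cube.
  ∑-coeff-const : ∀ {m L} (φ : Vec (Fin m) L) (G : Vec Bool L → ℤ) c →
    2^ L * ∑ (cube L) (λ U → G U * coeff U φ (λ _ → c)) ≡ + ((2 ℕ.^ m) ℕ.^ L) * c * G (replicate L false)
  ∑-coeff-const         []      G c = lemma (G []) c
    where
    lemma : ∀ g c → 1ℤ * (g * c + 0ℤ) ≡ 1ℤ * c * g
    lemma = solve-∀
  ∑-coeff-const {m} {suc L} (p ∷ φ) G c = begin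
    2^ (suc L) * ∑ (cube (suc L)) (λ U → G U * coeff U (p ∷ φ) (λ _ → c))
      ≡⟨ cong₂ _*_ (2^-suc L) (trans (∑-cube L _) (trans
           (cong (_+_ S) (∑-zero (cube L) (λ U → trans
             (cong (_*_ (G (true ∷ U))) (coeff-zero U φ (λ _ → op-true-const p c)))
             (*-zeroʳ (G (true ∷ U))))))
           (+-identityʳ S))) ⟩
    + 2 * 2^ L * S
      ≡⟨ *-assoc (+ 2) (2^ L) S ⟩
    + 2 * (2^ L * S)
      ≡⟨ cong (_*_ (+ 2)) (∑-coeff-const φ (G ∘ (false ∷_)) d) ⟩
    + 2 * (k * d * g)
      ≡⟨ e₁ k d g ⟩
    k * (+ 2 * d) * g
      ≡⟨ cong (λ z → k * z * g) (face-const false p c) ⟩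
    k * (2^ m * c) * g
      ≡⟨ trans (e₂ k (2^ m) c g) (cong (λ z → z * c * g) (sym (pos-* (2 ℕ.^ m) ((2 ℕ.^ m) ℕ.^ L)))) ⟩
    + ((2 ℕ.^ m) ℕ.^ suc L) * c * g ∎
    where
    open ≡-Reasoning
    d = face false p (λ _ → c)
    g = G (replicate (suc L) false)
    k = + ((2 ℕ.^ m) ℕ.^ L)
    S = ∑ (cube L) (λ U → G (false ∷ U) * coeff U φ (λ _ → d))
    e₁ : ∀ k d g → + 2 * (k * d * g) ≡ k * (+ 2 * d) * g
    e₁ = solve-∀
    e₂ : ∀ k a c g → k * (a * c) * g ≡ a * k * c * g
    e₂ = solve-∀

  -- The cube is paired off along coordinate `j`.
  ∑-toggle : ∀ {L} (j : Fin L) (G : Vec Bool L → ℤ) →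
    (∀ U → lookup U j ≡ false → G U + G (U [ j ]≔ true) ≡ 0ℤ) → ∑ (cube L) G ≡ 0ℤ
  ∑-toggle {suc L} zero G cancel = trans (∑-cube L G) (trans
    (sym (∑-+ (cube L) (G ∘ (false ∷_)) (G ∘ (true ∷_))))
    (∑-zero (cube L) (λ U → cancel (false ∷ U) refl)))
  ∑-toggle {suc L} (suc j) G cancel = trans (∑-cube L G)
    (cong₂ _+_ (∑-toggle j (G ∘ (false ∷_)) (λ U → cancel (false ∷ U)))
               (∑-toggle j (G ∘ (true ∷_)) (λ U → cancel (true ∷ U))))

-- An invariant of the reversible pebble game

module PebbleInvariant where

  open import Data.Bool using (Bool; true; false; not; _∧_; _∨_)
  open import Data.Bool.ListAction using (or)
  open import Data.Bool.Properties using (∨-zeroʳ)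
  open import Data.Fin using (zero; suc)
  open import Data.List using (List; []; _∷_; take; drop)
  open import Data.List.Properties using (drop-drop)
  open import Data.Nat
  open import Data.Nat.Properties
  open import Data.Product using (_×_; _,_; ∃-syntax)
  open import Data.Sum using (_⊎_; inj₁; inj₂)
  open import Data.Vec as Vec using ([]; _∷_)
  open import Relation.Binary.PropositionalEquality
  open import Relation.Nullary using (contradiction)

  pebbles : List Bool → ℕ
  pebbles []          = 0
  pebbles (true  ∷ U) = suc (pebbles U)
  pebbles (false ∷ U) = pebbles U

  -- Place p U U′: U′ is U with one more pebble, placed right after a pebbled
  -- vertex; p tells whether the vertex before the whole path is pebbled.
  data Place : Bool → List Bool → List Bool → Set where
    here  : ∀ {U} → Place true (false ∷ U) (true ∷ U)
    there : ∀ {p b U U′} → Place b U U′ → Place p (b ∷ U) (b ∷ U′)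

  -- An invariant of the reversible pebble game with k pebbles: it holds of the
  -- empty configuration and is preserved by the moves, but fails as soon as a
  -- pebble is at distance 2 ^ k or more from the start.  The second disjunct says
  -- that A, which supports the pebbles of B, cannot be removed with k pebbles.
  reachable : ℕ → List Bool → Bool
  reachable zero    U = not (or U)
  reachable (suc k) U = not (or B) ∨ (not (reachable k A) ∧ reachable k B)
    where
    A = take (2 ^ k) U
    B = drop (2 ^ k) U

  pebbles-split : ∀ n U → pebbles U ≡ pebbles (take n U) + pebbles (drop n U)
  pebbles-split zero    U           = refl
  pebbles-split (suc n) []          = refl
  pebbles-split (suc n) (true  ∷ U) = cong suc (pebbles-split n U)
  pebbles-split (suc n) (false ∷ U) = pebbles-split n U

  or⇒pebbles>0 : ∀ U → or U ≡ true → 0 < pebbles U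
  or⇒pebbles>0 (true  ∷ U) _   = s≤s z≤n
  or⇒pebbles>0 (false ∷ U) orU = or⇒pebbles>0 U orU

  or-drop⇒or : ∀ n U → or (drop n U) ≡ true → or U ≡ true
  or-drop⇒or zero    U           orU = orU
  or-drop⇒or (suc n) (true  ∷ U) orU = refl
  or-drop⇒or (suc n) (false ∷ U) orU = or-drop⇒or n U orU

  empty-reachable : ∀ k U → or U ≡ false → reachable k U ≡ true
  empty-reachable zero    U ∅ rewrite ∅ = refl
  empty-reachable (suc k) U ∅ with or (drop (2 ^ k) U) in orB
  ... | false = refl
  ... | true  = contradiction (trans (sym (or-drop⇒or (2 ^ k) U orB)) ∅) λ ()

  unreachable⇒pebbles>0 : ∀ k U → reachable k U ≡ false → 0 < pebbles U
  unreachable⇒pebbles>0 k U ¬r with or U in orU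
  ... | true  = or⇒pebbles>0 U orU
  ... | false = contradiction (trans (sym (empty-reachable k U orU)) ¬r) λ ()

  0<m⇒n≤k : ∀ {m n k} → 0 < m → m + n ≤ suc k → n ≤ k
  0<m⇒n≤k {suc m} {n} _ (s≤s m+n≤k) = ≤-trans (m≤n+m n m) m+n≤k

  0<n⇒m≤k : ∀ {m n k} → 0 < n → m + n ≤ suc k → m ≤ k
  0<n⇒m≤k {m} {n} {k} 0<n m+n≤1+k = 0<m⇒n≤k 0<n (subst (_≤ suc k) (+-comm m n) m+n≤1+k)

  -- If `A` is reachable, the value is false because `B` is nonempty. Otherwise `A` holds a pebble,
  -- which leaves at most `k` for `B`, and induction applies to `B`. Entry `i` of the list stands
  -- for vertex `i + 1`, so dropping `2 ^ k ∸ 1` entries leaves the vertices at distance at least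
  -- `2 ^ k`.
  far-unreachable : ∀ k U → pebbles U ≤ k → or (drop (2 ^ k ∸ 1) U) ≡ true → reachable k U ≡ false
  far-unreachable zero    U _ orU = cong not orU
  far-unreachable (suc k) U U≤1+k orU = helper (reachable k A) refl
    where
    A = take (2 ^ k) U
    B = drop (2 ^ k) U
    farB : or (drop (2 ^ k ∸ 1) B) ≡ true
    farB = trans (cong or (trans (drop-drop (2 ^ k) (2 ^ k ∸ 1) U)
      (cong (λ n → drop n U) (trans (sym (+-∸-assoc (2 ^ k) (m^n>0 2 k)))
        (cong (λ n → 2 ^ k + n ∸ 1) (sym (+-identityʳ (2 ^ k)))))))) orU
    A+B≤1+k : pebbles A + pebbles B ≤ suc k
    A+B≤1+k = subst (_≤ suc k) (pebbles-split (2 ^ k) U) U≤1+k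
    helper : ∀ r → reachable k A ≡ r → not (or B) ∨ (not (reachable k A) ∧ reachable k B) ≡ false
    helper true  rA rewrite rA | or-drop⇒or (2 ^ k ∸ 1) B farB = refl
    helper false rA rewrite rA | or-drop⇒or (2 ^ k ∸ 1) B farB =
      far-unreachable k B (0<m⇒n≤k (unreachable⇒pebbles>0 k A rA) A+B≤1+k) farB

  place-or : ∀ {p U U′} → Place p U U′ → or U′ ≡ true
  place-or here              = refl
  place-or (there {b = b} m) = trans (cong (b ∨_) (place-or m)) (∨-zeroʳ b)

  place-source : ∀ {p U U′} → Place p U U′ → p ≡ true ⊎ or U ≡ true
  place-source here = inj₁ refl
  place-source (there {b = b} m) with place-source m
  ... | inj₁ refl = inj₂ refl
  ... | inj₂ orU  = inj₂ (trans (cong (b ∨_) orU) (∨-zeroʳ b))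

  place-true : ∀ {p U U′} → Place p U U′ → Place true U U′
  place-true here      = here
  place-true (there m) = there m

  -- If the new pebble lies behind the split, its support may be the last vertex of the first part;
  -- `q` is then the bit of that vertex. The length `suc n` ensures that the first part has a last
  -- vertex to speak of.
  place-split : ∀ n {p U U′} → Place p U U′ →
    (Place p (take (suc n) U) (take (suc n) U′) × drop (suc n) U ≡ drop (suc n) U′) ⊎
    (take (suc n) U ≡ take (suc n) U′ ×
     ∃[ q ] (Place q (drop (suc n) U) (drop (suc n) U′) × (q ≡ true → or (drop n (take (suc n) U)) ≡ true)))
  place-split n       here              = inj₁ (here , refl)
  place-split zero    (there {b = b} m) = inj₂ (refl , b , m , λ { refl → refl })
  place-split (suc n) (there {b = b} m) with place-split n m
  ... | inj₁ (m′ , eq)          = inj₁ (there m′ , eq)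
  ... | inj₂ (eq , q , m′ , qt) = inj₂ (cong (b ∷_) eq , q , m′ , qt)

  place-split-2^ : ∀ k {p U U′} → Place p U U′ →
    (Place p (take (2 ^ k) U) (take (2 ^ k) U′) × drop (2 ^ k) U ≡ drop (2 ^ k) U′) ⊎
    (take (2 ^ k) U ≡ take (2 ^ k) U′ ×
     ∃[ q ] (Place q (drop (2 ^ k) U) (drop (2 ^ k) U′) ×
             (q ≡ true → or (drop (2 ^ k ∸ 1) (take (2 ^ k) U)) ≡ true)))
  place-split-2^ k m with 2 ^ k | m^n>0 2 k
  ... | suc n | _ = place-split n m

  -- A move in `A` matters only if `B` holds a pebble, so that at most `k` are on `A`. A move in `B`
  -- matters only if `A` is unreachable, hence nonempty, so that at most `k` are on `B`. In both
  -- cases the invariance for `k` applies.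
  reachable-place : ∀ k {U U′} → Place true U U′ → pebbles U′ ≤ k → reachable k U ≡ reachable k U′
  reachable-place zero {U} {U′} m U′≤0 =
    contradiction (≤-trans (or⇒pebbles>0 U′ (place-or m)) U′≤0) λ ()
  reachable-place (suc k) {U} {U′} m U′≤1+k = by-half (place-split-2^ k m)
    where
    A = take (2 ^ k) U
    B = drop (2 ^ k) U
    A′ = take (2 ^ k) U′
    B′ = drop (2 ^ k) U′
    A′+B′≤1+k : pebbles A′ + pebbles B′ ≤ suc k
    A′+B′≤1+k = subst (_≤ suc k) (pebbles-split (2 ^ k) U′) U′≤1+k
    combine : Bool → Bool → Bool → Bool
    combine orB rA rB = not orB ∨ (not rA ∧ rB)
    left : Place true A A′ → ∀ b → or B′ ≡ b →
           combine b (reachable k A) (reachable k B′) ≡ combine b (reachable k A′) (reachable k B′)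
    left m false orB = refl
    left m true  orB = cong (λ r → not r ∧ reachable k B′)
      (reachable-place k m (0<n⇒m≤k (or⇒pebbles>0 B′ orB) A′+B′≤1+k))
    right : ∀ {q} → A ≡ A′ → Place q B B′ → (q ≡ true → or (drop (2 ^ k ∸ 1) A) ≡ true) →
            ∀ r b → reachable k A ≡ r → or B ≡ b → combine b r (reachable k B) ≡ combine true r (reachable k B′)
    right A≡A′ m far true  true  rA orB = refl
    -- The first pebble on `B` needs a pebble on the last vertex of `A`. That vertex is at distance
    -- `2 ^ k`, which makes `A` unreachable.
    right A≡A′ m far true  false rA orB with place-source m
    ... | inj₂ orB′ = contradiction (trans (sym orB) orB′) λ ()
    ... | inj₁ refl = contradiction (trans (sym rA) (far-unreachable k A
      (0<n⇒m≤k (or⇒pebbles>0 B′ (place-or m))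
        (subst (λ A → pebbles A + pebbles B′ ≤ suc k) (sym A≡A′) A′+B′≤1+k)) (far refl))) λ ()
    -- Regarding the vertex before `B` as pebbled only allows more moves, so the induction
    -- hypothesis for `Place true` covers every `q`.
    right A≡A′ m far false b     rA orB = trans (absorb b orB) (reachable-place k (place-true m)
      (0<m⇒n≤k (subst (λ A → 0 < pebbles A) A≡A′ (unreachable⇒pebbles>0 k A rA)) A′+B′≤1+k))
      where
      absorb : ∀ b → or B ≡ b → combine b false (reachable k B) ≡ reachable k B
      absorb true  _   = refl
      absorb false orB = sym (empty-reachable k B orB)
    by-half : _ → combine (or B) (reachable k A) (reachable k B) ≡ combine (or B′) (reachable k A′) (reachable k B′)
    by-half (inj₁ (mA , B≡B′)) =
      trans (cong (λ B → combine (or B) (reachable k A) (reachable k B)) B≡B′) (left mA (or B′) refl)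
    by-half (inj₂ (A≡A′ , q , mB , far)) = trans (right A≡A′ mB far (reachable k A) (or B) refl refl)
      (cong₂ (λ b A → combine b (reachable k A) (reachable k B′)) (sym (place-or mB)) A≡A′)

-- Linear functionals from the pebble invariant

module Functionals where

  open import Data.Bool using (Bool; true; false; if_then_else_; _∧_; _∨_)
  open import Data.Bool.ListAction using (or)
  open import Data.Bool.Properties using (∨-zeroʳ; ∧-zeroʳ; ∨-identityʳ)
  open import Data.Fin as Fin using (Fin; zero; suc; inject₁; fromℕ)
  open import Data.Fin using (Fin; zero; suc; inject₁; fromℕ)
  open import Data.Integer using (ℤ; +_; -[1+_]; 0ℤ; 1ℤ; _+_; _*_; _-_; -_; _≤_; +≤+; -≤+; ∣_∣; NonNegative; nonNegative)
  open import Data.Integer.Properties hiding (_≤?_; _≟_)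
  open import Data.Integer.Tactic.RingSolver using (solve-∀)
  open import Data.List using (List; []; _∷_; allFin; drop; length)
  open import Data.List.Membership.Propositional using (_∈_; _∉_)
  open import Data.List.Relation.Unary.Any using (here; there; any?)
  open import Data.Nat as ℕ using (ℕ; zero; suc; _≤?_; _≟_)
  import Data.Nat.Properties as ℕ
  import Data.Nat.Tactic.RingSolver as ℕ-Solver
  open import Data.Product using (_,_; ∃-syntax; proj₂)
  open import Data.Sum using (_⊎_; inj₁; inj₂)
  open import Data.Vec using (Vec; []; _∷_; lookup; _[_]≔_; replicate; toList)
  open import Data.Vec.Properties using ([]≔-idempotent; []≔-lookup; lookup∘update)
  open import Function using (_∘_)
  open import Relation.Binary.Construct.Closure.ReflexiveTransitive using (Star; ε; _◅_)
  open import Relation.Binary.Definitions using (tri<; tri≈; tri>; DecidableEquality)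
  open import Relation.Binary.PropositionalEquality
  open import Relation.Nullary using (Dec; does; yes; no)
  open import Relation.Nullary.Decidable using (dec-true; dec-false)
  open CubeSums
  open PebbleInvariant

  ⟦_⟧ : Bool → ℤ
  ⟦ false ⟧ = 0ℤ
  ⟦ true  ⟧ = 1ℤ

  abs : ℤ → ℤ
  abs i = + ∣ i ∣

  i≤abs : ∀ i → i ≤ abs i
  i≤abs (+ n)    = ≤-refl
  i≤abs -[1+ n ] = -≤+

  -i≤abs : ∀ i → - i ≤ abs i
  -i≤abs i = subst (- i ≤_) (cong +_ (∣-i∣≡∣i∣ i)) (i≤abs (- i))

  ‖_‖ : ∀ {L} → Vec Bool L → ℕ
  ‖ U ‖ = pebbles (toList U)

  low : ∀ {L} → ℕ → Vec Bool L → Bool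
  low k U = does (‖ U ‖ ≤? k) ∧ reachable k (toList U)

  top : ∀ {L} → ℕ → Vec Bool L → Bool
  top k U = does (‖ U ‖ ≟ suc k)

  -- Coefficients of a functional that ignores the functions supported on the cuts
  -- crossing the edge into vertex j: they agree on U and U ∪ {j} as soon as the
  -- predecessor of j lies in U.
  edge : ∀ {L} → ℕ → Fin L → Vec Bool L → Bool
  edge k j U = low k U ∨ (top k U ∧ (lookup U j ∧ reachable k (toList (U [ j ]≔ false))))

  functional : ∀ {m L} → (Vec Bool L → Bool) → Vec (Fin m) L → (Cut m L → ℤ) → ℤ
  functional {m} {L} c φ J = ∑ (cube L) (λ U → ⟦ c U ⟧ * coeff U φ J)

  error : ∀ {m L} → ℕ → Vec (Fin m) L → (Cut m L → ℤ) → ℤ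
  error {m} {L} k φ J = ∑ (cube L) (λ U → ⟦ top k U ⟧ * abs (coeff U φ J))

  error-nonNeg : ∀ {m L} k (φ : Vec (Fin m) L) J → 0ℤ ≤ error k φ J
  error-nonNeg {m} {L} k φ J = ∑-nonNeg (cube L) (λ U → nonNeg (top k U) (coeff U φ J))
    where
    nonNeg : ∀ b i → 0ℤ ≤ ⟦ b ⟧ * abs i
    nonNeg false i = ≤-refl
    nonNeg true  i = subst (0ℤ ≤_) (sym (*-identityˡ (abs i))) (+≤+ ℕ.z≤n)

  module _ (a t x : Bool) (i : ℤ) where

    private
      e = ⟦ a ∨ (t ∧ x) ⟧ * i

    -- The two coefficients can differ only on `top`, and there by at most one, so `abs i` pays for
    -- the difference.
    low≤edge+top : ⟦ a ⟧ * i ≤ e + ⟦ t ⟧ * abs i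
    low≤edge+top = go a t x
      where
      go : ∀ a t x → ⟦ a ⟧ * i ≤ ⟦ a ∨ (t ∧ x) ⟧ * i + ⟦ t ⟧ * abs i
      go true false x = ≤-reflexive (sym (+-identityʳ (1ℤ * i)))
      go true true  x = i≤i+j (1ℤ * i) (1ℤ * abs i) {{subst NonNegative (sym (*-identityˡ (abs i))) _}}
      go false false x = ≤-refl
      go false true false = subst (0ℤ ≤_) (sym (trans (+-identityˡ (1ℤ * abs i)) (*-identityˡ (abs i)))) (+≤+ ℕ.z≤n)
      go false true true = subst₂ _≤_ (+-inverseʳ i) (cong₂ _+_ (sym (*-identityˡ i)) (sym (*-identityˡ (abs i)))) (+-monoʳ-≤ i (-i≤abs i))

    edge≤low+top : e ≤ ⟦ a ⟧ * i + ⟦ t ⟧ * abs i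
    edge≤low+top = go a t x
      where
      go : ∀ a t x → ⟦ a ∨ (t ∧ x) ⟧ * i ≤ ⟦ a ⟧ * i + ⟦ t ⟧ * abs i
      go true false x = ≤-reflexive (sym (+-identityʳ (1ℤ * i)))
      go true true  x = i≤i+j (1ℤ * i) (1ℤ * abs i) {{subst NonNegative (sym (*-identityˡ (abs i))) _}}
      go false false x = ≤-refl
      go false true false = subst (0ℤ ≤_) (sym (trans (+-identityˡ (1ℤ * abs i)) (*-identityˡ (abs i)))) (+≤+ ℕ.z≤n)
      go false true true = subst₂ _≤_ (sym (*-identityˡ i)) (sym (trans (+-identityˡ (1ℤ * abs i)) (*-identityˡ (abs i)))) (i≤abs i)

  module _ {m L : ℕ} (k : ℕ) (φ : Vec (Fin m) L) (J : Cut m L → ℤ) where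

    low≤edge+error : ∀ j → functional (low k) φ J ≤ functional (edge k j) φ J + error k φ J
    low≤edge+error j = subst (functional (low k) φ J ≤_) (∑-+ (cube L) (λ U → ⟦ edge k j U ⟧ * coeff U φ J) (λ U → ⟦ top k U ⟧ * abs (coeff U φ J)))
      (∑-mono (cube L) (λ U → low≤edge+top (low k U) (top k U) _ (coeff U φ J)))

    edge≤low+error : ∀ j → functional (edge k j) φ J ≤ functional (low k) φ J + error k φ J
    edge≤low+error j = subst (functional (edge k j) φ J ≤_) (∑-+ (cube L) (λ U → ⟦ low k U ⟧ * coeff U φ J) (λ U → ⟦ top k U ⟧ * abs (coeff U φ J)))
      (∑-mono (cube L) (λ U → edge≤low+top (low k U) (top k U) _ (coeff U φ J)))

  functional-minus : ∀ {m L} c (φ : Vec (Fin m) L) J K →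
    functional c φ (λ y → J y - K y) ≡ functional c φ J - functional c φ K
  functional-minus {m} {L} c φ J K = trans
    (∑-cong (cube L) (λ U → trans (cong (_*_ ⟦ c U ⟧) (coeff-minus U φ J K)) (distrib ⟦ c U ⟧ (coeff U φ J) (coeff U φ K))))
    (∑-minus (cube L) (λ U → ⟦ c U ⟧ * coeff U φ J) (λ U → ⟦ c U ⟧ * coeff U φ K))
    where
    distrib : ∀ d a b → d * (a - b) ≡ d * a - d * b
    distrib = solve-∀

  ‖‖-place : ∀ {L} (U : Vec Bool L) j → lookup U j ≡ false → ‖ U [ j ]≔ true ‖ ≡ suc ‖ U ‖
  ‖‖-place (false ∷ U) zero    _  = refl
  ‖‖-place (true  ∷ U) (suc j) Uⱼ = cong suc (‖‖-place U j Uⱼ)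
  ‖‖-place (false ∷ U) (suc j) Uⱼ = ‖‖-place U j Uⱼ

  place-zero : ∀ {L} (U : Vec Bool (suc L)) → lookup U zero ≡ false →
               Place true (toList U) (toList (U [ zero ]≔ true))
  place-zero (false ∷ U) _ = here

  place-suc : ∀ {L p} (U : Vec Bool (suc L)) (i : Fin L) → lookup U (inject₁ i) ≡ true →
              lookup U (suc i) ≡ false → Place p (toList U) (toList (U [ suc i ]≔ true))
  place-suc (true ∷ false ∷ U) zero    _  _    = there here
  place-suc (b ∷ U)            (suc i) Uᵢ Uᵢ₊₁ = there (place-suc U i Uᵢ Uᵢ₊₁)

  -- With fewer than `k` pebbles on `U` this is the invariance of `reachable`. With exactly `k`, the
  -- set `U⁺` is a top set, and there `edge` copies the value at `U` by construction. With more,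
  -- both sides are false.
  edge-place : ∀ {L} k (U : Vec Bool L) j → lookup U j ≡ false →
               Place true (toList U) (toList (U [ j ]≔ true)) →
               edge k j U ≡ edge k j (U [ j ]≔ true)
  edge-place k U j Uⱼ pl = trans lhs (go (ℕ.<-cmp ‖ U ‖ k))
    where
    U⁺ = U [ j ]≔ true
    U⁺≡ = ‖‖-place U j Uⱼ
    lhs : edge k j U ≡ low k U
    lhs rewrite Uⱼ | ∧-zeroʳ (top k U) = ∨-identityʳ (low k U)
    U⁺⁻ : U⁺ [ j ]≔ false ≡ U
    U⁺⁻ = trans ([]≔-idempotent U j) (trans (cong (U [ j ]≔_) (sym Uⱼ)) ([]≔-lookup U j))
    go : _ → low k U ≡ edge k j U⁺
    go (tri< n<k n≢k _)
      rewrite lookup∘update j U true | U⁺⁻ | U⁺≡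
            | dec-true (‖ U ‖ ≤? k) (ℕ.<⇒≤ n<k)
            | dec-true (suc ‖ U ‖ ≤? k) n<k
            | dec-false (suc ‖ U ‖ ≟ suc k) (λ e → n≢k (ℕ.suc-injective e)) =
      trans (reachable-place k pl (subst (ℕ._≤ k) (sym U⁺≡) n<k)) (sym (∨-identityʳ _))
    go (tri≈ _ n≡k _)
      rewrite lookup∘update j U true | U⁺⁻ | U⁺≡
            | dec-true (‖ U ‖ ≤? k) (ℕ.≤-reflexive n≡k)
            | dec-false (suc ‖ U ‖ ≤? k) (λ n<k → ℕ.<⇒≢ n<k n≡k)
            | dec-true (suc ‖ U ‖ ≟ suc k) (cong suc n≡k) = refl
    go (tri> _ n≢k k<n)
      rewrite lookup∘update j U true | U⁺⁻ | U⁺≡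
            | dec-false (‖ U ‖ ≤? k) (ℕ.<⇒≱ k<n)
            | dec-false (suc ‖ U ‖ ≤? k) (λ n<k → ℕ.<-asym n<k k<n)
            | dec-false (suc ‖ U ‖ ≟ suc k) (λ e → n≢k (ℕ.suc-injective e)) = refl

  -- The terms for `U` and `U ∪ {j}` cancel: opposite differences of `H` meet equal coefficients, or
  -- both differences are zero.
  edge-functional-vanishes : ∀ {m L} k (φ : Vec (Fin m) L) j H →
    (∀ y → bit φ y j ≡ true → H y ≡ 0ℤ) →
    (∀ U → lookup U j ≡ false → coeff U φ H ≡ 0ℤ ⊎ Place true (toList U) (toList (U [ j ]≔ true))) →
    functional (edge k j) φ H ≡ 0ℤ
  edge-functional-vanishes k φ j H H≡0 place = ∑-toggle j _ cancel
    where
    cancel : ∀ U → lookup U j ≡ false →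
             ⟦ edge k j U ⟧ * coeff U φ H + ⟦ edge k j (U [ j ]≔ true) ⟧ * coeff (U [ j ]≔ true) φ H ≡ 0ℤ
    cancel U Uⱼ with coeff-toggle U φ j Uⱼ H≡0 | place U Uⱼ
    ... | tog | inj₁ c≡0 rewrite tog | c≡0 =
      cong₂ _+_ (*-zeroʳ ⟦ edge k j U ⟧) (*-zeroʳ ⟦ edge k j (U [ j ]≔ true) ⟧)
    ... | tog | inj₂ pl rewrite tog | sym (edge-place k U j Uⱼ pl) = zero-sum ⟦ edge k j U ⟧ (coeff U φ H)
      where
      zero-sum : ∀ d c → d * c + d * (- c) ≡ 0ℤ
      zero-sum = solve-∀

  or-drop-last : ∀ {n} (U : Vec Bool (suc n)) d → d ℕ.≤ n → lookup U (fromℕ n) ≡ true →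
                 or (drop d (toList U)) ≡ true
  or-drop-last {zero}  (true ∷ []) zero _ _ = refl
  or-drop-last {suc n} (b ∷ U) zero _ last =
    trans (cong (b ∨_) (or-drop-last U zero ℕ.z≤n last)) (∨-zeroʳ b)
  or-drop-last {suc n} (b ∷ U) (suc d) (ℕ.s≤s d≤n) last = or-drop-last U d d≤n last

  -- The edge into `t` is annihilated by `low` itself. A set containing the last vertex is out of
  -- reach for `k` pebbles, so its coefficient is zero; any other set sees only cuts with that
  -- vertex on the right.
  low-functional-vanishes : ∀ {m L} k (φ : Vec (Fin m) (suc L)) H → 2 ℕ.^ k ℕ.≤ suc L →
    (∀ y → bit φ y (fromℕ L) ≡ false → H y ≡ 0ℤ) → functional (low k) φ H ≡ 0ℤ
  low-functional-vanishes {m} {L} k φ H 2^k≤L H≡0 = ∑-zero (cube (suc L)) term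
    where
    term : ∀ U → ⟦ low k U ⟧ * coeff U φ H ≡ 0ℤ
    term U with lookup U (fromℕ L) in Uₗ
    ... | false = trans (cong (_*_ ⟦ low k U ⟧) (coeff-vanishes U φ (fromℕ L) Uₗ H≡0)) (*-zeroʳ ⟦ low k U ⟧)
    ... | true  = trans (cong (λ b → ⟦ b ⟧ * coeff U φ H) (low≡false (‖ U ‖ ≤? k))) (*-zeroˡ (coeff U φ H))
      where
      low≡false : Dec (‖ U ‖ ℕ.≤ k) → low k U ≡ false
      low≡false (no  U≰k) = cong (_∧ reachable k (toList U)) (dec-false (‖ U ‖ ≤? k) U≰k)
      low≡false (yes U≤k) = trans (cong (does (‖ U ‖ ≤? k) ∧_) (far-unreachable k (toList U) U≤k
        (or-drop-last U (2 ℕ.^ k ℕ.∸ 1) (ℕ.∸-monoˡ-≤ 1 2^k≤L) Uₗ))) (∧-zeroʳ (does (‖ U ‖ ≤? k)))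

  -- J and K differ only on cuts that cross one fixed edge of the path through φ.
  data Step {m L} (φ : Vec (Fin m) (suc L)) (J K : Cut m (suc L) → ℤ) : Set where
    first  : (∀ y → bit φ y zero ≡ true → J y ≡ K y) → Step φ J K
    middle : ∀ i → (∀ y → bit φ y (inject₁ i) ≡ false → J y ≡ K y) →
             (∀ y → bit φ y (suc i) ≡ true → J y ≡ K y) → Step φ J K
    last   : (∀ y → bit φ y (fromℕ L) ≡ false → J y ≡ K y) → Step φ J K

  module _ {m L : ℕ} (k : ℕ) (2^k≤L : 2 ℕ.^ k ℕ.≤ suc L) (φ : Vec (Fin m) (suc L))
           {J K : Cut m (suc L) → ℤ} where

    private
      H : Cut m (suc L) → ℤ
      H y = J y - K y

      H≡0 : ∀ {y} → J y ≡ K y → H y ≡ 0ℤ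
      H≡0 {y} J≡K = trans (cong (_- K y) J≡K) (+-inverseʳ (K y))

      equal : ∀ c → functional c φ H ≡ 0ℤ → functional c φ J ≡ functional c φ K
      equal c H≡0 = i-j≡0⇒i≡j _ _ (trans (sym (functional-minus c φ J K)) H≡0)

      through : ∀ j → functional (edge k j) φ H ≡ 0ℤ →
                functional (low k) φ J ≤ functional (low k) φ K + (error k φ J + error k φ K)
      through j ΦH≡0 = begin
        functional (low k) φ J                        ≤⟨ low≤edge+error k φ J j ⟩
        functional (edge k j) φ J + error k φ J       ≡⟨ cong (_+ error k φ J) (equal (edge k j) ΦH≡0) ⟩
        functional (edge k j) φ K + error k φ J       ≤⟨ +-monoˡ-≤ (error k φ J) (edge≤low+error k φ K j) ⟩
        functional (low k) φ K + error k φ K + error k φ J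
          ≡⟨ trans (+-assoc (functional (low k) φ K) (error k φ K) (error k φ J))
               (cong (_+_ (functional (low k) φ K)) (+-comm (error k φ K) (error k φ J))) ⟩
        functional (low k) φ K + (error k φ J + error k φ K) ∎
        where open ≤-Reasoning

    -- Trading `low` for `edge` costs the error of `J`, crossing the path edge is free, and trading
    -- back costs the error of `K`.
    low-step : Step φ J K →
               functional (low k) φ J ≤ functional (low k) φ K + (error k φ J + error k φ K)
    low-step (first eq) = through zero (edge-functional-vanishes k φ zero H
      (λ y yⱼ → H≡0 (eq y yⱼ)) (λ U Uⱼ → inj₂ (place-zero U Uⱼ)))
    low-step (middle i eq₁ eq₂) = through (suc i) (edge-functional-vanishes k φ (suc i) H
      (λ y yⱼ → H≡0 (eq₂ y yⱼ)) place)
      where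
      place : ∀ U → lookup U (suc i) ≡ false →
              coeff U φ H ≡ 0ℤ ⊎ Place true (toList U) (toList (U [ suc i ]≔ true))
      place U Uⱼ with lookup U (inject₁ i) in Uᵢ
      ... | false = inj₁ (coeff-vanishes U φ (inject₁ i) Uᵢ (λ y yᵢ → H≡0 (eq₁ y yᵢ)))
      ... | true  = inj₂ (place-suc U i Uᵢ Uⱼ)
    low-step (last eq) = begin
      functional (low k) φ J  ≡⟨ equal (low k) (low-functional-vanishes k φ H 2^k≤L (λ y yₗ → H≡0 (eq y yₗ))) ⟩
      functional (low k) φ K  ≡⟨ +-identityʳ (functional (low k) φ K) ⟨
      functional (low k) φ K + 0ℤ
        ≤⟨ +-monoʳ-≤ (functional (low k) φ K) (+-mono-≤ (error-nonNeg k φ J) (error-nonNeg k φ K)) ⟩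
      functional (low k) φ K + (error k φ J + error k φ K) ∎
      where open ≤-Reasoning

  low-∅ : ∀ {L} k → low k (replicate L false) ≡ true
  low-∅ {L} k = cong₂ _∧_ (dec-true (_ ≤? k) (subst (ℕ._≤ k) (sym (no-pebbles L)) ℕ.z≤n)) (empty-reachable k _ (or-∅ L))
    where
    no-pebbles : ∀ L → ‖ replicate L false ‖ ≡ 0
    no-pebbles zero    = refl
    no-pebbles (suc L) = no-pebbles L
    or-∅ : ∀ L → or (toList (replicate L false)) ≡ false
    or-∅ zero    = refl
    or-∅ (suc L) = or-∅ L

  low-one : ∀ {m L} k (φ : Vec (Fin m) L) → 2^ L * functional (low k) φ (λ _ → 1ℤ) ≡ + ((2 ℕ.^ m) ℕ.^ L)
  low-one {m} {L} k φ = trans (∑-coeff-const φ (λ U → ⟦ low k U ⟧) 1ℤ)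
    (trans (cong (λ b → + ((2 ℕ.^ m) ℕ.^ L) * 1ℤ * ⟦ b ⟧) (low-∅ {L} k))
    (trans (*-identityʳ _) (*-identityʳ _)))

  low-zero : ∀ {m L} k (φ : Vec (Fin m) L) → functional (low k) φ (λ _ → 0ℤ) ≡ 0ℤ
  low-zero {m} {L} k φ = ∑-zero (cube L) (λ U → trans
    (cong (_*_ ⟦ low k U ⟧) (coeff-zero U φ (λ _ → refl))) (*-zeroʳ ⟦ low k U ⟧))

  -- Summing the errors along a simple walk

  data SimplePath {A : Set} (R : A → A → Set) : A → List A → A → Set where
    stop : ∀ {x} → SimplePath R x (x ∷ []) x
    step : ∀ {x z y vs} → R x z → x ∉ vs → SimplePath R z vs y → SimplePath R x (x ∷ vs) y

  suffix : ∀ {A : Set} {R : A → A → Set} {x z y vs} → x ∈ vs → SimplePath R z vs y →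
           ∃[ us ] SimplePath R x us y
  suffix (here refl) p@stop         = _ , p
  suffix (here refl) p@(step _ _ _) = _ , p
  suffix (there x∈)  (step _ _ p)   = suffix x∈ p

  simplify : ∀ {A : Set} {R : A → A → Set} → DecidableEquality A → ∀ {x y} → Star R x y →
             ∃[ vs ] SimplePath R x vs y
  simplify _≟_ ε = _ , stop
  simplify _≟_ {x} (xRz ◅ zR*y) with simplify _≟_ zR*y
  ... | vs , p with any? (x ≟_) vs
  ...   | yes x∈vs = suffix x∈vs p
  ...   | no  x∉vs = _ , step xRz x∉vs p

  omit : ∀ {n} → Fin n → (Fin n → ℤ) → Fin n → ℤ
  omit x f i = if does (i Fin.≟ x) then 0ℤ else f i

  ∑-cong-∉ : ∀ {n} x (vs : List (Fin n)) (f : Fin n → ℤ) → x ∉ vs →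
             ∑ vs f ≡ ∑ vs (omit x f)
  ∑-cong-∉ x []       f x∉vs = refl
  ∑-cong-∉ x (v ∷ vs) f x∉vs rewrite dec-false (v Fin.≟ x) (λ v≡x → x∉vs (here (sym v≡x))) =
    cong (_+_ (f v)) (∑-cong-∉ x vs f (x∉vs ∘ there))

  ∑-extract : ∀ {n} x (f : Fin n → ℤ) →
              ∑ (allFin n) f ≡ f x + ∑ (allFin n) (omit x f)
  ∑-extract {suc n} zero    f = trans (∑-allFin n f) (cong (_+_ (f zero))
    (sym (trans (∑-allFin n (omit zero f)) (+-identityˡ (∑ (allFin n) (f ∘ suc))))))
  ∑-extract {suc n} (suc x) f = begin
    ∑ (allFin (suc n)) f                 ≡⟨ ∑-allFin n f ⟩
    f zero + ∑ (allFin n) (f ∘ suc)      ≡⟨ cong (_+_ (f zero)) (∑-extract x (f ∘ suc)) ⟩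
    f zero + (f (suc x) + S)             ≡⟨ swap (f zero) (f (suc x)) S ⟩
    f (suc x) + (f zero + S)             ≡⟨ cong (_+_ (f (suc x))) (∑-allFin n (omit (suc x) f)) ⟨
    f (suc x) + ∑ (allFin (suc n)) (omit (suc x) f) ∎
    where
    open ≡-Reasoning
    S = ∑ (allFin n) (omit x (f ∘ suc))
    swap : ∀ a b c → a + (b + c) ≡ b + (a + c)
    swap = solve-∀

  -- Each vertex of the path is extracted from the full sum and then zeroed by `omit`; the rest of
  -- the path does not notice, since it never returns there.
  ∑-simple : ∀ {n} {R : Fin n → Fin n → Set} {x vs y} (f : Fin n → ℤ) → (∀ i → 0ℤ ≤ f i) →
             SimplePath R x vs y → ∑ vs f ≤ ∑ (allFin n) f
  ∑-simple {n} {x = x} f 0≤f stop = subst (∑ (x ∷ []) f ≤_) (sym (∑-extract x f))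
    (+-monoʳ-≤ (f x) (∑-nonNeg (allFin n) (λ i → nonNeg (does (i Fin.≟ x)) i)))
    where
    nonNeg : ∀ b i → 0ℤ ≤ (if b then 0ℤ else f i)
    nonNeg true  i = ≤-refl
    nonNeg false i = 0≤f i
  ∑-simple {n} {x = x} f 0≤f (step {vs = vs} _ x∉vs p) = subst (∑ (x ∷ vs) f ≤_) (sym (∑-extract x f))
    (+-monoʳ-≤ (f x) (subst (_≤ _) (sym (∑-cong-∉ x vs f x∉vs))
      (∑-simple (omit x f) (λ i → nonNeg (does (i Fin.≟ x)) i) p)))
    where
    nonNeg : ∀ b i → 0ℤ ≤ (if b then 0ℤ else f i)
    nonNeg true  i = ≤-refl
    nonNeg false i = 0≤f i

  module _ {m L size : ℕ} (k : ℕ) (2^k≤L : 2 ℕ.^ k ℕ.≤ suc L) (φ : Vec (Fin m) (suc L))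
           (J : Fin size → Cut m (suc L) → ℤ) where

    private
      Λ E : Fin size → ℤ
      Λ x = functional (low k) φ (J x)
      E x = error k φ (J x)

    -- A step from `x` to `z` costs `E x + E z`. The additional `E x` on the left strengthens the
    -- induction so that every vertex is charged exactly twice.
    low-path : ∀ {x vs y} → SimplePath (λ x y → Step φ (J x) (J y)) x vs y →
               Λ x + E x ≤ Λ y + + 2 * ∑ vs E
    low-path {x} stop = +-monoʳ-≤ (Λ x) (subst₂ _≤_ (+-identityʳ (E x)) (double (E x))
      (+-monoʳ-≤ (E x) (error-nonNeg k φ (J x))))
      where
      double : ∀ e → e + e ≡ + 2 * (e + 0ℤ)
      double = solve-∀
    low-path {x} {vs = x ∷ vs} {y} (step {z = z} s _ p) = begin
      Λ x + E x                                  ≤⟨ +-monoˡ-≤ (E x) (low-step k 2^k≤L φ s) ⟩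
      Λ z + (E x + E z) + E x                    ≡⟨ e₁ (Λ z) (E x) (E z) ⟩
      + 2 * E x + (Λ z + E z)                    ≤⟨ +-monoʳ-≤ (+ 2 * E x) (low-path p) ⟩
      + 2 * E x + (Λ y + + 2 * ∑ vs E)           ≡⟨ e₂ (E x) (Λ y) (∑ vs E) ⟩
      Λ y + + 2 * (E x + ∑ vs E)                 ∎
      where
      open ≤-Reasoning
      e₁ : ∀ a b c → a + (b + c) + b ≡ + 2 * b + (a + c)
      e₁ = solve-∀
      e₂ : ∀ a b c → + 2 * a + (b + + 2 * c) ≡ b + + 2 * (a + c)
      e₂ = solve-∀

    total-error : ∀ {x vs y} → SimplePath (λ x y → Step φ (J x) (J y)) x vs y →
                  (∀ c → J x c ≡ 1ℤ) → (∀ c → J y c ≡ 0ℤ) →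
                  + ((2 ℕ.^ m) ℕ.^ suc L) ≤ 2^ (suc L) * (+ 2 * ∑ (allFin size) E)
    total-error {x} {vs} {y} p J₁ J₀ = subst (_≤ 2^ (suc L) * (+ 2 * ∑ (allFin size) E)) (low-one k φ)
      (*-monoˡ-≤-nonNeg (2^ (suc L)) (begin
        functional (low k) φ (λ _ → 1ℤ)   ≡⟨ functional-cong (λ c → sym (J₁ c)) ⟩
        Λ x                               ≡⟨ +-identityʳ (Λ x) ⟨
        Λ x + 0ℤ                          ≤⟨ +-monoʳ-≤ (Λ x) (error-nonNeg k φ (J x)) ⟩
        Λ x + E x                         ≤⟨ low-path p ⟩
        Λ y + + 2 * ∑ vs E                ≡⟨ cong (_+ + 2 * ∑ vs E) (trans (functional-cong J₀) (low-zero k φ)) ⟩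
        0ℤ + + 2 * ∑ vs E                 ≡⟨ +-identityˡ (+ 2 * ∑ vs E) ⟩
        + 2 * ∑ vs E                      ≤⟨ *-monoˡ-≤-nonNeg (+ 2) (∑-simple E (λ i → error-nonNeg k φ (J i)) p) ⟩
        + 2 * ∑ (allFin size) E           ∎))
      where
      open ≤-Reasoning
      functional-cong : ∀ {G K : Cut m (suc L) → ℤ} → (∀ c → G c ≡ K c) →
                        functional (low k) φ G ≡ functional (low k) φ K
      functional-cong G≡K = ∑-cong (cube (suc L)) (λ U → cong (_*_ ⟦ low k U ⟧) (coeff-cong U φ G≡K))

  -- The mean square of the error over the paths

  top-count : ∀ L k → ∑ (cube L) (λ U → ⟦ top k U ⟧) ≤ + (L ℕ.^ suc k)
  top-count L k = count L (suc k)
    where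
    count : ∀ L r → ∑ (cube L) (λ U → ⟦ does (‖ U ‖ ≟ r) ⟧) ≤ + (L ℕ.^ r)
    count zero    zero    = +≤+ (ℕ.s≤s ℕ.z≤n)
    count zero    (suc r) = +≤+ ℕ.z≤n
    count (suc L) zero    = begin
      ∑ (cube (suc L)) (λ U → ⟦ does (‖ U ‖ ≟ 0) ⟧)   ≡⟨ ∑-cube L _ ⟩
      ∑ (cube L) (λ U → ⟦ does (‖ U ‖ ≟ 0) ⟧) + ∑ (cube L) (λ _ → 0ℤ) ≡⟨ cong (_+_ (∑ (cube L) (λ U → ⟦ does (‖ U ‖ ≟ 0) ⟧))) (∑-zero (cube L) (λ _ → refl)) ⟩
      ∑ (cube L) (λ U → ⟦ does (‖ U ‖ ≟ 0) ⟧) + 0ℤ ≡⟨ +-identityʳ (∑ (cube L) (λ U → ⟦ does (‖ U ‖ ≟ 0) ⟧)) ⟩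
      ∑ (cube L) (λ U → ⟦ does (‖ U ‖ ≟ 0) ⟧)   ≤⟨ count L zero ⟩
      1ℤ ∎
      where open ≤-Reasoning
    count (suc L) (suc r) = begin
      ∑ (cube (suc L)) (λ U → ⟦ does (‖ U ‖ ≟ suc r) ⟧)   ≡⟨ ∑-cube L _ ⟩
      ∑ (cube L) (λ U → ⟦ does (‖ U ‖ ≟ suc r) ⟧) + ∑ (cube L) (λ U → ⟦ does (‖ U ‖ ≟ r) ⟧) ≤⟨ +-mono-≤ (count L (suc r)) (count L r) ⟩
      + (L ℕ.^ suc r ℕ.+ L ℕ.^ r) ≤⟨ +≤+ (ℕ.≤-trans (ℕ.≤-reflexive (ℕ.+-comm (L ℕ.* L ℕ.^ r) (L ℕ.^ r)))
          (ℕ.*-monoʳ-≤ (suc L) (ℕ.^-monoˡ-≤ r (ℕ.n≤1+n L)))) ⟩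
      + (suc L ℕ.^ suc r) ∎
      where open ≤-Reasoning

  -- Each pebble replaces a weight 8 by `m`; multiplying by `8 ^ ‖ U ‖` avoids the exponent
  -- `L - ‖ U ‖`.
  weights-pebbles : ∀ {L} m (U : Vec Bool L) → + (8 ℕ.^ ‖ U ‖) * weights m U ≡ + (m ℕ.^ ‖ U ‖ ℕ.* 8 ℕ.^ L)
  weights-pebbles m []          = refl
  weights-pebbles {suc L} m (false ∷ U) = begin
    + (8 ℕ.^ ‖ U ‖) * (+ 8 * weights m U)       ≡⟨ swap (+ (8 ℕ.^ ‖ U ‖)) (+ 8) (weights m U) ⟩
    + 8 * (+ (8 ℕ.^ ‖ U ‖) * weights m U)       ≡⟨ cong (_*_ (+ 8)) (weights-pebbles m U) ⟩
    + 8 * + (m ℕ.^ ‖ U ‖ ℕ.* 8 ℕ.^ L)           ≡⟨ pos-* 8 (m ℕ.^ ‖ U ‖ ℕ.* 8 ℕ.^ L) ⟨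
    + (8 ℕ.* (m ℕ.^ ‖ U ‖ ℕ.* 8 ℕ.^ L))         ≡⟨ cong +_ (ℕ-swap 8 (m ℕ.^ ‖ U ‖) (8 ℕ.^ L)) ⟩
    + (m ℕ.^ ‖ U ‖ ℕ.* 8 ℕ.^ suc L)             ∎
    where
    open ≡-Reasoning
    swap : ∀ a b c → a * (b * c) ≡ b * (a * c)
    swap = solve-∀
    ℕ-swap : ∀ a b c → a ℕ.* (b ℕ.* c) ≡ b ℕ.* (a ℕ.* c)
    ℕ-swap = ℕ-Solver.solve-∀
  weights-pebbles {suc L} m (true ∷ U) = begin
    + (8 ℕ.* 8 ℕ.^ ‖ U ‖) * (+ m * weights m U)   ≡⟨ cong (_* (+ m * weights m U)) (pos-* 8 (8 ℕ.^ ‖ U ‖)) ⟩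
    + 8 * + (8 ℕ.^ ‖ U ‖) * (+ m * weights m U)   ≡⟨ swap (+ 8) (+ (8 ℕ.^ ‖ U ‖)) (+ m) (weights m U) ⟩
    + 8 * + m * (+ (8 ℕ.^ ‖ U ‖) * weights m U)   ≡⟨ cong₂ _*_ (sym (pos-* 8 m)) (weights-pebbles m U) ⟩
    + (8 ℕ.* m) * + (m ℕ.^ ‖ U ‖ ℕ.* 8 ℕ.^ L)     ≡⟨ pos-* (8 ℕ.* m) (m ℕ.^ ‖ U ‖ ℕ.* 8 ℕ.^ L) ⟨
    + (8 ℕ.* m ℕ.* (m ℕ.^ ‖ U ‖ ℕ.* 8 ℕ.^ L))     ≡⟨ cong +_ (ℕ-swap 8 m (m ℕ.^ ‖ U ‖) (8 ℕ.^ L)) ⟩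
    + (m ℕ.* m ℕ.^ ‖ U ‖ ℕ.* (8 ℕ.* 8 ℕ.^ L))     ∎
    where
    open ≡-Reasoning
    swap : ∀ a b c d → a * b * (c * d) ≡ a * c * (b * d)
    swap = solve-∀
    ℕ-swap : ∀ a b c d → a ℕ.* b ℕ.* (c ℕ.* d) ≡ b ℕ.* c ℕ.* (a ℕ.* d)
    ℕ-swap = ℕ-Solver.solve-∀

  weights-nonNeg : ∀ {L} m (U : Vec Bool L) → 0ℤ ≤ weights m U
  weights-nonNeg m []          = +≤+ ℕ.z≤n
  weights-nonNeg m (false ∷ U) = *-monoˡ-≤-nonNeg (+ 8) (weights-nonNeg m U)
  weights-nonNeg m (true  ∷ U) = subst (_≤ + m * weights m U) (*-zeroʳ (+ m)) (*-monoˡ-≤-nonNeg (+ m) (weights-nonNeg m U))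

  0≤i*j : ∀ {i j} → 0ℤ ≤ i → 0ℤ ≤ j → 0ℤ ≤ i * j
  0≤i*j {i} {j} 0≤i 0≤j = subst (_≤ i * j) (*-zeroʳ i) (*-monoˡ-≤-nonNeg i {{nonNegative 0≤i}} 0≤j)

  abs² : ∀ i → abs i ² ≡ i ²
  abs² (+ n)    = refl
  abs² -[1+ n ] = refl

  ∑-choices : ∀ m L c → ∑ (vecs (allFin m) L) (λ _ → c) ≡ + (m ℕ.^ L) * c
  ∑-choices m L c = trans (∑-vecs-const (allFin m) L c) (cong (λ n → + (n ℕ.^ L) * c) (length-allFin m))

  module _ {m L : ℕ} (k : ℕ) (J : Cut m L → ℤ) where

    private
      Φ = vecs (allFin m) L
      Q : Vec (Fin m) L → ℤ
      Q φ = ∑ (cube L) (λ U → ⟦ top k U ⟧ * (coeff U φ J) ²)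
      t = ∑ (cube L) (λ U → ⟦ top k U ⟧)
      w = m ℕ.^ suc k ℕ.* 8 ℕ.^ L
      W : Vec (Fin m) L → ℤ
      W φ = ∑ (cube L) (λ U → weights m U * (coeff U φ J) ²)
      C = ((2 ℕ.* m ℕ.+ 4) ℕ.* 2 ℕ.^ m) ℕ.^ L

      error²≤ : ∀ φ → (error k φ J) ² ≤ t * Q φ
      error²≤ φ = begin
        (error k φ J) ²
          -- The indicator is doubled so that Cauchy-Schwarz yields the number `t` of top sets
          -- instead of `2 ^ L`.
          ≡⟨ cong _² (∑-cong (cube L) (λ U → idem (top k U) (abs (coeff U φ J)))) ⟩
        (∑ (cube L) (λ U → ⟦ top k U ⟧ * (⟦ top k U ⟧ * abs (coeff U φ J)))) ²
          ≤⟨ cauchy-schwarz (cube L) (λ U → ⟦ top k U ⟧) (λ U → ⟦ top k U ⟧ * abs (coeff U φ J)) ⟩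
        ∑ (cube L) (λ U → ⟦ top k U ⟧ ²) * ∑ (cube L) (λ U → (⟦ top k U ⟧ * abs (coeff U φ J)) ²)
          ≡⟨ cong₂ _*_ (∑-cong (cube L) (λ U → idem₁ (top k U)))
               (∑-cong (cube L) (λ U → trans (idem₂ (top k U) (abs (coeff U φ J)))
                 (cong (_*_ ⟦ top k U ⟧) (abs² (coeff U φ J))))) ⟩
        t * Q φ ∎
        where
        open ≤-Reasoning
        idem : ∀ b i → ⟦ b ⟧ * i ≡ ⟦ b ⟧ * (⟦ b ⟧ * i)
        idem false i = refl
        idem true  i = cong (_*_ 1ℤ) (sym (*-identityˡ i))
        idem₁ : ∀ b → ⟦ b ⟧ ² ≡ ⟦ b ⟧
        idem₁ false = refl
        idem₁ true  = refl
        idem₂ : ∀ b i → (⟦ b ⟧ * i) ² ≡ ⟦ b ⟧ * i ²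
        idem₂ false i = refl
        idem₂ true  i = trans (cong _² (*-identityˡ i)) (sym (*-identityˡ (i ²)))

      -- All top sets have the same weight `w / 8 ^ suc k`, and the other sets add nonnegative terms
      -- on the right.
      weighted : ∀ φ → + w * Q φ ≤ + (8 ℕ.^ suc k) * W φ
      weighted φ = subst₂ _≤_ (∑-* (cube L) (+ w) (λ U → ⟦ top k U ⟧ * (coeff U φ J) ²))
        (∑-* (cube L) (+ (8 ℕ.^ suc k)) (λ U → weights m U * (coeff U φ J) ²))
        (∑-mono (cube L) (λ U → term U ((coeff U φ J) ²) (0≤i² (coeff U φ J))))
        where
        term : ∀ U i → 0ℤ ≤ i → + w * (⟦ top k U ⟧ * i) ≤ + (8 ℕ.^ suc k) * (weights m U * i)
        term U i 0≤i with ‖ U ‖ ≟ suc k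
        ... | yes U≡ = ≤-reflexive (begin
          + w * (⟦ top k U ⟧ * i)                 ≡⟨ cong (λ b → + w * (⟦ b ⟧ * i)) (dec-true (‖ U ‖ ≟ suc k) U≡) ⟩
          + w * (1ℤ * i)                          ≡⟨ cong₂ _*_ w≡ (*-identityˡ i) ⟩
          + (8 ℕ.^ suc k) * weights m U * i       ≡⟨ *-assoc (+ (8 ℕ.^ suc k)) (weights m U) i ⟩
          + (8 ℕ.^ suc k) * (weights m U * i)     ∎)
          where
          open ≡-Reasoning
          w≡ : + w ≡ + (8 ℕ.^ suc k) * weights m U
          w≡ = subst (λ r → + (m ℕ.^ r ℕ.* 8 ℕ.^ L) ≡ + (8 ℕ.^ r) * weights m U) U≡ (sym (weights-pebbles m U))
        ... | no U≢ = subst (_≤ + (8 ℕ.^ suc k) * (weights m U * i))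
          (sym (trans (cong (λ b → + w * (⟦ b ⟧ * i)) (dec-false (‖ U ‖ ≟ suc k) U≢)) (*-zeroʳ (+ w))))
          (0≤i*j {+ (8 ℕ.^ suc k)} (+≤+ ℕ.z≤n) (0≤i*j (weights-nonNeg m U) 0≤i))

      Q-nonNeg : ∀ φ → 0ℤ ≤ Q φ
      Q-nonNeg φ = ∑-nonNeg (cube L) (λ U → nonNeg (top k U) ((coeff U φ J) ²) (0≤i² (coeff U φ J)))
        where
        nonNeg : ∀ b i → 0ℤ ≤ i → 0ℤ ≤ ⟦ b ⟧ * i
        nonNeg false i 0≤i = ≤-refl
        nonNeg true  i 0≤i = subst (0ℤ ≤_) (sym (*-identityˡ i)) 0≤i

    -- Cauchy-Schwarz over `φ` and over the top sets leads to the weighted squares of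
    -- `tensor-bound`. Since `J y ² ≤ 1`, the squares of `J` sum to at most the number of cuts.
    mean-error : (∀ y → J y ² ≤ 1ℤ) →
      + w * (∑ Φ (λ φ → error k φ J)) ² ≤
      + (m ℕ.^ L ℕ.* (L ℕ.^ suc k ℕ.* (8 ℕ.^ suc k ℕ.* (C ℕ.* (2 ℕ.^ m) ℕ.^ L))))
    mean-error J²≤1 = begin
      + w * (∑ Φ (λ φ → error k φ J)) ²
        ≤⟨ *-monoˡ-≤-nonNeg (+ w) (∑²≤length*∑² Φ (λ φ → error k φ J)) ⟩
      + w * (+ length Φ * ∑ Φ (λ φ → (error k φ J) ²))
        ≤⟨ *-monoˡ-≤-nonNeg (+ w) (*-monoˡ-≤-nonNeg (+ length Φ) (∑-mono Φ error²≤)) ⟩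
      + w * (+ length Φ * ∑ Φ (λ φ → t * Q φ))
        ≡⟨ cong (λ z → + w * (+ length Φ * z)) (∑-* Φ t Q) ⟩
      + w * (+ length Φ * (t * ∑ Φ Q))
        ≡⟨ cong (λ z → + w * (z * (t * ∑ Φ Q))) length-Φ ⟩
      + w * (+ (m ℕ.^ L) * (t * ∑ Φ Q))
        ≤⟨ *-monoˡ-≤-nonNeg (+ w) (*-monoˡ-≤-nonNeg (+ (m ℕ.^ L))
             (*-monoʳ-≤-nonNeg (∑ Φ Q) {{nonNegative (∑-nonNeg Φ Q-nonNeg)}} (top-count L k))) ⟩
      + w * (+ (m ℕ.^ L) * (+ (L ℕ.^ suc k) * ∑ Φ Q))
        ≡⟨ swap (+ w) (+ (m ℕ.^ L)) (+ (L ℕ.^ suc k)) (∑ Φ Q) ⟩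
      + (m ℕ.^ L) * (+ (L ℕ.^ suc k) * (+ w * ∑ Φ Q))
        ≤⟨ *-monoˡ-≤-nonNeg (+ (m ℕ.^ L)) (*-monoˡ-≤-nonNeg (+ (L ℕ.^ suc k)) (begin
          + w * ∑ Φ Q                                ≡⟨ ∑-* Φ (+ w) Q ⟨
          ∑ Φ (λ φ → + w * Q φ)                      ≤⟨ ∑-mono Φ weighted ⟩
          ∑ Φ (λ φ → + (8 ℕ.^ suc k) * W φ)          ≡⟨ ∑-* Φ (+ (8 ℕ.^ suc k)) W ⟩
          + (8 ℕ.^ suc k) * ∑ Φ W                    ≤⟨ *-monoˡ-≤-nonNeg (+ (8 ℕ.^ suc k)) (tensor-bound m L J) ⟩
          + (8 ℕ.^ suc k) * (+ C * ∑ Y (λ y → J y ²))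
            ≤⟨ *-monoˡ-≤-nonNeg (+ (8 ℕ.^ suc k)) (*-monoˡ-≤-nonNeg (+ C) (begin
              ∑ Y (λ y → J y ²)                      ≤⟨ ∑-mono Y J²≤1 ⟩
              ∑ Y (λ _ → 1ℤ)                         ≡⟨ ∑-vecs-const (cube m) L 1ℤ ⟩
              + (length (cube m) ℕ.^ L) * 1ℤ         ≡⟨ *-identityʳ (+ (length (cube m) ℕ.^ L)) ⟩
              + (length (cube m) ℕ.^ L)              ≡⟨ cong (λ n → + (n ℕ.^ L)) length-cube ⟩
              + ((2 ℕ.^ m) ℕ.^ L)                    ∎)) ⟩
          + (8 ℕ.^ suc k) * (+ C * + ((2 ℕ.^ m) ℕ.^ L)) ∎)) ⟩
      + (m ℕ.^ L) * (+ (L ℕ.^ suc k) * (+ (8 ℕ.^ suc k) * (+ C * + ((2 ℕ.^ m) ℕ.^ L))))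
        ≡⟨ collect (m ℕ.^ L) (L ℕ.^ suc k) (8 ℕ.^ suc k) C ((2 ℕ.^ m) ℕ.^ L) ⟩
      + (m ℕ.^ L ℕ.* (L ℕ.^ suc k ℕ.* (8 ℕ.^ suc k ℕ.* (C ℕ.* (2 ℕ.^ m) ℕ.^ L)))) ∎
      where
      open ≤-Reasoning
      Y = vecs (cube m) L
      swap : ∀ a b c d → a * (b * (c * d)) ≡ b * (c * (a * d))
      swap = solve-∀
      collect : ∀ a b c d e → + a * (+ b * (+ c * (+ d * + e))) ≡ + (a ℕ.* (b ℕ.* (c ℕ.* (d ℕ.* e))))
      collect a b c d e = trans (cong (_*_ (+ a)) (trans (cong (_*_ (+ b)) (trans
        (cong (_*_ (+ c)) (sym (pos-* d e))) (sym (pos-* c (d ℕ.* e))))) (sym (pos-* b (c ℕ.* (d ℕ.* e))))))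
        (sym (pos-* a (b ℕ.* (c ℕ.* (d ℕ.* e)))))
      length≡ : ∀ {A : Set} (xs : List A) → + length xs ≡ ∑ xs (λ _ → 1ℤ)
      length≡ xs = sym (trans (∑-const xs 1ℤ) (*-identityʳ (+ length xs)))
      length-Φ : + length Φ ≡ + (m ℕ.^ L)
      length-Φ = trans (length≡ Φ) (trans (∑-choices m L 1ℤ) (*-identityʳ (+ (m ℕ.^ L))))
      length-cube : length (cube m) ≡ 2 ℕ.^ m
      length-cube = +-injective (trans (length≡ (cube m)) (trans (∑-vecs-const bools m 1ℤ) (*-identityʳ (2^ m))))

  *-^ : ∀ n i j → (i ℕ.* j) ℕ.^ n ≡ i ℕ.^ n ℕ.* j ℕ.^ n
  *-^ zero    i j = refl
  *-^ (suc n) i j = trans (cong (i ℕ.* j ℕ.*_) (*-^ n i j)) (swap i j (i ℕ.^ n) (j ℕ.^ n))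
    where
    swap : ∀ a b c d → a ℕ.* b ℕ.* (c ℕ.* d) ≡ a ℕ.* c ℕ.* (b ℕ.* d)
    swap = ℕ-Solver.solve-∀

  ²-mono : ∀ {i j} → 0ℤ ≤ i → i ≤ j → i ² ≤ j ²
  ²-mono {i} {j} 0≤i i≤j = ≤-trans (*-monoˡ-≤-nonNeg i {{nonNegative 0≤i}} i≤j)
    (*-monoʳ-≤-nonNeg j {{nonNegative (≤-trans 0≤i i≤j)}} i≤j)

  module _ {m n′ size : ℕ} .{{_ : ℕ.NonZero m}} (k : ℕ) (2^k≤n : 2 ℕ.^ k ℕ.≤ suc n′)
           (J : Fin size → Cut m (suc n′) → ℤ) {s t : Fin size}
           (J₁ : ∀ c → J s c ≡ 1ℤ) (J₀ : ∀ c → J t c ≡ 0ℤ) (J²≤1 : ∀ x c → J x c ² ≤ 1ℤ)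
           (walk : ∀ φ → Star (λ x y → Step φ (J x) (J y)) s t) where

    private
      n = suc n′
      Φ = vecs (allFin m) n
      S : Fin size → ℤ
      S x = ∑ Φ (λ φ → error k φ (J x))
      a = m ℕ.^ n
      K = (2 ℕ.^ m) ℕ.^ n
      w = m ℕ.^ suc k ℕ.* 8 ℕ.^ n
      C = ((2 ℕ.* m ℕ.+ 4) ℕ.* 2 ℕ.^ m) ℕ.^ n
      R = a ℕ.* (n ℕ.^ suc k ℕ.* (8 ℕ.^ suc k ℕ.* (C ℕ.* K)))

      aK≤ : + (a ℕ.* K) ≤ 2^ n * (+ 2 * ∑ (allFin size) S)
      aK≤ = begin
        + (a ℕ.* K)               ≡⟨ pos-* a K ⟩
        + a * + K                 ≡⟨ ∑-choices m n (+ K) ⟨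
        ∑ Φ (λ _ → + K)
          ≤⟨ ∑-mono Φ (λ φ → total-error k 2^k≤n φ J (proj₂ (simplify Fin._≟_ (walk φ))) J₁ J₀) ⟩
        ∑ Φ (λ φ → 2^ n * (+ 2 * ∑ (allFin size) (λ x → error k φ (J x))))
          ≡⟨ trans (∑-* Φ (2^ n) (λ φ → + 2 * ∑ (allFin size) (λ x → error k φ (J x))))
               (cong (_*_ (2^ n)) (trans (∑-* Φ (+ 2) (λ φ → ∑ (allFin size) (λ x → error k φ (J x))))
                 (cong (_*_ (+ 2)) (∑-swap Φ (allFin size) (λ φ x → error k φ (J x)))))) ⟩
        2^ n * (+ 2 * ∑ (allFin size) S) ∎
        where open ≤-Reasoning

      squared : + (w ℕ.* ((a ℕ.* K) ℕ.* (a ℕ.* K))) ≤ + (4 ℕ.* (2 ℕ.^ n ℕ.* 2 ℕ.^ n) ℕ.* (size ℕ.* (size ℕ.* R)))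
      squared = begin
        + (w ℕ.* ((a ℕ.* K) ℕ.* (a ℕ.* K)))
          ≡⟨ trans (pos-* w ((a ℕ.* K) ℕ.* (a ℕ.* K))) (cong (_*_ (+ w)) (pos-* (a ℕ.* K) (a ℕ.* K))) ⟩
        + w * (+ (a ℕ.* K)) ²
          ≤⟨ *-monoˡ-≤-nonNeg (+ w) (²-mono (+≤+ ℕ.z≤n) aK≤) ⟩
        + w * (2^ n * (+ 2 * ∑ (allFin size) S)) ²
          ≡⟨ e₁ (+ w) (2^ n) (∑ (allFin size) S) ⟩
        + 4 * (2^ n * 2^ n) * (+ w * (∑ (allFin size) S) ²)
          ≡⟨ cong (_* (+ w * (∑ (allFin size) S) ²)) 4tt ⟩
        + 4tt′ * (+ w * (∑ (allFin size) S) ²)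
          -- Cauchy-Schwarz over the network vertices contributes one factor `size`; summing the
          -- bound `R` over them contributes the other.
          ≤⟨ *-monoˡ-≤-nonNeg (+ 4tt′) (*-monoˡ-≤-nonNeg (+ w) (∑²≤length*∑² (allFin size) S)) ⟩
        + 4tt′ * (+ w * (+ length (allFin size) * ∑ (allFin size) (λ x → S x ²)))
          ≡⟨ cong (_*_ (+ 4tt′)) (trans (e₂ (+ w) (+ length (allFin size)) (∑ (allFin size) (λ x → S x ²)))
               (cong (λ z → + z * (+ w * ∑ (allFin size) (λ x → S x ²))) (length-allFin size))) ⟩
        + 4tt′ * (+ size * (+ w * ∑ (allFin size) (λ x → S x ²)))
          ≡⟨ cong (λ z → + 4tt′ * (+ size * z)) (∑-* (allFin size) (+ w) (λ x → S x ²)) ⟨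
        + 4tt′ * (+ size * ∑ (allFin size) (λ x → + w * S x ²))
          ≤⟨ *-monoˡ-≤-nonNeg (+ 4tt′) (*-monoˡ-≤-nonNeg (+ size)
               (∑-mono (allFin size) (λ x → mean-error k (J x) (J²≤1 x)))) ⟩
        + 4tt′ * (+ size * ∑ (allFin size) (λ _ → + R))
          ≡⟨ cong (λ z → + 4tt′ * (+ size * z)) (trans (∑-const (allFin size) (+ R))
               (cong (λ z → + z * + R) (length-allFin size))) ⟩
        + 4tt′ * (+ size * (+ size * + R))
          ≡⟨ trans (cong (λ z → + 4tt′ * (+ size * z)) (sym (pos-* size R)))
               (trans (cong (_*_ (+ 4tt′)) (sym (pos-* size (size ℕ.* R)))) (sym (pos-* 4tt′ (size ℕ.* (size ℕ.* R))))) ⟩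
        + (4tt′ ℕ.* (size ℕ.* (size ℕ.* R))) ∎
        where
        open ≤-Reasoning
        4tt′ = 4 ℕ.* (2 ℕ.^ n ℕ.* 2 ℕ.^ n)
        4tt : + 4 * (2^ n * 2^ n) ≡ + 4tt′
        4tt = trans (cong (_*_ (+ 4)) (sym (pos-* (2 ℕ.^ n) (2 ℕ.^ n)))) (sym (pos-* 4 (2 ℕ.^ n ℕ.* 2 ℕ.^ n)))
        e₁ : ∀ w t s → w * ((t * (+ 2 * s)) * (t * (+ 2 * s))) ≡ + 4 * (t * t) * (w * (s * s))
        e₁ = solve-∀
        e₂ : ∀ w l q → w * (l * q) ≡ l * (w * q)
        e₂ = solve-∀

    -- Cancelling common factors in `squared`: `8 ^ n` in `w` meets the powers of two on the right,
    -- and of `(2 m + 4) ^ n` only `(m + 2) ^ n` is left.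
    size-bound : m ℕ.^ suc k ℕ.* m ℕ.^ n ℕ.≤
                 4 ℕ.* (size ℕ.* size) ℕ.* ((8 ℕ.* n) ℕ.^ suc k ℕ.* (m ℕ.+ 2) ℕ.^ n)
    size-bound = ℕ.*-cancelˡ-≤ (K ℕ.* K ℕ.* a ℕ.* (T ℕ.* (T ℕ.* T))) {{nonZero}}
      (subst₂ ℕ._≤_ lhs rhs (drop‿+≤+ squared))
      where
      T = 2 ℕ.^ n
      P = (m ℕ.+ 2) ℕ.^ n
      nonZero : ℕ.NonZero (K ℕ.* K ℕ.* a ℕ.* (T ℕ.* (T ℕ.* T)))
      nonZero = ℕ.m*n≢0 (K ℕ.* K ℕ.* a) (T ℕ.* (T ℕ.* T)) {{ℕ.m*n≢0 (K ℕ.* K) a {{ℕ.m*n≢0 K K {{K≢0}} {{K≢0}}}} {{ℕ.m^n≢0 m n}}}}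
        {{ℕ.m*n≢0 T (T ℕ.* T) {{ℕ.m^n≢0 2 n}} {{ℕ.m*n≢0 T T {{ℕ.m^n≢0 2 n}} {{ℕ.m^n≢0 2 n}}}}}}
        where
        K≢0 : ℕ.NonZero K
        K≢0 = ℕ.m^n≢0 (2 ℕ.^ m) n {{ℕ.m^n≢0 2 m}}
      8^n : 8 ℕ.^ n ≡ T ℕ.* (T ℕ.* T)
      8^n = trans (*-^ n 2 4) (cong (T ℕ.*_) (*-^ n 2 2))
      C≡ : C ≡ T ℕ.* P ℕ.* K
      C≡ = trans (*-^ n (2 ℕ.* m ℕ.+ 4) (2 ℕ.^ m)) (cong (ℕ._* K)
        (trans (cong (ℕ._^ n) (sym (ℕ.*-distribˡ-+ 2 m 2))) (*-^ n 2 (m ℕ.+ 2))))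
      lhs : w ℕ.* ((a ℕ.* K) ℕ.* (a ℕ.* K)) ≡ K ℕ.* K ℕ.* a ℕ.* (T ℕ.* (T ℕ.* T)) ℕ.* (m ℕ.^ suc k ℕ.* a)
      lhs = trans (cong (λ e → m ℕ.^ suc k ℕ.* e ℕ.* ((a ℕ.* K) ℕ.* (a ℕ.* K))) 8^n)
        (e (m ℕ.^ suc k) a K (T ℕ.* (T ℕ.* T)))
        where
        e : ∀ q a K T → q ℕ.* T ℕ.* ((a ℕ.* K) ℕ.* (a ℕ.* K)) ≡ K ℕ.* K ℕ.* a ℕ.* T ℕ.* (q ℕ.* a)
        e = ℕ-Solver.solve-∀
      rhs : 4 ℕ.* (T ℕ.* T) ℕ.* (size ℕ.* (size ℕ.* R)) ≡
            K ℕ.* K ℕ.* a ℕ.* (T ℕ.* (T ℕ.* T)) ℕ.* (4 ℕ.* (size ℕ.* size) ℕ.* ((8 ℕ.* n) ℕ.^ suc k ℕ.* P))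
      rhs = trans (cong (λ C → 4 ℕ.* (T ℕ.* T) ℕ.* (size ℕ.* (size ℕ.* (a ℕ.* (n ℕ.^ suc k ℕ.* (8 ℕ.^ suc k ℕ.* (C ℕ.* K))))))) C≡)
        (trans (e T size a (n ℕ.^ suc k) (8 ℕ.^ suc k) P K)
          (cong (λ q → K ℕ.* K ℕ.* a ℕ.* (T ℕ.* (T ℕ.* T)) ℕ.* (4 ℕ.* (size ℕ.* size) ℕ.* (q ℕ.* P)))
            (sym (*-^ (suc k) 8 n))))
        where
        e : ∀ T z a x y P K → 4 ℕ.* (T ℕ.* T) ℕ.* (z ℕ.* (z ℕ.* (a ℕ.* (x ℕ.* (y ℕ.* (T ℕ.* P ℕ.* K ℕ.* K)))))) ≡
            K ℕ.* K ℕ.* a ℕ.* (T ℕ.* (T ℕ.* T)) ℕ.* (4 ℕ.* (z ℕ.* z) ℕ.* (y ℕ.* x ℕ.* P))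
        e = ℕ-Solver.solve-∀

-- From a sound network to functions of cuts

module Cuts where

  open import Data.Bool as Bool using (Bool; true; false; not; _∧_; _∨_; T?)
  open import Data.Fin using (Fin; zero; suc; inject₁; fromℕ; _≟_)
  open import Data.Fin.Properties using (any?)
  open import Data.Fin.Relation.Unary.Top using (View; view; ‵fromℕ; ‵inject₁; view-fromℕ; view-inject₁)
  import Data.Integer as ℤ
  import Data.Integer.Properties as ℤ
  open import Data.List using (List; length; allFin)
  open import Data.Nat using (ℕ; zero; suc; _≤_; _+_; _*_; _^_; z≤n; s≤s; NonZero)
  open import Data.Nat.Properties hiding (_≟_)
  open import Data.Product using (_×_; _,_; ∃-syntax; proj₁; proj₂)
  open import Data.Product.Properties using (≡-dec)
  open import Data.Sum using (_⊎_; inj₁; inj₂)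
  open import Data.Vec using (Vec; lookup)
  open import Defs hiding (fromℕ)
  open import Function using (_∘_; mk⇔)
  open import Function.Definitions using (Injective)
  open import Relation.Binary.Construct.Closure.ReflexiveTransitive using (Star; ε; _◅_; _◅◅_; gmap)
  open import Relation.Binary.Definitions using (Decidable)
  open import Relation.Binary.PropositionalEquality
  open import Relation.Nullary using (¬_; Dec; does; contradiction)
  open import Relation.Nullary.Decidable using (dec-true; dec-false; _×-dec_; _⊎-dec_; does-⇔; ⌊_⌋; toWitness; fromWitness; map′)
  open CubeSums using (∑; ∑-const; _²; length-allFin; Cut; bit)
  open Functionals

  Within : ∀ {A : Set} → (A → A → Set) → ℕ → A → A → Set
  Within R zero    x y = x ≡ y
  Within R (suc d) x y = x ≡ y ⊎ ∃[ z ] (R x z × Within R d z y)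

  within-mono : ∀ {A : Set} {R : A → A → Set} {d e x y} → d ≤ e → Within R d x y → Within R e x y
  within-mono {e = zero}  z≤n x≡y = x≡y
  within-mono {e = suc e} z≤n x≡y = inj₁ x≡y
  within-mono (s≤s d≤e) (inj₁ x≡y)           = inj₁ x≡y
  within-mono (s≤s d≤e) (inj₂ (z , xRz , w)) = inj₂ (z , xRz , within-mono d≤e w)

  within⇒star : ∀ {A : Set} {R : A → A → Set} d {x y} → Within R d x y → Star R x y
  within⇒star zero    refl                 = ε
  within⇒star (suc d) (inj₁ refl)          = ε
  within⇒star (suc d) (inj₂ (z , xRz , w)) = xRz ◅ within⇒star d w

  simple⇒within : ∀ {A : Set} {R : A → A → Set} {x vs y} → SimplePath R x vs y → Within R (length vs) x y
  simple⇒within stop           = inj₁ refl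
  simple⇒within (step xRz _ p) = inj₂ (_ , xRz , simple⇒within p)

  simple-length : ∀ {n} {R : Fin n → Fin n → Set} {x vs y} → SimplePath R x vs y → length vs ≤ n
  simple-length {n} {vs = vs} p = ℤ.drop‿+≤+ (subst₂ ℤ._≤_ (∑-one vs)
    (trans (∑-one (allFin n)) (cong ℤ.+_ (length-allFin n)))
    (∑-simple (λ _ → ℤ.1ℤ) (λ _ → ℤ.+≤+ z≤n) p))
    where
    ∑-one : ∀ (xs : List (Fin n)) → ∑ xs (λ _ → ℤ.1ℤ) ≡ ℤ.+ length xs
    ∑-one xs = trans (∑-const xs ℤ.1ℤ) (ℤ.*-identityʳ (ℤ.+ length xs))

  within? : ∀ {n} {R : Fin n → Fin n → Set} → Decidable R → ∀ d → Decidable (Within R d)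
  within? R? zero    x y = x ≟ y
  within? R? (suc d) x y = (x ≟ y) ⊎-dec any? (λ z → R? x z ×-dec within? R? d z y)

  -- A walk freed of repetitions visits at most `n` vertices, so `n` steps suffice.
  star? : ∀ {n} {R : Fin n → Fin n → Set} → Decidable R → Decidable (Star R)
  star? {n} R? x y = map′ (within⇒star n)
    (λ xR*y → let (vs , p) = simplify _≟_ xR*y in within-mono (simple-length p) (simple⇒within p))
    (within? R? n x y)

  module _ {N : ℕ} (net : Network N) (G : Graph N) where

    open Network net using (ends; label; Joins; Traversable)

    joins? : ∀ e → Decidable (Joins e)
    joins? e x y = ≡-dec _≟_ _≟_ (ends e) (x , y) ⊎-dec ≡-dec _≟_ _≟_ (ends e) (y , x)

    traversable? : Decidable (Traversable G)
    traversable? x y = any? (λ e → joins? e x y ×-dec T? (G (proj₁ (proj₁ (label e))) (proj₂ (proj₁ (label e)))))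

    traversable-sym : ∀ {x y} → Traversable G x y → Traversable G y x
    traversable-sym (e , inj₁ j , g) = e , inj₂ j , g
    traversable-sym (e , inj₂ j , g) = e , inj₁ j , g

  module _ {N L′ m : ℕ} (s t : Fin N) (s≢t : s ≢ t) (vertex : Fin (suc L′) → Fin m → Fin N)
           (vertex-injective : ∀ {i j p q} → vertex i p ≡ vertex j q → i ≡ j × p ≡ q)
           (vertex≢s : ∀ i p → vertex i p ≢ s) (vertex≢t : ∀ i p → vertex i p ≢ t) where

    private
      L = suc L′

    chosen? : ∀ (y : Cut m L) v → Dec (∃[ i ] ∃[ p ] (v ≡ vertex i p × lookup (lookup y i) p ≡ true))
    chosen? y v = any? (λ i → any? (λ p → (v ≟ vertex i p) ×-dec (lookup (lookup y i) p Bool.≟ true)))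

    -- Vertices outside the columns, apart from `s`, count as right.
    left : Cut m L → Fin N → Bool
    left y v = does (v ≟ s) ∨ does (chosen? y v)

    left-s : ∀ y → left y s ≡ true
    left-s y = cong (_∨ does (chosen? y s)) (dec-true (s ≟ s) refl)

    left-t : ∀ y → left y t ≡ false
    left-t y = cong₂ _∨_ (dec-false (t ≟ s) (s≢t ∘ sym))
      (dec-false (chosen? y t) (λ (i , p , t≡ , _) → vertex≢t i p (sym t≡)))

    left-vertex : ∀ y i p → left y (vertex i p) ≡ lookup (lookup y i) p
    left-vertex y i p rewrite dec-false (vertex i p ≟ s) (vertex≢s i p) with lookup (lookup y i) p in yᵢₚ
    ... | true  = dec-true (chosen? y (vertex i p)) (i , p , refl , yᵢₚ)
    ... | false = dec-false (chosen? y (vertex i p)) unique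
      where
      unique : ¬ (∃[ j ] ∃[ q ] (vertex i p ≡ vertex j q × lookup (lookup y j) q ≡ true))
      unique (j , q , eq , yⱼ) with vertex-injective eq
      ... | refl , refl = contradiction (trans (sym yᵢₚ) yⱼ) λ ()

    cutGraph : Cut m L → Graph N
    cutGraph y u v = not (left y u ∧ not (left y v))

    cutGraph-edge : ∀ y {u v} → left y u ≡ false ⊎ left y v ≡ true → Edge (cutGraph y) u v
    cutGraph-edge y (inj₁ eq) rewrite eq = _
    cutGraph-edge y {u} (inj₂ eq) rewrite eq with left y u
    ... | true  = _
    ... | false = _

    cutGraph-left : ∀ y {u v} → Star (Edge (cutGraph y)) u v → left y u ≡ true → left y v ≡ true
    cutGraph-left y ε lu = lu
    cutGraph-left y {u} (_◅_ {j = w} uw wv) lu = cutGraph-left y wv (next uw)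
      where
      next : Edge (cutGraph y) u w → left y w ≡ true
      next rewrite lu with left y w
      ... | true  = λ _ → refl
      ... | false = λ ()

    cutGraph-disconnected : ∀ y → ¬ Star (Edge (cutGraph y)) s t
    cutGraph-disconnected y st = contradiction (trans (sym (cutGraph-left y st (left-s y))) (left-t y)) λ ()

    inner : Vec (Fin m) L → Fin (suc L) → Fin N
    inner φ i with view i
    ... | ‵fromℕ     = t
    ... | ‵inject₁ j = vertex j (lookup φ j)

    inner-last : ∀ φ → inner φ (fromℕ L) ≡ t
    inner-last φ rewrite view-fromℕ L = refl

    inner-inject₁ : ∀ φ j → inner φ (inject₁ j) ≡ vertex j (lookup φ j)
    inner-inject₁ φ j rewrite view-inject₁ j = refl

    inner≢s : ∀ φ i → inner φ i ≢ s
    inner≢s φ i with view i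
    ... | ‵fromℕ     = s≢t ∘ sym
    ... | ‵inject₁ j = vertex≢s j (lookup φ j)

    inner-injective : ∀ φ i j → inner φ i ≡ inner φ j → i ≡ j
    inner-injective φ i j eq with view i | view j
    ... | ‵fromℕ     | ‵fromℕ     = refl
    ... | ‵fromℕ     | ‵inject₁ b = contradiction (sym eq) (vertex≢t b (lookup φ b))
    ... | ‵inject₁ a | ‵fromℕ     = contradiction eq (vertex≢t a (lookup φ a))
    ... | ‵inject₁ a | ‵inject₁ b = cong inject₁ (proj₁ (vertex-injective eq))

    pathVertex : Vec (Fin m) L → Fin (suc (suc L)) → Fin N
    pathVertex φ zero    = s
    pathVertex φ (suc i) = inner φ i

    pathVertex-injective : ∀ φ → Injective _≡_ _≡_ (pathVertex φ)
    pathVertex-injective φ {zero}  {zero}  eq = refl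
    pathVertex-injective φ {zero}  {suc j} eq = contradiction (sym eq) (inner≢s φ j)
    pathVertex-injective φ {suc i} {zero}  eq = contradiction eq (inner≢s φ i)
    pathVertex-injective φ {suc i} {suc j} eq = cong suc (inner-injective φ i j eq)

    pathEdge? : ∀ φ a b → Dec (∃[ i ] (a ≡ pathVertex φ (inject₁ i) × b ≡ pathVertex φ (suc i)))
    pathEdge? φ a b = any? (λ i → (a ≟ pathVertex φ (inject₁ i)) ×-dec (b ≟ pathVertex φ (suc i)))

    pathGraph : Vec (Fin m) L → Graph N
    pathGraph φ a b = ⌊ pathEdge? φ a b ⌋

    pathGraph-𝒫 : ∀ φ → 𝒫 s t (suc L) (pathGraph φ)
    pathGraph-𝒫 φ = record
      { v        = pathVertex φ
      ; starts   = refl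
      ; finishes = inner-last φ
      ; distinct = pathVertex-injective φ
      ; edges    = λ a b → mk⇔ toWitness fromWitness
      }

    module _ (net : Network N) (solves : Solves s t (𝒫 s t (suc L)) net) where

      open Network net using (source; target; Traversable; label)

      reached? : ∀ x y → Dec (Star (Traversable (cutGraph y)) source x)
      reached? x y = star? (traversable? net (cutGraph y)) source x

      reached : Fin (size net) → Cut m L → ℤ.ℤ
      reached x y = ⟦ does (reached? x y) ⟧

      -- Network edges are undirected, so on an input containing the label either both ends are
      -- reached or neither. The values can differ only on cuts that the label crosses from left to
      -- right.
      reached-step : ∀ φ {x x′} → Traversable (pathGraph φ) x x′ → Step φ (reached x) (reached x′)
      reached-step φ {x} {x′} (e , joins , ab) = classify (toWitness ab)
        where
        a = proj₁ (proj₁ (label e))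
        b = proj₂ (proj₁ (label e))
        same : ∀ y → left y a ≡ false ⊎ left y b ≡ true → reached x y ≡ reached x′ y
        same y uncut = cong ⟦_⟧ (does-⇔ (mk⇔ (_◅◅ (xx′ ◅ ε)) (_◅◅ (traversable-sym net (cutGraph y) xx′ ◅ ε)))
          (reached? x y) (reached? x′ y))
          where
          xx′ : Traversable (cutGraph y) x x′
          xx′ = e , joins , cutGraph-edge y {a} {b} uncut
        left-inner : ∀ y j → left y (inner φ (inject₁ j)) ≡ bit φ y j
        left-inner y j = trans (cong (left y) (inner-inject₁ φ j)) (left-vertex y j (lookup φ j))
        classify : ∃[ i ] (a ≡ pathVertex φ (inject₁ i) × b ≡ pathVertex φ (suc i)) →
                   Step φ (reached x) (reached x′)
        classify (zero  , a≡ , b≡) = first (λ y y₀ →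
          same y (inj₂ (trans (cong (left y) b≡) (trans (left-inner y zero) y₀))))
        classify (suc i , a≡ , b≡) = classify-suc (view i) a≡ b≡
          where
          classify-suc : ∀ {i} → View i → a ≡ pathVertex φ (suc (inject₁ i)) → b ≡ pathVertex φ (suc (suc i)) →
                         Step φ (reached x) (reached x′)
          classify-suc ‵fromℕ       a≡ b≡ = last (λ y yₗ →
            same y (inj₁ (trans (cong (left y) a≡) (trans (left-inner y (fromℕ L′)) yₗ))))
          classify-suc (‵inject₁ j) a≡ b≡ = middle j
            (λ y yⱼ → same y (inj₁ (trans (cong (left y) a≡) (trans (left-inner y (inject₁ j)) yⱼ))))
            (λ y yⱼ → same y (inj₂ (trans (cong (left y) b≡) (trans (left-inner y (suc j)) yⱼ))))

      path-bound : .{{_ : NonZero m}} → ∀ k → 2 ^ k ≤ L →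
                   m ^ suc k * m ^ L ≤ 4 * (size net * size net) * ((8 * L) ^ suc k * (m + 2) ^ L)
      path-bound k 2^k≤L = size-bound k 2^k≤L reached
        (λ y → cong ⟦_⟧ (dec-true (reached? source y) ε))
        (λ y → cong ⟦_⟧ (dec-false (reached? target y) (proj₁ solves (cutGraph y) (cutGraph-disconnected y))))
        (λ x y → indicator² (does (reached? x y)))
        (λ φ → gmap (λ x → x) (reached-step φ) (proj₂ solves (pathGraph-𝒫 φ)))
        where
        indicator² : ∀ b → ⟦ b ⟧ ² ℤ.≤ ℤ.1ℤ
        indicator² false = ℤ.+≤+ z≤n
        indicator² true  = ℤ.≤-refl

-- The lower bound for one path length

module LowerBound where

  open import Data.Fin using (Fin; zero; suc; combine; inject≤)
  open import Data.Fin.Properties using (combine-injective; inject≤-injective; suc-injective)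
  open import Data.Fin.Subset using (Subset; inside; outside; ∣_∣; ∁; ⁅_⁆; _∪_; _∈_)
  open import Data.Fin.Subset.Properties
  open import Data.Nat using (ℕ; zero; suc; _≤_; _+_; _*_; _^_; _/_; z≤n; s≤s; NonZero; >-nonZero)
  open import Data.Nat.DivMod
  open import Data.Nat.Properties hiding (suc-injective)
  open import Data.Nat.Tactic.RingSolver using (solve-∀)
  open import Data.Product using (_,_; ∃-syntax)
  open import Data.Sum using (_⊎_; inj₁; inj₂)
  open import Data.Vec using (_∷_; here; there)
  open import Defs hiding (fromℕ)
  open import Relation.Binary.PropositionalEquality
  open import Relation.Nullary using (¬_; yes; no)
  open Functionals using (*-^)
  open Cuts

  element : ∀ {N} (p : Subset N) → Fin ∣ p ∣ → Fin N
  element (inside  ∷ p) zero    = zero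
  element (inside  ∷ p) (suc i) = suc (element p i)
  element (outside ∷ p) i       = suc (element p i)

  element-∈ : ∀ {N} (p : Subset N) i → element p i ∈ p
  element-∈ (inside  ∷ p) zero    = here
  element-∈ (inside  ∷ p) (suc i) = there (element-∈ p i)
  element-∈ (outside ∷ p) i       = there (element-∈ p i)

  element-injective : ∀ {N} (p : Subset N) {i j} → element p i ≡ element p j → i ≡ j
  element-injective (inside  ∷ p) {zero}  {zero}  eq = refl
  element-injective (inside  ∷ p) {suc i} {suc j} eq = cong suc (element-injective p (suc-injective eq))
  element-injective (outside ∷ p) eq = element-injective p (suc-injective eq)

  element-surjective : ∀ {N} (p : Subset N) {x} → x ∈ p → ∃[ i ] element p i ≡ x
  element-surjective (inside  ∷ p) here        = zero , refl
  element-surjective (inside  ∷ p) (there x∈p) with element-surjective p x∈p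
  ... | i , refl = suc i , refl
  element-surjective (outside ∷ p) (there x∈p) with element-surjective p x∈p
  ... | i , refl = i , refl

  module _ {N : ℕ} (s t : Fin N) where

    others : Subset N
    others = ∁ (⁅ s ⁆ ∪ ⁅ t ⁆)

    others-≢s : ∀ {x} → x ∈ others → x ≢ s
    others-≢s x∈ refl = x∈∁p⇒x∉p x∈ (p⊆p∪q ⁅ t ⁆ (x∈⁅x⁆ s))

    others-≢t : ∀ {x} → x ∈ others → x ≢ t
    others-≢t x∈ refl = x∈∁p⇒x∉p x∈ (q⊆p∪q ⁅ s ⁆ ⁅ t ⁆ (x∈⁅x⁆ t))

    ≢⇒others : ∀ {x} → x ≢ s → x ≢ t → x ∈ others
    ≢⇒others x≢s x≢t = x∉p⇒x∈∁p (λ x∈ → either (x∈p∪q⁻ ⁅ s ⁆ ⁅ t ⁆ x∈))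
      where
      either : ¬ (_ ⊎ _)
      either (inj₁ x∈s) = x≢s (x∈⁅y⁆⇒x≡y s x∈s)
      either (inj₂ x∈t) = x≢t (x∈⁅y⁆⇒x≡y t x∈t)

  -- Bernoulli's inequality `(1 + 2/m) ^ (-i) ≥ 1 - 2i/m` without division, `q` being `m - 2i`. The
  -- induction trades a factor `m + 2` for an increase of `q` by 2: `(m + 2) q ≤ (q + 2) m`, as
  -- `q ≤ m`.
  bernoulli : ∀ {m} i q → 2 * i + q ≡ m → (m + 2) ^ i * q ≤ m ^ i * m
  bernoulli {m} zero q refl = ≤-refl
  bernoulli {m} (suc i) q eq = begin
    (m + 2) * (m + 2) ^ i * q     ≡⟨ e₁ (m + 2) ((m + 2) ^ i) q ⟩
    (m + 2) ^ i * ((m + 2) * q)   ≤⟨ *-monoʳ-≤ ((m + 2) ^ i) shift ⟩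
    (m + 2) ^ i * ((2 + q) * m)   ≡⟨ *-assoc ((m + 2) ^ i) (2 + q) m ⟨
    (m + 2) ^ i * (2 + q) * m     ≤⟨ *-monoˡ-≤ m (bernoulli i (2 + q) (trans (e₂ i q) eq)) ⟩
    m ^ i * m * m                 ≡⟨ cong (_* m) (*-comm (m ^ i) m) ⟩
    m * m ^ i * m                 ∎
    where
    open ≤-Reasoning
    e₁ : ∀ a b c → a * b * c ≡ b * (a * c)
    e₁ = solve-∀
    e₂ : ∀ i q → 2 * i + (2 + q) ≡ 2 * suc i + q
    e₂ = solve-∀
    e₃ : ∀ m q → (m + 2) * q ≡ m * q + 2 * q
    e₃ = solve-∀
    e₄ : ∀ m q → m * q + 2 * m ≡ (2 + q) * m
    e₄ = solve-∀
    shift : (m + 2) * q ≤ (2 + q) * m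
    shift = subst₂ _≤_ (sym (e₃ m q)) (e₄ m q)
      (+-monoʳ-≤ (m * q) (*-monoʳ-≤ 2 (subst (q ≤_) eq (m≤n+m q (2 * suc i)))))

  -- From `bernoulli`, since `4 L ≤ m` makes `1 - 2L/m` at least one half.
  [m+2]^L≤2m^L : ∀ m L .{{_ : NonZero m}} → 4 * L ≤ m → (m + 2) ^ L ≤ 2 * m ^ L
  [m+2]^L≤2m^L m L 4L≤m with m≤n⇒∃[o]m+o≡n 4L≤m
  ... | o , refl = *-cancelʳ-≤ _ _ m′ (begin
    (m′ + 2) ^ L * (4 * L + o)          ≤⟨ *-monoʳ-≤ ((m′ + 2) ^ L) half ⟩
    (m′ + 2) ^ L * (2 * (2 * L + o))    ≡⟨ e₂ ((m′ + 2) ^ L) (2 * L + o) ⟩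
    2 * ((m′ + 2) ^ L * (2 * L + o))    ≤⟨ *-monoʳ-≤ 2 (bernoulli L (2 * L + o) (e₃ L o)) ⟩
    2 * (m′ ^ L * m′)                   ≡⟨ *-assoc 2 (m′ ^ L) m′ ⟨
    2 * m′ ^ L * m′                     ∎)
    where
    open ≤-Reasoning
    m′ = 4 * L + o
    half : 4 * L + o ≤ 2 * (2 * L + o)
    half = subst (4 * L + o ≤_) (e₁ L o) (+-monoʳ-≤ (4 * L) (m≤m+n o (o + 0)))
      where
      e₁ : ∀ L o → 4 * L + (o + (o + 0)) ≡ 2 * (2 * L + o)
      e₁ = solve-∀
    e₂ : ∀ a b → a * (2 * b) ≡ 2 * (a * b)
    e₂ = solve-∀
    e₃ : ∀ L o → 2 * L + (2 * L + o) ≡ 4 * L + o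
    e₃ = solve-∀

  size-nonZero : ∀ {N} (net : Network N) → NonZero (size net)
  size-nonZero net with size net | Network.source net
  ... | suc _ | _ = _

  lower-bound : ∀ {N} (s t : Fin N) → s ≢ t → ∀ L .{{_ : NonZero L}} k → 2 ^ k ≤ L → (net : Network N) →
    Solves s t (𝒫 s t (suc L)) net →
    ∣ others s t ∣ ^ suc k ≤ 4 * (size net * size net) * (64 * L ^ 2) ^ suc k
  lower-bound s t s≢t L@(suc _) k 2^k≤L net solves with ∣ others s t ∣ ≤? 64 * L ^ 2
  -- Here the base on the right is already at least `n`, and a network has at least one vertex.
  ... | yes n≤d = ≤-trans (^-monoˡ-≤ (suc k) n≤d)
    (m≤n*m ((64 * L ^ 2) ^ suc k) (4 * (size net * size net)) {{m*n≢0 4 (size net * size net) {{_}} {{m*n≢0 (size net) (size net) {{z≢0}} {{z≢0}}}}}})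
    where
    z≢0 = size-nonZero net
  ... | no n≰d = begin
    n ^ r                                      ≤⟨ ^-monoˡ-≤ r n≤2Lm ⟩
    (2 * L * m) ^ r                            ≡⟨ *-^ r (2 * L) m ⟩
    (2 * L) ^ r * m ^ r                        ≤⟨ *-monoʳ-≤ ((2 * L) ^ r) m^r≤ ⟩
    (2 * L) ^ r * (Z * ((8 * L) ^ r * 2))      ≡⟨ e₁ ((2 * L) ^ r) Z ((8 * L) ^ r) ⟩
    -- The 2 is enlarged to `4 ^ r` so that the base becomes `4 · 2L · 8L`.
    Z * (2 * ((2 * L) ^ r * (8 * L) ^ r))      ≤⟨ *-monoʳ-≤ Z (*-monoˡ-≤ ((2 * L) ^ r * (8 * L) ^ r) 2≤4^r) ⟩
    Z * (4 ^ r * ((2 * L) ^ r * (8 * L) ^ r))  ≡⟨ cong (Z *_) (trans (cong (4 ^ r *_) (sym (*-^ r (2 * L) (8 * L))))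
                                                    (trans (sym (*-^ r 4 (2 * L * (8 * L)))) (cong (_^ r) (e₂ L)))) ⟩
    Z * (64 * L ^ 2) ^ r                       ∎
    where
    open ≤-Reasoning
    n = ∣ others s t ∣
    r = suc k
    m = n / L
    Z = 4 * (size net * size net)
    -- More than the `4 L ≤ m` used below; the threshold is set by the trivial case.
    64L≤m : 64 * L ≤ m
    64L≤m = subst (_≤ m) (m*n/n≡m (64 * L) L) (/-monoˡ-≤ L (≤-trans (≤-reflexive (e L)) (<⇒≤ (≰⇒> n≰d))))
      where
      e : ∀ L → 64 * L * L ≡ 64 * (L * (L * 1))
      e = solve-∀
    instance
      m≢0 : NonZero m
      m≢0 = >-nonZero (≤-trans (s≤s z≤n) 64L≤m)
    Lm≤n : L * m ≤ n
    Lm≤n = subst (_≤ n) (*-comm m L) (m/n*n≤m n L)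
    vertex : Fin L → Fin m → Fin _
    vertex i p = element (others s t) (inject≤ (combine i p) Lm≤n)
    m^r≤ : m ^ r ≤ Z * ((8 * L) ^ r * 2)
    m^r≤ = *-cancelʳ-≤ (m ^ r) _ (m ^ L) {{m^n≢0 m L}} (begin
      m ^ r * m ^ L                             ≤⟨ path-bound s t s≢t vertex
        (λ {i} {j} {p} {q} eq → combine-injective i p j q (inject≤-injective Lm≤n Lm≤n _ _ (element-injective (others s t) eq)))
        (λ i p → others-≢s s t (element-∈ (others s t) _)) (λ i p → others-≢t s t (element-∈ (others s t) _))
        net solves k 2^k≤L ⟩
      Z * ((8 * L) ^ r * (m + 2) ^ L)           ≤⟨ *-monoʳ-≤ Z (*-monoʳ-≤ ((8 * L) ^ r)
                                                     ([m+2]^L≤2m^L m L (≤-trans (*-monoˡ-≤ L {4} {64} (s≤s (s≤s (s≤s (s≤s z≤n))))) 64L≤m))) ⟩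
      Z * ((8 * L) ^ r * (2 * m ^ L))           ≡⟨ e Z ((8 * L) ^ r) (m ^ L) ⟩
      Z * ((8 * L) ^ r * 2) * m ^ L             ∎)
      where
      e : ∀ a b c → a * (b * (2 * c)) ≡ a * (b * 2) * c
      e = solve-∀
    n≤2Lm : n ≤ 2 * L * m
    n≤2Lm = begin
      n                 ≡⟨ m≡m%n+[m/n]*n n L ⟩
      n % L + m * L     ≤⟨ +-monoˡ-≤ (m * L) (<⇒≤ (m%n<n n L)) ⟩
      L + m * L         ≤⟨ +-monoˡ-≤ (m * L) (m≤n*m L m) ⟩
      m * L + m * L     ≡⟨ e m L ⟩
      2 * L * m         ∎
      where
      e : ∀ m L → m * L + m * L ≡ 2 * L * m
      e = solve-∀
    2≤4^r : 2 ≤ 4 ^ r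
    2≤4^r = ≤-trans (s≤s (s≤s z≤n)) (m≤m*n 4 (4 ^ k) {{m^n≢0 4 k}})
    e₁ : ∀ a b c → a * (b * (c * 2)) ≡ b * (2 * (a * c))
    e₁ = solve-∀
    e₂ : ∀ L → 4 * (2 * L * (8 * L)) ≡ 64 * (L * (L * 1))
    e₂ = solve-∀

-- Existence of minimum sizes by finite search

module MinimumSize where

  open import Data.Bool as Bool using (Bool; true; false; not; _∧_; T; T?; if_then_else_)
  open import Data.Fin using (Fin; zero; suc; inject₁; fromℕ; combine; remQuot; _≟_)
  open import Data.Fin.Properties using (any?; all?; remQuot-combine)
  open import Data.Nat using (ℕ; zero; suc; _≤_; _<_; _*_; s≤s; s≤s⁻¹; _≤?_)
  open import Data.Nat.Properties using (≮⇒≥; m≤n⇒m<n∨m≡n; anyUpTo?; ≤-refl)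
  open import Data.Product using (_×_; _,_; ∃-syntax; ∃; proj₁; proj₂; map₂)
  open import Data.Product.Properties using (≡-dec)
  open import Data.Sum using (_⊎_; inj₁; inj₂)
  open import Data.Vec using (Vec; []; _∷_; lookup; tabulate)
  open import Data.Vec.Properties using (lookup∘tabulate)
  open import Defs hiding (fromℕ)
  open import Function using (_∘_; _⇔_; mk⇔; Equivalence)
  open import Level using (0ℓ)
  open import Relation.Binary.Construct.Closure.ReflexiveTransitive using (Star; ε; _◅_; gmap; concat) renaming (map to star-map)
  open import Relation.Binary.PropositionalEquality
  open import Relation.Nullary using (¬_; Dec; yes; no; contradiction)
  open import Relation.Nullary.Decidable using (_×-dec_; _→-dec_; ¬?; ⌊_⌋; toWitness; fromWitness; map′; decidable-stable)
  open import Relation.Unary using (Pred)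
  open Cuts using (star?; traversable?)

  open Equivalence using (to; from)

  -- Finiteness in the form of decidable existence. It passes from entries to vectors, so graphs and
  -- networks are recoded as nested vectors of Booleans.
  Searchable : Set → Set₁
  Searchable A = ∀ {P : A → Set} → (∀ a → Dec (P a)) → Dec (∃ P)

  search-bool : Searchable Bool
  search-bool P? with P? false | P? true
  ... | yes p | _     = yes (false , p)
  ... | no _  | yes p = yes (true , p)
  ... | no ¬p | no ¬q = no λ { (false , p) → ¬p p ; (true , q) → ¬q q }

  search-vec : ∀ {A} → Searchable A → ∀ n → Searchable (Vec A n)
  search-vec search zero    P? = map′ ([] ,_) (λ { ([] , p) → p }) (P? [])
  search-vec search (suc n) P? = map′ (λ (a , v , p) → a ∷ v , p) (λ { (a ∷ v , p) → a , v , p })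
    (search (λ a → search-vec search n (λ v → P? (a ∷ v))))

  forall? : ∀ {A} → Searchable A → ∀ {P : A → Set} → (∀ a → Dec (P a)) → Dec (∀ a → P a)
  forall? search P? with search (λ a → ¬? (P? a))
  ... | yes (a , ¬p) = no λ all → ¬p (all a)
  ... | no  ¬∃       = yes λ a → decidable-stable (P? a) (λ ¬p → ¬∃ (a , ¬p))

  least : ∀ {P : ℕ → Set} → (∀ n → Dec (P n)) → ∀ {b} → P b → ∃[ k ] (P k × (∀ j → P j → k ≤ j))
  least {P} P? {b} pb with below (suc b)
    where
    below : ∀ n → (∀ j → j < n → ¬ P j) ⊎ ∃[ k ] (P k × (∀ j → P j → k ≤ j))
    below zero = inj₁ λ _ ()
    below (suc n) with below n
    ... | inj₂ found = inj₂ found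
    ... | inj₁ none with P? n
    ...   | yes p = inj₂ (n , p , λ j pj → ≮⇒≥ (λ j<n → none j j<n pj))
    ...   | no ¬p = inj₁ λ j j<1+n pj → case j j<1+n pj (m≤n⇒m<n∨m≡n (s≤s⁻¹ j<1+n))
      where
      case : ∀ j → j < suc n → P j → ¬ (j < n ⊎ j ≡ n)
      case j _ pj (inj₁ j<n)  = none j j<n pj
      case j _ pj (inj₂ refl) = ¬p pj
  ... | inj₂ found = found
  ... | inj₁ none  = contradiction pb (none b ≤-refl)

  module _ {N : ℕ} (s t : Fin N) (s≢t : s ≢ t) where

    Slot : ℕ → Set
    Slot q = Fin q × Fin q × Fin N × Fin N

    decode : ∀ q → Fin (q * (q * (N * N))) → Slot q
    decode q e = map₂ (map₂ (remQuot N) ∘ remQuot (N * N)) (remQuot (q * (N * N)) e)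

    encode : ∀ {q} → Slot q → Fin (q * (q * (N * N)))
    encode (x , y , u , v) = combine x (combine y (combine u v))

    decode-encode : ∀ {q} (z : Slot q) → decode q (encode z) ≡ z
    decode-encode {q} (x , y , u , v) = trans
      (cong (map₂ (map₂ (remQuot N) ∘ remQuot (N * N))) (remQuot-combine x (combine y (combine u v)))) (trans
      (cong (λ e → x , map₂ (remQuot N) e) (remQuot-combine y (combine u v)))
      (cong (λ e → x , y , e) (remQuot-combine u v)))

    Rel : ℕ → Set
    Rel q = Fin q → Fin q → Fin N → Fin N → Bool

    slot-ends : ∀ {q} → Rel q → Slot q → Fin q × Fin q
    slot-ends rel (x , y , u , v) = if rel x y u v ∧ not ⌊ u ≟ v ⌋ then (x , y) else (x , x)

    -- A label needs distinct vertices; a slot with `u = v` receives the dummy `s → t`, harmless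
    -- since its ends coincide.
    slot-label : ∀ {q} → Slot q → ∃[ (v₁ , v₂) ] (v₁ ≢ v₂)
    slot-label (x , y , u , v) with u ≟ v
    ... | yes _  = (s , t) , s≢t
    ... | no u≢v = (u , v) , u≢v

    -- Slots that carry no edge become loops, which have no effect.
    relNetwork : ∀ {q} → Fin q → Fin q → Rel q → Network N
    relNetwork {q} source target rel = record
      { size   = q
      ; #edges = q * (q * (N * N))
      ; ends   = slot-ends rel ∘ decode q
      ; source = source
      ; target = target
      ; label  = slot-label ∘ decode q
      }

    module _ {q} (x₀ y₀ : Fin q) (rel : Rel q) (G : Graph N) where

      open Network (relNetwork x₀ y₀ rel) using (Traversable)

      Linked : Fin q → Fin q → Set
      Linked x y = ∃[ u ] ∃[ v ] (u ≢ v × T (rel x y u v) × Edge G u v)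

      linked⇒traversable : ∀ {x y} → Linked x y → Traversable G x y
      linked⇒traversable {x} {y} (u , v , u≢v , r , uv) = encode z ,
        inj₁ (trans (cong (slot-ends rel) (decode-encode z)) ends) ,
        subst (λ z → Edge G (proj₁ (proj₁ (slot-label z))) (proj₂ (proj₁ (slot-label z)))) (sym (decode-encode z)) labels
        where
        z = x , y , u , v
        ends : slot-ends rel z ≡ (x , y)
        ends with rel x y u v | u ≟ v
        ... | true | no _     = refl
        ... | true | yes refl = contradiction refl u≢v
        labels : Edge G (proj₁ (proj₁ (slot-label z))) (proj₂ (proj₁ (slot-label z)))
        labels with u ≟ v
        ... | no _     = uv
        ... | yes refl = contradiction refl u≢v

      linked⇒traversable′ : ∀ {x y} → Linked y x → Traversable G x y
      linked⇒traversable′ l with linked⇒traversable l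
      ... | e , inj₁ j , g = e , inj₂ j , g
      ... | e , inj₂ j , g = e , inj₁ j , g

      traversable⇒linked : ∀ {x y} → Traversable G x y → x ≡ y ⊎ Linked x y ⊎ Linked y x
      traversable⇒linked (e , joins , g) = go (decode q e) joins g
        where
        go : ∀ {x y} z → slot-ends rel z ≡ (x , y) ⊎ slot-ends rel z ≡ (y , x) →
             Edge G (proj₁ (proj₁ (slot-label z))) (proj₂ (proj₁ (slot-label z))) →
             x ≡ y ⊎ Linked x y ⊎ Linked y x
        go (x , y , u , v) joins g with rel x y u v in r | u ≟ v
        go (x , y , u , v) (inj₁ refl) g | true | no u≢v = inj₂ (inj₁ (u , v , u≢v , subst T (sym r) _ , g))
        go (x , y , u , v) (inj₂ refl) g | true | no u≢v = inj₂ (inj₂ (u , v , u≢v , subst T (sym r) _ , g))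
        go (x , y , u , v) (inj₁ refl) g | true  | yes _ = inj₁ refl
        go (x , y , u , v) (inj₂ refl) g | true  | yes _ = inj₁ refl
        go (x , y , u , v) (inj₁ refl) g | false | _     = inj₁ refl
        go (x , y , u , v) (inj₂ refl) g | false | _     = inj₁ refl

    Table : ℕ → Set
    Table q = Vec (Vec (Vec (Vec Bool N) N) q) q

    entry : ∀ {q} → Table q → Rel q
    entry tab x y u v = lookup (lookup (lookup (lookup tab x) y) u) v

    search-table : ∀ q → Searchable (Table q)
    search-table q = search-vec (search-vec (search-vec (search-vec search-bool N) N) q) q

    tableNetwork : ∀ {q} → Fin q → Fin q → Table q → Network N
    tableNetwork x y tab = relNetwork x y (entry tab)

    module _ (net : Network N) where

      open Network net using (ends; label; source; target; Traversable)

      connects? : ∀ x y u v → Dec (∃[ e ] (ends e ≡ (x , y) × proj₁ (label e) ≡ (u , v)))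
      connects? x y u v = any? (λ e → ≡-dec _≟_ _≟_ (ends e) (x , y) ×-dec ≡-dec _≟_ _≟_ (proj₁ (label e)) (u , v))

      table : Table (size net)
      table = tabulate λ x → tabulate λ y → tabulate λ u → tabulate λ v → ⌊ connects? x y u v ⌋

      entry-table : ∀ x y u v → entry table x y u v ≡ ⌊ connects? x y u v ⌋
      entry-table x y u v = trans
        (cong (λ w → lookup (lookup (lookup w y) u) v) (lookup∘tabulate _ x)) (trans
        (cong (λ w → lookup (lookup w u) v) (lookup∘tabulate _ y)) (trans
        (cong (λ w → lookup w v) (lookup∘tabulate _ u)) (lookup∘tabulate _ v)))

      table-accepts : ∀ G → Accepts net G ⇔ Accepts (tableNetwork source target table) G
      table-accepts G = mk⇔ (gmap (λ x → x) there) (concat ∘ gmap (λ x → x) back)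
        where
        linked : ∀ {x y} e → ends e ≡ (x , y) → Edge G (proj₁ (proj₁ (label e))) (proj₂ (proj₁ (label e))) →
                 Linked source target (entry table) G x y
        linked e j g = _ , _ , proj₂ (label e) ,
          subst T (sym (entry-table _ _ _ _)) (fromWitness (e , j , refl)) , g
        there : ∀ {x y} → Traversable G x y → Network.Traversable (tableNetwork source target table) G x y
        there (e , inj₁ j , g) = linked⇒traversable source target (entry table) G (linked e j g)
        there (e , inj₂ j , g) = linked⇒traversable′ source target (entry table) G (linked e j g)
        unlink : ∀ {x y} → Linked source target (entry table) G x y →
                 ∃[ e ] (ends e ≡ (x , y) × Edge G (proj₁ (proj₁ (label e))) (proj₂ (proj₁ (label e))))
        unlink {x} {y} (u , v , u≢v , r , g) with toWitness {a? = connects? x y u v} (subst T (entry-table x y u v) r)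
        ... | e , j , refl = e , j , g
        back : ∀ {x y} → Network.Traversable (tableNetwork source target table) G x y → Star (Traversable G) x y
        back tr with traversable⇒linked source target (entry table) G tr
        ... | inj₁ refl     = ε
        ... | inj₂ (inj₁ l) = let (e , j , g) = unlink l in (e , inj₁ j , g) ◅ ε
        ... | inj₂ (inj₂ l) = let (e , j , g) = unlink l in (e , inj₂ j , g) ◅ ε

    infix 4 _≐_
    -- Graphs are functions, so a graph and its table agree only pointwise. Quantifiers over graphs
    -- reduce to searches over tables because acceptance, connectedness and membership respect this
    -- relation.
    _≐_ : Graph N → Graph N → Set
    G ≐ H = ∀ u v → G u v ≡ H u v

    GraphTable : Set
    GraphTable = Vec (Vec Bool N) N

    graph : GraphTable → Graph N
    graph g u v = lookup (lookup g u) v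

    graphTable : Graph N → GraphTable
    graphTable G = tabulate λ u → tabulate λ v → G u v

    graph-table : ∀ G → G ≐ graph (graphTable G)
    graph-table G u v = sym (trans (cong (λ w → lookup w v) (lookup∘tabulate _ u)) (lookup∘tabulate _ v))

    ≐-sym : ∀ {G H} → G ≐ H → H ≐ G
    ≐-sym G≐H u v = sym (G≐H u v)

    accepts-≐ : ∀ (net : Network N) {G H} → G ≐ H → Accepts net G → Accepts net H
    accepts-≐ net G≐H = gmap (λ x → x) (λ (e , j , g) → e , j , subst T (G≐H _ _) g)

    connected-≐ : ∀ {G H} → G ≐ H → Star (Edge G) s t → Star (Edge H) s t
    connected-≐ G≐H = gmap (λ x → x) (subst T (G≐H _ _))

    search-graph : Searchable GraphTable
    search-graph = search-vec (search-vec search-bool N) N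

    accepts? : ∀ (net : Network N) G → Dec (Accepts net G)
    accepts? net G = star? (traversable? net G) (Network.source net) (Network.target net)

    sound? : ∀ (net : Network N) → Dec (Sound s t net)
    sound? net = map′
      (λ sound G ¬st acc → sound (graphTable G) (¬st ∘ connected-≐ (≐-sym (graph-table G)))
        (accepts-≐ net (graph-table G) acc))
      (λ sound g → sound (graph g))
      (forall? search-graph (λ g → ¬? (star? (λ u v → T? (graph g u v)) s t) →-dec ¬? (accepts? net (graph g))))

    module _ (I : Pred (Graph N) 0ℓ) (I? : ∀ G → Dec (I G)) (I-≐ : ∀ {G H} → G ≐ H → I G → I H) where

      solves? : ∀ (net : Network N) → Dec (Solves s t I net)
      solves? net = sound? net ×-dec map′
        (λ complete {G} i → accepts-≐ net (≐-sym (graph-table G)) (complete (graphTable G) (I-≐ (graph-table G) i)))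
        (λ complete g i → complete i)
        (forall? search-graph (λ g → I? (graph g) →-dec accepts? net (graph g)))

      Solvable : ℕ → Set
      Solvable q = ∃[ x ] ∃[ y ] ∃[ tab ] Solves s t I (tableNetwork {q} x y tab)

      solvable? : ∀ q → Dec (Solvable q)
      solvable? q = any? λ x → any? λ y → search-table q λ tab → solves? (tableNetwork x y tab)

      solves⇒solvable : ∀ net → Solves s t I net → Solvable (size net)
      solves⇒solvable net (sound , complete) = Network.source net , Network.target net , table net ,
        (λ G ¬st acc → sound G ¬st (from (table-accepts net G) acc)) ,
        (λ {G} i → to (table-accepts net G) (complete i))

      minimum-exists : ∀ net → Solves s t I net → ∃[ m ] IsMinimumSize s t I m
      minimum-exists net solves with least solvable? (solves⇒solvable net solves)
      ... | m , (x , y , tab , sol) , min = m , record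
        { attained = tableNetwork x y tab , sol , refl
        ; minimal  = λ net′ sol′ → min (size net′) (solves⇒solvable net′ sol′)
        }

    module _ {l : ℕ} {G : Graph N} where

      private
        Traces : (Fin (suc l) → Fin N) → Set
        Traces v = v zero ≡ s × v (fromℕ l) ≡ t × (∀ i j → v i ≡ v j → i ≡ j) ×
          (∀ a b → (Edge G a b → ∃[ i ] (a ≡ v (inject₁ i) × b ≡ v (suc i))) ×
                   (∃[ i ] (a ≡ v (inject₁ i) × b ≡ v (suc i)) → Edge G a b))

        traces? : ∀ v → Dec (Traces v)
        traces? v = (v zero ≟ s) ×-dec (v (fromℕ l) ≟ t) ×-dec
          (all? λ i → all? λ j → (v i ≟ v j) →-dec (i ≟ j)) ×-dec
          (all? λ a → all? λ b →
            let link? = any? λ i → (a ≟ v (inject₁ i)) ×-dec (b ≟ v (suc i))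
            in (T? (G a b) →-dec link?) ×-dec (link? →-dec T? (G a b)))

      𝒫? : Dec (𝒫 s t l G)
      𝒫? = map′ fromTraces toTraces (search-vec any? (suc l) (λ w → traces? (lookup w)))
        where
        fromTraces : ∃[ w ] Traces (lookup w) → 𝒫 s t l G
        fromTraces (w , st , fi , inj , ed) = record
          { v = lookup w ; starts = st ; finishes = fi ; distinct = inj _ _
          ; edges = λ a b → mk⇔ (proj₁ (ed a b)) (proj₂ (ed a b)) }
        toTraces : 𝒫 s t l G → ∃[ w ] Traces (lookup w)
        toTraces p = tabulate v , trans (lt zero) starts , trans (lt (fromℕ l)) finishes ,
          (λ i j eq → distinct (trans (sym (lt i)) (trans eq (lt j)))) ,
          (λ a b → (λ ab → let (i , p , q) = to (edges a b) ab in
                      i , trans p (sym (lt (inject₁ i))) , trans q (sym (lt (suc i)))) ,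
                   (λ (i , p , q) → from (edges a b)
                      (i , trans p (lt (inject₁ i)) , trans q (lt (suc i)))))
          where
          open 𝒫 p
          lt : ∀ i → lookup (tabulate v) i ≡ v i
          lt = lookup∘tabulate v

    𝒫-≐ : ∀ {l G H} → G ≐ H → 𝒫 s t l G → 𝒫 s t l H
    𝒫-≐ G≐H p = record
      { v = v ; starts = starts ; finishes = finishes ; distinct = distinct
      ; edges = λ a b → mk⇔ (to (edges a b) ∘ subst T (sym (G≐H a b))) (subst T (G≐H a b) ∘ from (edges a b)) }
      where open 𝒫 p

    𝒫≤? : ∀ l G → Dec (𝒫≤ s t l G)
    𝒫≤? l G = map′ (λ (j , j<1+l , 1≤j , p) → j , 1≤j , s≤s⁻¹ j<1+l , p)
      (λ (j , 1≤j , j≤l , p) → j , s≤s j≤l , 1≤j , p)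
      (anyUpTo? (λ j → (1 ≤? j) ×-dec 𝒫? {j} {G}) (suc l))

    𝒫≤-≐ : ∀ {l G H} → G ≐ H → 𝒫≤ s t l G → 𝒫≤ s t l H
    𝒫≤-≐ G≐H (j , 1≤j , j≤l , p) = j , 1≤j , j≤l , 𝒫-≐ G≐H p

-- Strategies for the reversible pebble game

module PebbleGame where

  open import Data.List using (List; []; _∷_; _++_; length)
  open import Data.List.Membership.Propositional using (_∈_)
  open import Data.List.Membership.Propositional.Properties using (∈-++⁺ˡ; ∈-++⁺ʳ; ∈-++⁻)
  open import Data.List.Properties using (length-++; ++-assoc)
  open import Data.List.Relation.Unary.All as All using (All; []; _∷_)
  import Data.List.Relation.Unary.All.Properties as All
  open import Data.List.Relation.Unary.Any using (here; there)
  open import Data.Nat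
  open import Data.Nat.Properties
  open import Data.Product using (_×_; _,_)
  open import Data.Sum using (inj₁; inj₂)
  open import Function using (_⇔_; mk⇔; Equivalence)
  open import Relation.Binary.Construct.Closure.ReflexiveTransitive using (Star; ε; _◅_; _◅◅_; reverse)
  open import Relation.Binary.PropositionalEquality
  open import Relation.Nullary using (yes; no; contradiction)

  open Equivalence using (to; from)

  -- The reversible pebble game with k pebbles on the vertices 1, …, j - 1 of a
  -- path; vertex 0 always counts as pebbled.
  module _ (j k : ℕ) where

    Inner : ℕ → Set
    Inner p = 0 < p × p < j

    -- Configurations are lists read as sets: `A` and `B` may differ only at `suc pos`, whose
    -- predecessor is pebbled in both. The limit counts repetitions, so superposed lists need not be
    -- kept disjoint.
    record Move (A B : List ℕ) : Set where
      field
        {pos}   : ℕ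
        inner   : suc pos < j
        A-valid : length A ≤ k × All Inner A
        B-valid : length B ≤ k × All Inner B
        A-prev  : pos ∈ 0 ∷ A
        B-prev  : pos ∈ 0 ∷ B
        elsewhere  : ∀ {r} → r ≢ suc pos → r ∈ A ⇔ r ∈ B

    move-sym : ∀ {A B} → Move A B → Move B A
    move-sym m = record
      { inner = inner ; A-valid = B-valid ; B-valid = A-valid ; A-prev = B-prev ; B-prev = A-prev
      ; elsewhere = λ r≢ → mk⇔ (from (elsewhere r≢)) (to (elsewhere r≢)) }
      where open Move m

    ∈-weaken : ∀ {q a : ℕ} {low Y} → q ∈ a ∷ low → a ∈ 0 ∷ Y → q ∈ 0 ∷ (low ++ Y)
    ∈-weaken (here refl)         (here refl) = here refl
    ∈-weaken {low = low} (here refl) (there a∈Y) = there (∈-++⁺ʳ low a∈Y)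
    ∈-weaken (there q∈low)       _           = there (∈-++⁺ˡ q∈low)

    -- The pebbles `low` are the same for every background `Y`, and may overlap it. Hence a stage
    -- can be replayed backwards after further pebbles have been placed.
    record Advance (f a d : ℕ) : Set where
      field
        low       : List ℕ
        length-≤  : length low ≤ f
        low-inner : All Inner low
        reaches   : a + d ∈ a ∷ low
        play      : ∀ Y → All Inner Y → f + length Y ≤ k → a ∈ 0 ∷ Y → Star Move Y (low ++ Y)

    module _ (f a e : ℕ) (c<j : a + 2 ^ f < j) (first : Advance f a (2 ^ f ∸ 1)) (second : Advance f (a + 2 ^ f) e) where

      private
        c = a + 2 ^ f
        q = a + (2 ^ f ∸ 1)
        c≡1+q : c ≡ suc q
        c≡1+q = trans (cong (a +_) (sym (m+[n∸m]≡n (m^n>0 2 f)))) (+-suc a (2 ^ f ∸ 1))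
        c-inner : Inner c
        c-inner = subst (0 <_) (sym c≡1+q) (s≤s z≤n) , c<j
        module F = Advance first
        module S = Advance second

      -- Advance by 2 ^ f - 1, place a pebble on c, and undo the first stage with
      -- the pebble on c left in place.
      compose : Advance (suc f) a (2 ^ f + e)
      compose = record
        { low       = S.low ++ c ∷ []
        ; length-≤  = subst (_≤ suc f) (sym (trans (length-++ S.low) (+-comm (length S.low) 1))) (s≤s S.length-≤)
        ; low-inner = All.++⁺ S.low-inner (c-inner ∷ [])
        ; reaches   = subst (_∈ a ∷ (S.low ++ c ∷ [])) (+-assoc a (2 ^ f) e) (there (c∈ S.reaches))
        ; play      = play
        }
        where
        c∈ : ∀ {x} → x ∈ c ∷ S.low → x ∈ S.low ++ c ∷ []
        c∈ (here refl) = ∈-++⁺ʳ S.low (here refl)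
        c∈ (there x∈)  = ∈-++⁺ˡ x∈
        play : ∀ Y → All Inner Y → suc f + length Y ≤ k → a ∈ 0 ∷ Y → Star Move Y ((S.low ++ c ∷ []) ++ Y)
        play Y Y-inner 1+f+Y≤k a∈Y = subst (Star Move Y) (sym (++-assoc S.low (c ∷ []) Y))
          (F.play Y Y-inner (<⇒≤ 1+f+Y≤k) a∈Y ◅◅
           place ◅
           reverse move-sym (F.play (c ∷ Y) (c-inner ∷ Y-inner) f+cY≤k (0∷ a∈Y)) ◅◅
           S.play (c ∷ Y) (c-inner ∷ Y-inner) f+cY≤k (there (here refl)))
          where
          f+cY≤k : f + length (c ∷ Y) ≤ k
          f+cY≤k = subst (_≤ k) (sym (+-suc f (length Y))) 1+f+Y≤k
          0∷ : ∀ {x} → x ∈ 0 ∷ Y → x ∈ 0 ∷ c ∷ Y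
          0∷ (here refl) = here refl
          0∷ (there x∈)  = there (there x∈)
          short : ∀ Z → f + length Z ≤ k → length (F.low ++ Z) ≤ k
          short Z f+Z≤k = subst (_≤ k) (sym (length-++ F.low)) (≤-trans (+-monoˡ-≤ (length Z) F.length-≤) f+Z≤k)
          place : Move (F.low ++ Y) (F.low ++ c ∷ Y)
          place = record
            { inner   = subst (_< j) c≡1+q c<j
            ; A-valid = short Y (<⇒≤ 1+f+Y≤k) , All.++⁺ F.low-inner Y-inner
            ; B-valid = short (c ∷ Y) f+cY≤k , All.++⁺ F.low-inner (c-inner ∷ Y-inner)
            ; A-prev  = ∈-weaken F.reaches a∈Y
            ; B-prev  = ∈-weaken F.reaches (0∷ a∈Y)
            ; elsewhere  = λ r≢ → mk⇔ add (remove r≢)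
            }
            where
            add : ∀ {r} → r ∈ F.low ++ Y → r ∈ F.low ++ c ∷ Y
            add r∈ with ∈-++⁻ F.low r∈
            ... | inj₁ r∈low = ∈-++⁺ˡ r∈low
            ... | inj₂ r∈Y   = ∈-++⁺ʳ F.low (there r∈Y)
            remove : ∀ {r} → r ≢ suc q → r ∈ F.low ++ c ∷ Y → r ∈ F.low ++ Y
            remove r≢ r∈ with ∈-++⁻ F.low r∈
            ... | inj₁ r∈low        = ∈-++⁺ˡ r∈low
            ... | inj₂ (here r≡c)   = contradiction (trans r≡c c≡1+q) r≢
            ... | inj₂ (there r∈Y)  = ∈-++⁺ʳ F.low r∈Y

    advance : ∀ f a d → d < 2 ^ f → a + d < j → Advance f a d
    advance zero a zero _ _ = record
      { low = [] ; length-≤ = z≤n ; low-inner = [] ; reaches = here (+-identityʳ a) ; play = λ _ _ _ _ → ε }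
    advance zero a (suc d) (s≤s ()) _
    advance (suc f) a d d<2^ a+d<j with d <? 2 ^ f
    ... | yes d<2^f = record
      { low = low ; length-≤ = m≤n⇒m≤1+n length-≤ ; low-inner = low-inner ; reaches = reaches
      ; play = λ Y Y-inner 1+f+Y≤k → play Y Y-inner (<⇒≤ 1+f+Y≤k) }
      where open Advance (advance f a d d<2^f a+d<j)
    ... | no d≮2^f with m≤n⇒∃[o]m+o≡n (≮⇒≥ d≮2^f)
    ...   | e , refl = compose f a e c<j
      (advance f a (2 ^ f ∸ 1) (≤-reflexive (m+[n∸m]≡n (m^n>0 2 f)))
        (≤-<-trans (+-monoʳ-≤ a (m∸n≤m (2 ^ f) 1)) c<j))
      (advance f (a + 2 ^ f) e (+-cancelˡ-< (2 ^ f) e (2 ^ f) (subst (2 ^ f + e <_) (cong (2 ^ f +_) (+-identityʳ (2 ^ f))) d<2^))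
        (subst (_< j) (sym (+-assoc a (2 ^ f) e)) a+d<j))
      where
      c<j : a + 2 ^ f < j
      c<j = ≤-<-trans (+-monoʳ-≤ a (m≤m+n (2 ^ f) e)) a+d<j

-- The network of pebble configurations

module UpperBound where

  open import Data.Fin as Fin using (Fin; zero; suc; inject₁; fromℕ; fromℕ<; toℕ; splitAt; _↑ˡ_; _↑ʳ_; finToFun; funToFin; _≟_)
  open import Data.Fin.Properties using (any?; all?; splitAt-↑ˡ; splitAt-↑ʳ; finToFun-funToFin; fromℕ<-injective; toℕ-injective; toℕ-fromℕ<; toℕ-fromℕ; toℕ-inject₁; toℕ<n)
  open import Data.Fin.Subset using (∣_∣)
  open import Data.Fin.Subset.Properties using (_∈?_)
  open import Data.List using (List; []; _∷_; _++_; length; map)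
  open import Data.List.Membership.Propositional using (_∈_)
  open import Data.List.Membership.Propositional.Properties using (∈-map⁺; ∈-map⁻)
  open import Data.List.Properties using (length-map; ++-identityʳ)
  open import Data.List.Relation.Unary.All as All using (All; []; _∷_)
  open import Data.List.Relation.Unary.Any using (here; there)
  open import Data.Nat hiding (_≟_)
  open import Data.Nat.Properties hiding (_≟_)
  open import Data.Product using (_×_; _,_; ∃-syntax; proj₁; proj₂)
  open import Data.Sum using (_⊎_; inj₁; inj₂)
  open import Defs hiding (fromℕ)
  open import Function using (_⇔_; mk⇔; Equivalence; _∘_)
  open import Relation.Binary.Construct.Closure.ReflexiveTransitive using (Star; ε; _◅_; _◅◅_; gmap)
  open import Relation.Binary.PropositionalEquality
  open import Relation.Nullary using (¬_; Dec; yes; no; contradiction)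
  open import Relation.Nullary.Decidable using (_×-dec_; _⊎-dec_; _→-dec_; ¬?; ⌊_⌋; toWitness; fromWitness)
  open LowerBound using (element; element-surjective; others; ≢⇒others)
  open MinimumSize
  open PebbleGame

  open Equivalence using (to; from)

  module _ {n : ℕ} where

    -- Reading a short list as a k-tuple with the same entries, padded with a.
    entryOr : Fin n → List (Fin n) → ∀ {k} → Fin k → Fin n
    entryOr a []      i       = a
    entryOr a (b ∷ B) zero    = b
    entryOr a (b ∷ B) (suc i) = entryOr a B i

    entryOr-∈ : ∀ a A {k} (i : Fin k) → entryOr a A i ∈ a ∷ A
    entryOr-∈ a []      i       = here refl
    entryOr-∈ a (b ∷ B) zero    = there (here refl)
    entryOr-∈ a (b ∷ B) (suc i) with entryOr-∈ a B i
    ... | here eq  = here eq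
    ... | there b∈ = there (there b∈)

    ∈-entryOr : ∀ a {A b k} → b ∈ A → length A ≤ k → ∃[ i ] entryOr a A {k} i ≡ b
    ∈-entryOr a (here refl) (s≤s _)   = zero , refl
    ∈-entryOr a (there b∈)  (s≤s A≤k) = let (i , eq) = ∈-entryOr a b∈ A≤k in suc i , eq

  module _ {N : ℕ} (s t : Fin N) (s≢t : s ≢ t) (k : ℕ) where

    private
      n = ∣ others s t ∣
      vertexOf = element (others s t)

    source target : Fin (n ^ k + 2)
    source = (n ^ k) ↑ʳ zero
    target = (n ^ k) ↑ʳ suc zero

    -- Read `v` as certified reachable from `s` at the given network vertex. Tuples with the same
    -- entries certify the same vertices.
    HoldsAt : Fin (n ^ k) ⊎ Fin 2 → Fin N → Set
    HoldsAt (inj₁ c)          v = v ≡ s ⊎ ∃[ i ] v ≡ vertexOf (finToFun {n} {k} c i)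
    HoldsAt (inj₂ zero)       v = v ≡ s
    HoldsAt (inj₂ (suc zero)) v = v ≡ t

    Holds : Fin (n ^ k + 2) → Fin N → Set
    Holds x = HoldsAt (splitAt (n ^ k) x)

    holds? : ∀ x v → Dec (Holds x v)
    holds? x = holdsAt? (splitAt (n ^ k) x)
      where
      holdsAt? : ∀ x v → Dec (HoldsAt x v)
      holdsAt? (inj₁ c)          v = (v ≟ s) ⊎-dec any? (λ i → v ≟ vertexOf (finToFun {n} {k} c i))
      holdsAt? (inj₂ zero)       v = v ≟ s
      holdsAt? (inj₂ (suc zero)) v = v ≟ t

    holds-source : ∀ {v} → Holds source v → v ≡ s
    holds-source {v} = subst (λ z → HoldsAt z v → v ≡ s) (sym (splitAt-↑ʳ (n ^ k) 2 zero)) (λ eq → eq)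

    holds-target : Holds target t
    holds-target = subst (λ z → HoldsAt z t) (sym (splitAt-↑ʳ (n ^ k) 2 (suc zero))) refl

    Agree : Fin (n ^ k + 2) → Fin (n ^ k + 2) → Fin N → Set
    Agree x y v = ∀ w → w ≢ v → (Holds x w → Holds y w) × (Holds y w → Holds x w)

    -- The first alternative is a reversible pebble move at `v` supported by `u`, the second the
    -- final step over an edge `u → t`.
    Link : Fin (n ^ k + 2) → Fin (n ^ k + 2) → Fin N → Fin N → Set
    Link x y u v = (Holds x u × Holds y u × Agree x y v) ⊎ (y ≡ target × v ≡ t × Holds x u)

    link? : ∀ x y u v → Dec (Link x y u v)
    link? x y u v =
      (holds? x u ×-dec holds? y u ×-dec all? (λ w → ¬? (w ≟ v) →-dec
        ((holds? x w →-dec holds? y w) ×-dec (holds? y w →-dec holds? x w))))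
      ⊎-dec ((y ≟ target) ×-dec (v ≟ t) ×-dec holds? x u)

    linkRel : Rel s t s≢t (n ^ k + 2)
    linkRel x y u v = ⌊ link? x y u v ⌋

    pebbleNetwork : Network N
    pebbleNetwork = relNetwork s t s≢t source target linkRel

    module _ (G : Graph N) where

      open Network pebbleNetwork using (Traversable)

      link⇒traversable : ∀ {x y u v} → u ≢ v → Link x y u v → Edge G u v → Traversable G x y
      link⇒traversable u≢v l uv = linked⇒traversable s t s≢t source target linkRel G (_ , _ , u≢v , fromWitness {a? = link? _ _ _ _} l , uv)

      Truthful : Fin (n ^ k + 2) → Set
      Truthful x = ∀ w → Holds x w → Star (Edge G) s w

      extend : ∀ {x y u v} → Holds x u → (∀ w → w ≢ v → Holds y w → Holds x w) → Edge G u v → Truthful x → Truthful y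
      extend {v = v} xu agree uv tx w yw with w ≟ v
      ... | yes refl = tx _ xu ◅◅ (uv ◅ ε)
      ... | no  w≢v  = tx w (agree w w≢v yw)

      -- A move can add only `v`, which is reached over the present edge `u → v`; as `u` is held at
      -- both ends, this works in both directions. Entering `t′` from a truthful state, or being
      -- truthful at `t′`, would connect `s` to `t`.
      truthful-step : ¬ Star (Edge G) s t → ∀ {x y} → Traversable G x y → Truthful x → Truthful y
      truthful-step ¬st {x} {y} tr tx with traversable⇒linked s t s≢t source target linkRel G tr
      ... | inj₁ refl = tx
      ... | inj₂ (inj₁ (u , v , _ , l , uv)) with toWitness {a? = link? x y u v} l
      ...   | inj₁ (xu , yu , agree)  = extend xu (λ w w≢v → proj₂ (agree w w≢v)) uv tx
      ...   | inj₂ (_ , refl , xu)    = contradiction (tx u xu ◅◅ (uv ◅ ε)) ¬st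
      truthful-step ¬st {x} {y} tr tx | inj₂ (inj₂ (u , v , _ , l , uv)) with toWitness {a? = link? y x u v} l
      ...   | inj₁ (yu , xu , agree)  = extend xu (λ w w≢v → proj₁ (agree w w≢v)) uv tx
      ...   | inj₂ (refl , _ , _)     = contradiction (tx t holds-target) ¬st

      truthful : ¬ Star (Edge G) s t → ∀ {x y} → Star (Traversable G) x y → Truthful x → Truthful y
      truthful ¬st ε          tx = tx
      truthful ¬st (tr ◅ trs) tx = truthful ¬st trs (truthful-step ¬st tr tx)

    pebbleNetwork-sound : Sound s t pebbleNetwork
    pebbleNetwork-sound G ¬st acc =
      ¬st (truthful G ¬st acc (λ w sw → subst (Star (Edge G) s) (sym (holds-source sw)) ε) t holds-target)

    code : List (Fin n) → Fin (n ^ k + 2)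
    code []      = source
    code (a ∷ A) = funToFin (entryOr a (a ∷ A) {k}) ↑ˡ 2

    Contains : List (Fin n) → Fin N → Set
    Contains A v = v ≡ s ⊎ ∃[ a ] (a ∈ A × v ≡ vertexOf a)

    holds-code : ∀ A {v} → length A ≤ k → Holds (code A) v ⇔ Contains A v
    holds-code [] {v} _ = mk⇔ (inj₁ ∘ holds-source) contains
      where
      contains : Contains [] v → Holds source v
      contains (inj₁ refl) = subst (λ z → HoldsAt z v) (sym (splitAt-↑ʳ (n ^ k) 2 zero)) refl
    holds-code (a ∷ A) {v} A≤k = mk⇔ (holds⇒ ∘ subst (λ z → HoldsAt z v) split)
      (subst (λ z → HoldsAt z v) (sym split) ∘ ⇒holds)
      where
      f = entryOr a (a ∷ A) {k}
      split : splitAt (n ^ k) (code (a ∷ A)) ≡ inj₁ (funToFin f)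
      split = splitAt-↑ˡ (n ^ k) (funToFin f) 2
      holds⇒ : HoldsAt (inj₁ (funToFin f)) v → Contains (a ∷ A) v
      holds⇒ (inj₁ v≡s)       = inj₁ v≡s
      holds⇒ (inj₂ (i , v≡)) = inj₂ (f i , simplify (entryOr-∈ a (a ∷ A) i) ,
        trans v≡ (cong vertexOf (finToFun-funToFin f i)))
        where
        simplify : ∀ {x} → x ∈ a ∷ a ∷ A → x ∈ a ∷ A
        simplify (here eq)  = here eq
        simplify (there x∈) = x∈
      ⇒holds : Contains (a ∷ A) v → HoldsAt (inj₁ (funToFin f)) v
      ⇒holds (inj₁ v≡s)            = inj₁ v≡s
      ⇒holds (inj₂ (b , b∈ , v≡)) = let (i , eq) = ∈-entryOr a b∈ A≤k in
        inj₂ (i , trans v≡ (cong vertexOf (trans (sym eq) (sym (finToFun-funToFin f i)))))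

    module _ (a₀ : Fin n) {j : ℕ} (1≤j : 1 ≤ j) (j≤2^k : j ≤ 2 ^ k) {G : Graph N} (path : 𝒫 s t j G) where

      open 𝒫 path
      open Network pebbleNetwork using (Traversable)

      -- Positions beyond `j` are clamped to keep the function total.
      at : ℕ → Fin N
      at p = v (fromℕ< {p ⊓ j} (s≤s (m⊓n≤n p j)))

      at-toℕ : ∀ i → at (toℕ i) ≡ v i
      at-toℕ i = cong v (toℕ-injective (trans (toℕ-fromℕ< _) (m≤n⇒m⊓n≡m (s≤s⁻¹ (toℕ<n i)))))

      at-injective : ∀ {p q} → p ≤ j → q ≤ j → at p ≡ at q → p ≡ q
      at-injective {p} {q} p≤j q≤j eq = trans (sym (m≤n⇒m⊓n≡m p≤j))
        (trans (fromℕ<-injective (p ⊓ j) (q ⊓ j) _ _ (distinct eq)) (m≤n⇒m⊓n≡m q≤j))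

      at-0 : at 0 ≡ s
      at-0 = starts

      at-j : at j ≡ t
      at-j = trans (cong at (sym (toℕ-fromℕ j))) (trans (at-toℕ (fromℕ j)) finishes)

      at-edge : ∀ {p} → p < j → Edge G (at p) (at (suc p))
      at-edge {p} p<j = from (edges (at p) (at (suc p))) (i ,
        trans (cong at (sym (trans (toℕ-inject₁ i) i≡p))) (at-toℕ (inject₁ i)) ,
        trans (cong (at ∘ suc) (sym i≡p)) (at-toℕ (suc i)))
        where
        i = fromℕ< p<j
        i≡p : toℕ i ≡ p
        i≡p = toℕ-fromℕ< p<j

      at-≢ : ∀ {p} → p < j → at p ≢ at (suc p)
      at-≢ p<j eq = contradiction (at-injective (<⇒≤ p<j) p<j eq) (<⇒≢ (n<1+n _))

      index : ℕ → Fin n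
      index p with at p ∈? others s t
      ... | yes p∈ = proj₁ (element-surjective (others s t) p∈)
      ... | no  _  = a₀

      vertexOf-index : ∀ {p} → Inner j k p → vertexOf (index p) ≡ at p
      vertexOf-index {p} (0<p , p<j) with at p ∈? others s t
      ... | yes p∈ = proj₂ (element-surjective (others s t) p∈)
      ... | no  p∉ = contradiction (≢⇒others s t
        (λ eq → <⇒≢ 0<p (sym (at-injective (<⇒≤ p<j) z≤n (trans eq (sym at-0)))))
        (λ eq → <⇒≢ p<j (at-injective (<⇒≤ p<j) ≤-refl (trans eq (sym at-j))))) p∉

      state : List ℕ → Fin (n ^ k + 2)
      state A = code (map index A)

      Valid : List ℕ → Set
      Valid A = length A ≤ k × All (Inner j k) A

      holds-state : ∀ {A w} → Valid A → Holds (state A) w ⇔ (w ≡ s ⊎ ∃[ p ] (p ∈ A × w ≡ at p))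
      holds-state {A} {w} (A≤k , A-inner) = mk⇔ (unmap ∘ to code⇔) (from code⇔ ∘ remap)
        where
        code⇔ = holds-code (map index A) {w} (subst (_≤ k) (sym (length-map index A)) A≤k)
        unmap : Contains (map index A) w → w ≡ s ⊎ ∃[ p ] (p ∈ A × w ≡ at p)
        unmap (inj₁ w≡s) = inj₁ w≡s
        unmap (inj₂ (a , a∈ , w≡)) with ∈-map⁻ index a∈
        ... | p , p∈ , refl = inj₂ (p , p∈ , trans w≡ (vertexOf-index (All.lookup A-inner p∈)))
        remap : w ≡ s ⊎ ∃[ p ] (p ∈ A × w ≡ at p) → Contains (map index A) w
        remap (inj₁ w≡s) = inj₁ w≡s
        remap (inj₂ (p , p∈ , w≡)) = inj₂ (index p , ∈-map⁺ index p∈ , trans w≡ (sym (vertexOf-index (All.lookup A-inner p∈))))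

      holds-prev : ∀ {A q} → Valid A → q ∈ 0 ∷ A → Holds (state A) (at q)
      holds-prev A-valid (here refl) = from (holds-state A-valid) (inj₁ at-0)
      holds-prev A-valid (there q∈)  = from (holds-state A-valid) (inj₂ (_ , q∈ , refl))

      move⇒traversable : ∀ {A B} → Move j k A B → Traversable G (state A) (state B)
      move⇒traversable {A} {B} m = link⇒traversable G (at-≢ q<j)
        (inj₁ (holds-prev A-valid A-prev , holds-prev B-valid B-prev ,
          λ w w≢ → transfer A-valid B-valid (λ r≢ → to (elsewhere r≢)) w≢ , transfer B-valid A-valid (λ r≢ → from (elsewhere r≢)) w≢))
        (at-edge q<j)
        where
        open Move m
        q<j = <⇒≤ inner
        transfer : ∀ {A B w} → Valid A → Valid B → (∀ {r} → r ≢ suc pos → r ∈ A → r ∈ B) → w ≢ at (suc pos) →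
                   Holds (state A) w → Holds (state B) w
        transfer A-valid B-valid A⊆B w≢ Aw with to (holds-state A-valid) Aw
        ... | inj₁ w≡s           = from (holds-state B-valid) (inj₁ w≡s)
        ... | inj₂ (p , p∈ , w≡) = from (holds-state B-valid)
          (inj₂ (p , A⊆B (λ p≡ → w≢ (trans w≡ (cong at p≡))) p∈ , w≡))

      -- A pebble has to get only to position `j - 1`, which is less than `2 ^ k`; the last edge
      -- leads straight to `t′`. Hence lengths up to `2 ^ k` are covered.
      pebbleNetwork-accepts : Accepts pebbleNetwork G
      pebbleNetwork-accepts = gmap state move⇒traversable (play [] [] (≤-reflexive (+-identityʳ k)) (here refl)) ◅◅
        (link⇒traversable G (at-≢ (≤-reflexive 1+d≡j)) (inj₂ (refl , last , holds-prev valid reaches′)) (at-edge (≤-reflexive 1+d≡j)) ◅ ε)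
        where
        d = j ∸ 1
        1+d≡j : suc d ≡ j
        1+d≡j = m+[n∸m]≡n 1≤j
        open Advance (advance j k k 0 d (≤-trans (≤-reflexive 1+d≡j) j≤2^k) (≤-reflexive 1+d≡j))
        last : at (suc d) ≡ t
        last = trans (cong at 1+d≡j) at-j
        valid : Valid (low ++ [])
        valid = subst Valid (sym (++-identityʳ low)) (length-≤ , low-inner)
        reaches′ : d ∈ 0 ∷ (low ++ [])
        reaches′ = subst (λ A → d ∈ 0 ∷ A) (sym (++-identityʳ low)) reaches

    pebbleNetwork-solves : Fin n → ∀ l → l ≤ 2 ^ k → Solves s t (𝒫≤ s t l) pebbleNetwork
    pebbleNetwork-solves a₀ l l≤2^k = pebbleNetwork-sound ,
      λ (j , 1≤j , j≤l , path) → pebbleNetwork-accepts a₀ 1≤j (≤-trans j≤l l≤2^k) path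

-- Logarithms, roots and powers of natural numbers

module Arithmetic where

  open import Data.Nat
  open import Data.Nat.Induction using (<-rec)
  open import Data.Nat.Logarithm
  open import Data.Nat.Properties
  open import Data.Nat.Tactic.RingSolver using (solve-∀)
  open import Data.Product using (_×_; _,_; ∃-syntax)
  open import Relation.Binary.PropositionalEquality
  open import Relation.Nullary using (yes; no; contradiction)
  open Functionals using (*-^)

  n≤2^⌈log₂n⌉ : ∀ n → n ≤ 2 ^ ⌈log₂ n ⌉
  n≤2^⌈log₂n⌉ = <-rec (λ n → n ≤ 2 ^ ⌈log₂ n ⌉) go
    where
    n≤2*⌈n/2⌉ : ∀ n → n ≤ 2 * ⌈ n /2⌉
    n≤2*⌈n/2⌉ n = subst₂ _≤_ (⌊n/2⌋+⌈n/2⌉≡n n) (cong (⌈ n /2⌉ +_) (sym (+-identityʳ ⌈ n /2⌉)))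
      (+-monoˡ-≤ ⌈ n /2⌉ (⌊n/2⌋≤⌈n/2⌉ n))
    go : ∀ n → (∀ {m} → m < n → m ≤ 2 ^ ⌈log₂ m ⌉) → n ≤ 2 ^ ⌈log₂ n ⌉
    go zero          rec = z≤n
    go (suc zero)    rec = s≤s z≤n
    go n@(suc (suc n′)) rec = begin
      n                          ≤⟨ n≤2*⌈n/2⌉ n ⟩
      2 * ⌈ n /2⌉                ≤⟨ *-monoʳ-≤ 2 (rec (⌈n/2⌉<n n′)) ⟩
      2 ^ suc ⌈log₂ ⌈ n /2⌉ ⌉    ≡⟨ cong (λ k → 2 ^ suc k) (⌈log₂⌈n/2⌉⌉≡⌈log₂n⌉∸1 n) ⟩
      2 ^ suc (⌈log₂ n ⌉ ∸ 1)    ≡⟨ cong (2 ^_) (m+[n∸m]≡n 1≤log) ⟩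
      2 ^ ⌈log₂ n ⌉              ∎
      where
      open ≤-Reasoning
      1≤log : 1 ≤ ⌈log₂ n ⌉
      1≤log = subst (_≤ ⌈log₂ n ⌉) (⌈log₂2^n⌉≡n 1) (⌈log₂⌉-mono-≤ (s≤s (s≤s (z≤n {n′}))))

  ⌈log₂⌉-suc : ∀ {n} → 1 < n → ∃[ k ] (⌈log₂ n ⌉ ≡ suc k × 2 ^ k < n)
  ⌈log₂⌉-suc {n} 1<n with ⌈log₂ n ⌉ in log≡
  ... | zero  = contradiction (subst₂ _≤_ (⌈log₂2^n⌉≡n 1) log≡ (⌈log₂⌉-mono-≤ 1<n)) λ ()
  ... | suc k = k , refl , ≰⇒> (λ n≤2^k → 1+n≰n (subst₂ _≤_ log≡ (⌈log₂2^n⌉≡n k) (⌈log₂⌉-mono-≤ n≤2^k)))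

  fourth-root : ∀ n → ∃[ w ] (w ^ 4 ≤ n × n < suc w ^ 4)
  fourth-root zero = 0 , z≤n , s≤s z≤n
  fourth-root (suc n) with fourth-root n
  ... | w , w⁴≤n , n<[1+w]⁴ with suc n <? suc w ^ 4
  ...   | yes 1+n< = w , m≤n⇒m≤1+n w⁴≤n , 1+n<
  ...   | no  1+n≮ = suc w , ≮⇒≥ 1+n≮ , ≤-<-trans n<[1+w]⁴ (^-monoˡ-< 4 (n<1+n (suc w)))

  ^-cancel-≤ : ∀ k .{{_ : NonZero k}} {i j} → i ^ k ≤ j ^ k → i ≤ j
  ^-cancel-≤ k {i} {j} iᵏ≤jᵏ = ≮⇒≥ (λ j<i → <⇒≱ (^-monoˡ-< k j<i) iᵏ≤jᵏ)

  -- The first two terms of the binomial expansion.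
  [1+Y]^N≥ : ∀ Y N → Y ^ N + N * Y ^ (N ∸ 1) ≤ suc Y ^ N
  [1+Y]^N≥ Y zero          = ≤-refl
  [1+Y]^N≥ Y (suc zero)    = ≤-reflexive (lemma Y)
    where
    lemma : ∀ Y → Y * 1 + 1 ≡ (1 + Y) * 1
    lemma = solve-∀
  [1+Y]^N≥ Y (suc (suc N)) = begin
    Y * (Y * Y ^ N) + (2 + N) * (Y * Y ^ N)               ≤⟨ m≤m+n _ ((1 + N) * Y ^ N) ⟩
    Y * (Y * Y ^ N) + (2 + N) * (Y * Y ^ N) + (1 + N) * Y ^ N ≡⟨ e Y N (Y ^ N) ⟩
    suc Y * (Y * Y ^ N + (1 + N) * Y ^ N)                 ≤⟨ *-monoʳ-≤ (suc Y) ([1+Y]^N≥ Y (suc N)) ⟩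
    suc Y ^ suc (suc N)                                   ∎
    where
    open ≤-Reasoning
    e : ∀ Y N p → Y * (Y * p) + (2 + N) * (Y * p) + (1 + N) * p ≡ (1 + Y) * (Y * p + (1 + N) * p)
    e = solve-∀

  -- Otherwise X ^ N ≥ (Y + 1) ^ N ≥ 3 Y ^ N for N = 2 Y.
  archimedean : ∀ {X Y} .{{_ : NonZero Y}} → (∀ N → X ^ N ≤ 2 * Y ^ N) → X ≤ Y
  archimedean {X} {Y@(suc _)} bounded = ≮⇒≥ (λ Y<X → <⇒≱ (begin-strict
    2 * Y ^ N                 <⟨ *-monoˡ-< (Y ^ N) {{m^n≢0 Y N}} (n<1+n 2) ⟩
    3 * Y ^ N                 ≡⟨ e Y (Y ^ (N ∸ 1)) ⟩
    Y ^ N + N * Y ^ (N ∸ 1)   ≤⟨ [1+Y]^N≥ Y N ⟩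
    suc Y ^ N                 ≤⟨ ^-monoˡ-≤ N Y<X ⟩
    X ^ N                     ∎) (bounded N))
    where
    open ≤-Reasoning
    N = 2 * Y
    e : ∀ Y p → 3 * (Y * p) ≡ Y * p + 2 * Y * p
    e = solve-∀

  module _ (n z d P : ℕ) .{{_ : NonZero n}} where

    -- The bound for l = w + 1 with w = ⌊ n ^ (1/4) ⌋; r = ⌈ lg l ⌉ ≥ (lg n) / 4.
    fourth-root-bound : ∀ w r → w ^ 4 ≤ n → n ≤ 2 ^ (4 * r) →
      n ^ r ≤ 4 * (z * z) * (64 * w ^ 2) ^ r → 2 ^ (16 * P + 12 * d) ≤ n ^ d →
      n ^ (4 * P) ≤ ((2 * z) ^ 4) ^ d
    fourth-root-bound w r w⁴≤n n≤ bound log-bound = begin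
      n ^ (4 * P)                 ≤⟨ ^-monoˡ-≤ (4 * P) n≤ ⟩
      (2 ^ (4 * r)) ^ (4 * P)     ≡⟨ trans (^-*-assoc 2 (4 * r) (4 * P)) (cong (2 ^_) (e₁ r P)) ⟩
      2 ^ (16 * P * r)            ≤⟨ *-cancelʳ-≤ (2 ^ (16 * P * r)) _ (2 ^ (12 * r * d)) {{m^n≢0 2 (12 * r * d)}} main ⟩
      ((2 * z) ^ 4) ^ d           ∎
      where
      open ≤-Reasoning
      Z = (2 * z) ^ 4
      e₁ : ∀ r P → 4 * r * (4 * P) ≡ 16 * P * r
      e₁ = solve-∀
      -- Squaring the bound turns `w ^ 2` into `w ^ 4 ≤ n`, so one factor `n ^ r` cancels; the 12
      -- comes from `64² = 2 ^ 12`.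
      n^r≤ : n ^ r ≤ Z * 2 ^ (12 * r)
      n^r≤ = *-cancelʳ-≤ (n ^ r) _ (n ^ r) {{m^n≢0 n r}} (begin
        n ^ r * n ^ r                                   ≤⟨ *-mono-≤ bound bound ⟩
        B * (64 * w ^ 2) ^ r * (B * (64 * w ^ 2) ^ r)   ≡⟨ e₂ z ((64 * w ^ 2) ^ r) ⟩
        Z * ((64 * w ^ 2) ^ r * (64 * w ^ 2) ^ r)       ≡⟨ cong (Z *_) (trans (sym (*-^ r (64 * w ^ 2) (64 * w ^ 2)))
                                                            (trans (cong (_^ r) (e₃ w)) (*-^ r 4096 (w ^ 4)))) ⟩
        Z * (4096 ^ r * (w ^ 4) ^ r)                    ≤⟨ *-monoʳ-≤ Z (*-monoʳ-≤ (4096 ^ r) (^-monoˡ-≤ r w⁴≤n)) ⟩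
        Z * (4096 ^ r * n ^ r)                          ≡⟨ *-assoc Z (4096 ^ r) (n ^ r) ⟨
        Z * 4096 ^ r * n ^ r                            ≡⟨ cong (λ q → Z * q * n ^ r) (^-*-assoc 2 12 r) ⟩
        Z * 2 ^ (12 * r) * n ^ r                        ∎)
        where
        B = 4 * (z * z)
        e₂ : ∀ z x → 4 * (z * z) * x * (4 * (z * z) * x) ≡ (2 * z) * ((2 * z) * ((2 * z) * ((2 * z) * 1))) * (x * x)
        e₂ = solve-∀
        e₃ : ∀ w → 64 * (w * (w * 1)) * (64 * (w * (w * 1))) ≡ 4096 * (w * (w * (w * (w * 1))))
        e₃ = solve-∀
      main : 2 ^ (16 * P * r) * 2 ^ (12 * r * d) ≤ Z ^ d * 2 ^ (12 * r * d)
      main = begin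
        2 ^ (16 * P * r) * 2 ^ (12 * r * d)   ≡⟨ trans (sym (^-distribˡ-+-* 2 (16 * P * r) (12 * r * d)))
                                                   (trans (cong (2 ^_) (e₄ P r d)) (sym (^-*-assoc 2 (16 * P + 12 * d) r))) ⟩
        (2 ^ (16 * P + 12 * d)) ^ r           ≤⟨ ^-monoˡ-≤ r log-bound ⟩
        (n ^ d) ^ r                           ≡⟨ trans (^-*-assoc n d r) (trans (cong (n ^_) (*-comm d r)) (sym (^-*-assoc n r d))) ⟩
        (n ^ r) ^ d                           ≤⟨ ^-monoˡ-≤ d n^r≤ ⟩
        (Z * 2 ^ (12 * r)) ^ d                ≡⟨ trans (*-^ d Z (2 ^ (12 * r))) (cong (Z ^ d *_) (^-*-assoc 2 (12 * r) d)) ⟩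
        Z ^ d * 2 ^ (12 * r * d)              ∎
        where
        e₄ : ∀ P r d → 16 * P * r + 12 * r * d ≡ (16 * P + 12 * d) * r
        e₄ = solve-∀

-- From bounds on natural numbers to bounds on reals

module Reals where

  open import Algebra.Bundles using (CommutativeRing)
  open import Data.Integer as ℤ using (ℤ; +_; -[1+_])
  import Data.Integer.Properties as ℤ
  import Data.Integer.Tactic.RingSolver as ℤ-Solver
  open import Data.Nat as ℕ using (ℕ; zero; suc; NonZero; z≤n; s≤s)
  import Data.Nat.Properties as ℕ
  import Data.Nat.Tactic.RingSolver as ℕ-Solver
  open import Data.Product using (_×_; _,_; ∃-syntax)
  open import Data.Rational.Unnormalised hiding (NonZero)
  open import Data.Rational.Unnormalised.Properties
  open import Defs hiding (bounded)
  open import Relation.Binary.PropositionalEquality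
  open import Algebra.Properties.Semiring.Exp (CommutativeRing.semiring +-*-commutativeRing) using () renaming (_^_ to infixr 8 _^_)
  open Functionals using (*-^)
  open Arithmetic

  ↥-* : ∀ p q → ↥ (p * q) ≡ ↥ p ℤ.* ↥ q
  ↥-* p@record{} q@record{} = refl

  ↧ₙ-* : ∀ p q → ↧ₙ (p * q) ≡ ↧ₙ p ℕ.* ↧ₙ q
  ↧ₙ-* p@record{} q@record{} = refl

  ↥-^ : ∀ a {x} k → ↥ a ≡ + x → ↥ (a ^ k) ≡ + (x ℕ.^ k)
  ↥-^ a     zero    eq = refl
  ↥-^ a {x} (suc k) eq = trans (↥-* a (a ^ k)) (trans (cong₂ ℤ._*_ eq (↥-^ a k eq)) (sym (ℤ.pos-* x (x ℕ.^ k))))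

  ↧ₙ-^ : ∀ a k → ↧ₙ (a ^ k) ≡ ↧ₙ a ℕ.^ k
  ↧ₙ-^ a zero    = refl
  ↧ₙ-^ a (suc k) = trans (↧ₙ-* a (a ^ k)) (cong (↧ₙ a ℕ.*_) (↧ₙ-^ a k))

  ↧≡+↧ₙ : ∀ p → ↧ p ≡ + (↧ₙ p)
  ↧≡+↧ₙ record{} = refl

  cross : ∀ a b {x} j k → ↥ a ≡ + x → ↥ (a ^ j) ℤ.* ↧ (b ^ k) ≡ + (x ℕ.^ j ℕ.* (↧ₙ b) ℕ.^ k)
  cross a b {x} j k a≡ = trans (cong₂ ℤ._*_ (↥-^ a j a≡) (trans (↧≡+↧ₙ (b ^ k)) (cong +_ (↧ₙ-^ b k))))
    (sym (ℤ.pos-* (x ℕ.^ j) ((↧ₙ b) ℕ.^ k)))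

  ^-≤⇒ : ∀ {a b x y} j k → ↥ a ≡ + x → ↥ b ≡ + y → a ^ j ≤ b ^ k →
         x ℕ.^ j ℕ.* (↧ₙ b) ℕ.^ k ℕ.≤ y ℕ.^ k ℕ.* (↧ₙ a) ℕ.^ j
  ^-≤⇒ {a} {b} {x} {y} j k a≡ b≡ aʲ≤bᵏ = ℤ.drop‿+≤+ (subst₂ ℤ._≤_ (cross a b j k a≡) (cross b a k j b≡) (drop-*≤* aʲ≤bᵏ))

  ⇒^-≤ : ∀ {a b x y} j k → ↥ a ≡ + x → ↥ b ≡ + y →
         x ℕ.^ j ℕ.* (↧ₙ b) ℕ.^ k ℕ.≤ y ℕ.^ k ℕ.* (↧ₙ a) ℕ.^ j → a ^ j ≤ b ^ k
  ⇒^-≤ {a} {b} {x} {y} j k a≡ b≡ le = *≤* (subst₂ ℤ._≤_ (sym (cross a b j k a≡)) (sym (cross b a k j b≡)) (ℤ.+≤+ le))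

  ℕ⇒ℚ-mono : ∀ {i j} → i ℕ.≤ j → ℕ⇒ℚ i ≤ ℕ⇒ℚ j
  ℕ⇒ℚ-mono {i} {j} i≤j = *≤* (ℤ.*-monoʳ-≤-nonNeg (+ 1) (ℤ.+≤+ i≤j))

  ℕ⇒ℚ-^-cancel : ∀ {n m} {j k} → ℕ⇒ℚ n ^ j ≤ ℕ⇒ℚ m ^ k → n ℕ.^ j ℕ.≤ m ℕ.^ k
  ℕ⇒ℚ-^-cancel {n} {m} {j} {k} le = subst₂ ℕ._≤_
    (trans (cong (n ℕ.^ j ℕ.*_) (ℕ.^-zeroˡ k)) (ℕ.*-identityʳ _))
    (trans (cong (m ℕ.^ k ℕ.*_) (ℕ.^-zeroˡ j)) (ℕ.*-identityʳ _))
    (^-≤⇒ {ℕ⇒ℚ n} {ℕ⇒ℚ m} j k refl refl le)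

  ℕ⇒ℚ-^-mono : ∀ {n m} {j k} → n ℕ.^ j ℕ.≤ m ℕ.^ k → ℕ⇒ℚ n ^ j ≤ ℕ⇒ℚ m ^ k
  ℕ⇒ℚ-^-mono {n} {m} {j} {k} le = ⇒^-≤ {ℕ⇒ℚ n} {ℕ⇒ℚ m} j k refl refl (subst₂ ℕ._≤_
    (sym (trans (cong (n ℕ.^ j ℕ.*_) (ℕ.^-zeroˡ k)) (ℕ.*-identityʳ _)))
    (sym (trans (cong (m ℕ.^ k ℕ.*_) (ℕ.^-zeroˡ j)) (ℕ.*-identityʳ _))) le)

  p<q+r⇒p-r<q : ∀ {p} q r → p < q + r → p - r < q
  p<q+r⇒p-r<q {p} q r p<q+r = <-respʳ-≃
    (≃-trans (+-assoc q r (- r)) (≃-trans (+-congʳ q (+-inverseʳ r)) (+-identityʳ q)))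
    (+-monoˡ-< (- r) p<q+r)

  p-r<q⇒p<q+r : ∀ {p} q r → p - r < q → p < q + r
  p-r<q⇒p<q+r {p} q r p-r<q = <-respˡ-≃
    (≃-trans (+-assoc p (- r) r) (≃-trans (+-congʳ p (+-inverseˡ r)) (+-identityʳ p)))
    (+-monoˡ-< r p-r<q)

  +-cancelʳ-< : ∀ {p q} r → p + r < q + r → p < q
  +-cancelʳ-< {p} {q} r p+r<q+r = <-respˡ-≃
    (≃-trans (+-assoc p r (- r)) (≃-trans (+-congʳ p (+-inverseʳ r)) (+-identityʳ p)))
    (p<q+r⇒p-r<q q r p+r<q+r)

  -- The slack is used twice, to go below `x` and then below `y`, as membership in the lower cut of
  -- a sum demands.
  split-< : ∀ {q} x y → q < x + y → ∃[ a ] ∃[ b ] (a < x × b < y × q < a + b)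
  split-< {q} x y q<x+y with <-dense (p<q+r⇒p-r<q x y q<x+y)
  ... | a , q-y<a , a<x with <-dense (p<q+r⇒p-r<q {q} y a (<-respʳ-≃ (+-comm a y) (p-r<q⇒p<q+r a y q-y<a)))
  ...   | b , q-a<b , b<y = a , b , a<x , b<y , <-respʳ-≃ (+-comm b a) (p-r<q⇒p<q+r b a q-a<b)

  -- Membership in the set whose supremum defines lg n.
  infix 4 _≤lg_
  _≤lg_ : ℚᵘ → ℕ → Set
  r ≤lg n = ℕ⇒ℚ 2 ^ᶻ ↥ r ≤ ℕ⇒ℚ n ^ ↧ₙ r

  -- Both sides are raised to the denominator of `g`, compared there by clearing fractions, and the
  -- power is cancelled.
  ≤lg-below : ∀ {n X Y g} .{{_ : NonZero n}} → g ≤lg n → + X / suc Y < g → 2 ℕ.^ X ℕ.≤ n ℕ.^ suc Y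
  ≤lg-below {n} {X} {Y} {mkℚᵘ -[1+ G ] H} _ (*<* XH<) with subst (ℤ._< -[1+ G ] ℤ.* + suc Y) (sym (ℤ.pos-* X (suc H))) XH<
  ... | ()
  ≤lg-below {n} {X} {Y} {mkℚᵘ (+ G) H} 2ᴳ≤nᴴ (*<* XH<GY) = ^-cancel-≤ (suc H) (begin
    (2 ℕ.^ X) ℕ.^ suc H        ≡⟨ ℕ.^-*-assoc 2 X (suc H) ⟩
    2 ℕ.^ (X ℕ.* suc H)        ≤⟨ ℕ.^-monoʳ-≤ 2 (ℕ.<⇒≤ (ℤ.drop‿+<+ (subst₂ ℤ._<_ (sym (ℤ.pos-* X (suc H))) (sym (ℤ.pos-* G (suc Y))) XH<GY))) ⟩
    2 ℕ.^ (G ℕ.* suc Y)        ≡⟨ ℕ.^-*-assoc 2 G (suc Y) ⟨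
    (2 ℕ.^ G) ℕ.^ suc Y        ≤⟨ ℕ.^-monoˡ-≤ (suc Y) (ℕ⇒ℚ-^-cancel {2} {n} {G} {suc H} 2ᴳ≤nᴴ) ⟩
    (n ℕ.^ suc H) ℕ.^ suc Y    ≡⟨ trans (ℕ.^-*-assoc n (suc H) (suc Y)) (trans (cong (n ℕ.^_) (ℕ.*-comm (suc H) (suc Y))) (sym (ℕ.^-*-assoc n (suc Y) (suc H)))) ⟩
    (n ℕ.^ suc Y) ℕ.^ suc H    ∎)
    where open ℕ.≤-Reasoning

  -- Approximating ρ = P / d from below by ((16 P + 12 d) N - 1) / (16 d N) - 3/4.
  lg-bound : ∀ n .{{_ : NonZero n}} P d-1 → fromℚ (mkℚᵘ (+ P) d-1) ≤ʳ ((+ 1 / 16) *ʳ lg n +ʳ fromℚ (-[1+ 2 ] / 4)) →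
             2 ℕ.^ (16 ℕ.* P ℕ.+ 12 ℕ.* suc d-1) ℕ.≤ n ℕ.^ suc d-1
  lg-bound n P d-1 ρ≤ = archimedean {Y = n ℕ.^ d} {{ℕ.m^n≢0 n d}} bounded
    where
    d = suc d-1
    X = 16 ℕ.* P ℕ.+ 12 ℕ.* d
    y : ℕ → ℚᵘ
    y N = + (X ℕ.* suc N ℕ.∸ 1) / (d ℕ.* suc N)
    1≤XN : ∀ N → 1 ℕ.≤ X ℕ.* suc N
    1≤XN N = ℕ.*-mono-≤ {1} {X} {1} {suc N} (ℕ.≤-trans (s≤s z≤n) (ℕ.m≤n+m (12 ℕ.* d) (16 ℕ.* P))) (s≤s z≤n)
    y<X/d : ∀ N → y N < + X / d
    y<X/d N = *<* (subst₂ ℤ._<_ (ℤ.pos-* (X ℕ.* suc N ℕ.∸ 1) d) (ℤ.pos-* X (d ℕ.* suc N)) (ℤ.+<+ (begin-strict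
      (X ℕ.* suc N ℕ.∸ 1) ℕ.* d   <⟨ ℕ.*-monoˡ-< d (ℕ.≤-reflexive (ℕ.m+[n∸m]≡n (1≤XN N))) ⟩
      X ℕ.* suc N ℕ.* d           ≡⟨ e X (suc N) d ⟩
      X ℕ.* (d ℕ.* suc N)         ∎)))
      where
      open ℕ.≤-Reasoning
      e : ∀ X N d → X ℕ.* N ℕ.* d ≡ X ℕ.* (d ℕ.* N)
      e = ℕ-Solver.solve-∀
    1/16 -¾ : ℚᵘ
    1/16 = + 1 / 16
    -¾ = -[1+ 2 ] / 4
    q<ρ : ∀ N → 1/16 * y N + -¾ < mkℚᵘ (+ P) d-1
    q<ρ N = <-respʳ-≃ (*≡* e) (+-monoˡ-< -¾ (*-monoʳ-<-pos 1/16 (y<X/d N)))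
      where
      e′ : ∀ P d → ((+ 1 ℤ.* (+ 16 ℤ.* P ℤ.+ + 12 ℤ.* d)) ℤ.* + 4 ℤ.+ -[1+ 2 ] ℤ.* (+ 16 ℤ.* d)) ℤ.* d ≡ P ℤ.* (+ 16 ℤ.* d ℤ.* + 4)
      e′ = ℤ-Solver.solve-∀
      X≡ : + X ≡ + 16 ℤ.* + P ℤ.+ + 12 ℤ.* + d
      X≡ = trans (ℤ.pos-+ (16 ℕ.* P) (12 ℕ.* d)) (cong₂ ℤ._+_ (ℤ.pos-* 16 P) (ℤ.pos-* 12 d))
      e : (+ 1 ℤ.* + X ℤ.* + 4 ℤ.+ -[1+ 2 ] ℤ.* + (16 ℕ.* d)) ℤ.* + d ≡ + P ℤ.* + (16 ℕ.* d ℕ.* 4)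
      e = trans (cong₂ (λ x z → (+ 1 ℤ.* x ℤ.* + 4 ℤ.+ -[1+ 2 ] ℤ.* z) ℤ.* + d) X≡ (ℤ.pos-* 16 d))
        (trans (e′ (+ P) (+ d)) (cong (ℤ._*_ (+ P)) (sym (trans (ℤ.pos-* (16 ℕ.* d) 4) (cong (ℤ._* + 4) (ℤ.pos-* 16 d))))))
    approx : ∀ N → 2 ℕ.^ (X ℕ.* suc N ℕ.∸ 1) ℕ.≤ n ℕ.^ (d ℕ.* suc N)
    approx N = conclude (ρ≤ {1/16 * y N + -¾} (q<ρ N))
      where
      conclude : Below ((+ 1 / 16) *ʳ lg n +ʳ fromℚ (-[1+ 2 ] / 4)) (1/16 * y N + -¾) → 2 ℕ.^ (X ℕ.* suc N ℕ.∸ 1) ℕ.≤ n ℕ.^ (d ℕ.* suc N)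
      conclude (_ , (a , b , (_ , (f , (g , g≤lg , f<g) , refl) , a<f/16) , b<-¾ , refl) , q<a+b) =
        ≤lg-below {n} {X ℕ.* suc N ℕ.∸ 1} {N ℕ.+ d-1 ℕ.* suc N} {g} g≤lg (<-trans (*-cancelˡ-<-nonNeg {y N} {f} 1/16
          (+-cancelʳ-< -¾ (<-trans q<a+b (+-mono-< a<f/16 b<-¾)))) f<g)
    -- Stopping one short of the exponent loses a single factor 2, whatever `N` is; `archimedean`
    -- removes it.
    bounded : ∀ N → (2 ℕ.^ X) ℕ.^ N ℕ.≤ 2 ℕ.* (n ℕ.^ d) ℕ.^ N
    bounded zero    = s≤s z≤n
    bounded (suc N) = begin
      (2 ℕ.^ X) ℕ.^ suc N               ≡⟨ ℕ.^-*-assoc 2 X (suc N) ⟩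
      2 ℕ.^ (X ℕ.* suc N)               ≡⟨ cong (2 ℕ.^_) (ℕ.m+[n∸m]≡n (1≤XN N)) ⟨
      2 ℕ.* 2 ℕ.^ (X ℕ.* suc N ℕ.∸ 1)   ≤⟨ ℕ.*-monoʳ-≤ 2 (approx N) ⟩
      2 ℕ.* n ℕ.^ (d ℕ.* suc N)         ≡⟨ cong (2 ℕ.*_) (ℕ.^-*-assoc n d (suc N)) ⟨
      2 ℕ.* (n ℕ.^ d) ℕ.^ suc N         ∎
      where open ℕ.≤-Reasoning

  half-bound : ∀ {q a} m → a ≤ ℕ⇒ℚ (2 ℕ.* m) → q < ½ * a → q < ℕ⇒ℚ m
  half-bound {q} {a} m a≤2m q<½a = <-≤-trans q<½a (≤-trans (*-monoʳ-≤-nonNeg ½ a≤2m) (≤-reflexive (*≡* (lemma m))))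
    where
    lemma : ∀ m → + 1 ℤ.* + (2 ℕ.* m) ℤ.* + 1 ≡ + m ℤ.* + 2
    lemma m = trans (cong (λ z → + 1 ℤ.* z ℤ.* + 1) (ℤ.pos-* 2 m)) (e (+ m))
      where
      e : ∀ m → + 1 ℤ.* (+ 2 ℤ.* m) ℤ.* + 1 ≡ m ℤ.* + 2
      e = ℤ-Solver.solve-∀

  ≤ℕ⇒ℚ : ∀ {x y-1 m} → x ℕ.≤ m ℕ.* suc y-1 → mkℚᵘ (+ x) y-1 ≤ ℕ⇒ℚ m
  ≤ℕ⇒ℚ {x} {y-1} {m} x≤my = *≤* (subst₂ ℤ._≤_ (sym (ℤ.*-identityʳ (+ x))) (ℤ.pos-* m (suc y-1)) (ℤ.+≤+ x≤my))

  -- Squaring removes the half in the exponent: `4 (m * m) = (2 m)²`, so every admissible `a` is at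
  -- most `2 m`, and the prefactor `½` absorbs the 2.
  power-lower : ∀ n D r m .{{_ : NonZero n}} .{{_ : NonZero D}} →
    let instance pos = /-pos n D in
    n ℕ.^ r ℕ.≤ 4 ℕ.* (m ℕ.* m) ℕ.* D ℕ.^ r → ½ *ʳ ((+ n / D) ^ᑫ (+ r / 2)) ≤ʳ fromℕ m
  power-lower n@(suc _) D@(suc _) r m bound (_ , (a , (a′ , (0≤a′ , a′²≤) , a<a′) , refl) , q<½a) =
    half-bound m (≤-trans (<⇒≤ a<a′) (a′≤2m a′ a′²≤)) q<½a
    where
    a′≤2m : ∀ a → a ^ 2 ≤ (+ n / D) ^ r → a ≤ ℕ⇒ℚ (2 ℕ.* m)
    a′≤2m (mkℚᵘ -[1+ _ ] _) _ = *≤* (subst (ℤ._≤_ _) (ℤ.pos-* (2 ℕ.* m) _) ℤ.-≤+)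
    a′≤2m a@(mkℚᵘ (+ x) y-1) a²≤ = ≤ℕ⇒ℚ {m = 2 ℕ.* m} (^-cancel-≤ 2 (ℕ.*-cancelʳ-≤ (x ℕ.^ 2) _ (D ℕ.^ r) {{ℕ.m^n≢0 D r}} (begin
      x ℕ.^ 2 ℕ.* D ℕ.^ r                                 ≤⟨ ^-≤⇒ {a} {+ n / D} 2 r refl refl a²≤ ⟩
      n ℕ.^ r ℕ.* y ℕ.^ 2                                 ≤⟨ ℕ.*-monoˡ-≤ (y ℕ.^ 2) bound ⟩
      4 ℕ.* (m ℕ.* m) ℕ.* D ℕ.^ r ℕ.* y ℕ.^ 2             ≡⟨ e m (D ℕ.^ r) y ⟩
      (2 ℕ.* m ℕ.* y) ℕ.^ 2 ℕ.* D ℕ.^ r                   ∎)))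
      where
      open ℕ.≤-Reasoning
      y = suc y-1
      e : ∀ m D y → 4 ℕ.* (m ℕ.* m) ℕ.* D ℕ.* (y ℕ.* (y ℕ.* 1)) ≡ (2 ℕ.* m ℕ.* y) ℕ.* ((2 ℕ.* m ℕ.* y) ℕ.* 1) ℕ.* D
      e = ℕ-Solver.solve-∀

  -- From `n ^ r ≤ (2m)⁴ · 2 ^ (12 r)` and `r ≥ (lg n) / 4` one has, for `lg n ≥ 12`,
  -- `(2m)⁴ ≥ 2 ^ ((lg n - 12) (lg n) / 4)`, that is, `2m ≥ n ^ ((lg n) / 16 - 3/4)`. This is
  -- checked for every rational `ρ` below the exponent.
  lg-power-lower : ∀ n w r m .{{_ : NonZero n}} .{{_ : NonZero m}} → w ℕ.^ 4 ℕ.≤ n → n ℕ.≤ 2 ℕ.^ (4 ℕ.* r) →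
    n ℕ.^ r ℕ.≤ 4 ℕ.* (m ℕ.* m) ℕ.* (64 ℕ.* w ℕ.^ 2) ℕ.^ r →
    ½ *ʳ (n ^ʳ ((+ 1 / 16) *ʳ lg n +ʳ fromℚ (-[1+ 2 ] / 4))) ≤ʳ fromℕ m
  lg-power-lower n@(suc n-1) w r m w⁴≤n n≤2^4r bound
    (_ , (a , (a′ , (ρ , ρ≤ , 0≤a′ , a′ᵈ≤) , a<a′) , refl) , q<½a) =
    half-bound m (≤-trans (<⇒≤ a<a′) (a′≤2m a′ ρ ρ≤ a′ᵈ≤)) q<½a
    where
    instance
      n-pos : Positive (ℕ⇒ℚ n)
      n-pos = /-pos n 1
    a′≤2m : ∀ a ρ → fromℚ ρ ≤ʳ ((+ 1 / 16) *ʳ lg n +ʳ fromℚ (-[1+ 2 ] / 4)) → a ^ ↧ₙ ρ ≤ ℕ⇒ℚ n ^ᶻ ↥ ρ → a ≤ ℕ⇒ℚ (2 ℕ.* m)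
    a′≤2m (mkℚᵘ -[1+ _ ] _) _ _ _ = *≤* (subst (ℤ._≤_ _) (ℤ.pos-* (2 ℕ.* m) _) ℤ.-≤+)
    a′≤2m a@(mkℚᵘ (+ x) y-1) (mkℚᵘ (+ P) d-1) ρ≤ aᵈ≤ = ≤ℕ⇒ℚ {m = 2 ℕ.* m} (^-cancel-≤ (4 ℕ.* d) (begin
      x ℕ.^ (4 ℕ.* d)                                   ≡⟨ trans (cong (x ℕ.^_) (ℕ.*-comm 4 d)) (sym (ℕ.^-*-assoc x d 4)) ⟩
      (x ℕ.^ d) ℕ.^ 4                                   ≤⟨ ℕ.^-monoˡ-≤ 4 xᵈ≤ ⟩
      (n ℕ.^ P ℕ.* y ℕ.^ d) ℕ.^ 4                       ≡⟨ trans (*-^ 4 (n ℕ.^ P) (y ℕ.^ d)) (cong₂ ℕ._*_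
                                                             (trans (ℕ.^-*-assoc n P 4) (cong (n ℕ.^_) (ℕ.*-comm P 4)))
                                                             (trans (ℕ.^-*-assoc y d 4) (cong (y ℕ.^_) (ℕ.*-comm d 4)))) ⟩
      n ℕ.^ (4 ℕ.* P) ℕ.* y ℕ.^ (4 ℕ.* d)               ≤⟨ ℕ.*-monoˡ-≤ (y ℕ.^ (4 ℕ.* d)) (fourth-root-bound n m d P w r w⁴≤n n≤2^4r bound (lg-bound n P d-1 ρ≤)) ⟩
      ((2 ℕ.* m) ℕ.^ 4) ℕ.^ d ℕ.* y ℕ.^ (4 ℕ.* d)       ≡⟨ cong (ℕ._* y ℕ.^ (4 ℕ.* d)) (ℕ.^-*-assoc (2 ℕ.* m) 4 d) ⟩
      (2 ℕ.* m) ℕ.^ (4 ℕ.* d) ℕ.* y ℕ.^ (4 ℕ.* d)       ≡⟨ *-^ (4 ℕ.* d) (2 ℕ.* m) y ⟨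
      (2 ℕ.* m ℕ.* y) ℕ.^ (4 ℕ.* d)                     ∎))
      where
      open ℕ.≤-Reasoning
      y = suc y-1
      d = suc d-1
      xᵈ≤ : x ℕ.^ d ℕ.≤ n ℕ.^ P ℕ.* y ℕ.^ d
      xᵈ≤ = subst (ℕ._≤ n ℕ.^ P ℕ.* y ℕ.^ d) (trans (cong (x ℕ.^ d ℕ.*_) (ℕ.^-zeroˡ P)) (ℕ.*-identityʳ _))
        (^-≤⇒ {a} {ℕ⇒ℚ n} d P refl refl aᵈ≤)
    -- For negative `ρ` the power is at most 1, which is below `2 m`; this takes care of small `n`.
    a′≤2m a@(mkℚᵘ (+ x) y-1) (mkℚᵘ -[1+ P ] d-1) ρ≤ aᵈ≤ = ≤ℕ⇒ℚ {m = 2 ℕ.* m} (ℕ.≤-trans (^-cancel-≤ d (begin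
      x ℕ.^ d                           ≤⟨ ℕ.m≤m*n (x ℕ.^ d) (n ℕ.^ suc P) {{ℕ.m^n≢0 n (suc P)}} ⟩
      x ℕ.^ d ℕ.* n ℕ.^ suc P           ≤⟨ ^-≤⇒ {a} {mkℚᵘ (+ 1) n-1} d (suc P) refl refl aᵈ≤ ⟩
      1 ℕ.^ suc P ℕ.* y ℕ.^ d           ≡⟨ trans (cong (ℕ._* y ℕ.^ d) (ℕ.^-zeroˡ (suc P))) (ℕ.*-identityˡ (y ℕ.^ d)) ⟩
      y ℕ.^ d                           ∎)) (ℕ.m≤n*m y (2 ℕ.* m) {{ℕ.m*n≢0 2 m}}))
      where
      open ℕ.≤-Reasoning
      y = suc y-1
      d = suc d-1

  -- As `2 ^ k ≤ n`, the exponent `suc k` is a rational below `lg n + 1`, so `n ^ suc k` is among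
  -- the values whose supremum is the power.
  lg-power-upper : ∀ n m k .{{_ : NonZero n}} → 2 ℕ.^ k ℕ.≤ n → m ℕ.≤ n ℕ.^ suc k ℕ.+ 2 →
                   fromℕ m ≤ʳ n ^ʳ (lg n +ʳ fromℕ 1) +ʳ fromℕ 2
  lg-power-upper n m k 2^k≤n m≤ {q} q<m =
    let (a , b , a<n^K , b<2 , q<a+b) = split-< (ℕ⇒ℚ (n ℕ.^ suc k)) (ℕ⇒ℚ 2) (<-≤-trans q<m (≤-trans (ℕ⇒ℚ-mono m≤) (≤-reflexive (ℕ⇒ℚ-+ (n ℕ.^ suc k) 2))))
    in a + b , (a , b , (ℕ⇒ℚ (n ℕ.^ suc k) , (ℕ⇒ℚ (suc k) , K≤lg+1 , ℕ⇒ℚ-mono {0} {n ℕ.^ suc k} z≤n ,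
         ℕ⇒ℚ-^-mono {n ℕ.^ suc k} {n} {1} {suc k} (ℕ.≤-reflexive (ℕ.^-identityʳ (n ℕ.^ suc k)))) , a<n^K) , b<2 , refl) , q<a+b
    where
    ℕ⇒ℚ-+ : ∀ i j → ℕ⇒ℚ (i ℕ.+ j) ≃ ℕ⇒ℚ i + ℕ⇒ℚ j
    ℕ⇒ℚ-+ i j = *≡* (cong (ℤ._* + 1) (trans (ℤ.pos-+ i j) (sym (cong₂ ℤ._+_ (ℤ.*-identityʳ (+ i)) (ℤ.*-identityʳ (+ j))))))
    K≤lg+1 : fromℚ (ℕ⇒ℚ (suc k)) ≤ʳ (lg n +ʳ fromℕ 1)
    K≤lg+1 {q} q<K =
      let (a , b , a<k , b<1 , q<a+b) = split-< (ℕ⇒ℚ k) (ℕ⇒ℚ 1) (<-respʳ-≃ (≃-trans (≃-reflexive (cong ℕ⇒ℚ (ℕ.+-comm 1 k))) (ℕ⇒ℚ-+ k 1)) q<K)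
      in a + b , (a , b , (ℕ⇒ℚ k , ℕ⇒ℚ-^-mono {2} {n} {k} {1} (ℕ.≤-trans 2^k≤n (ℕ.≤-reflexive (sym (ℕ.^-identityʳ n)))) , a<k) , b<1 , refl) , q<a+b

-- The bounds for one path length and for all path lengths

open import Data.Fin using (fromℕ<; Fin)
open import Data.Fin.Subset using (∣_∣; ∁; ⁅_⁆; _∪_)
open import Data.Integer using (+_; -[1+_])
import Data.Nat as ℕ
open import Data.Nat using (ℕ; NonZero; NonTrivial; _+_; _*_; _∸_; _^_; _≤_)
open import Data.Nat.Logarithm using (⌈log₂_⌉)
open import Data.Nat.Properties
open import Data.Product using (_,_; proj₁; proj₂; _×_; ∃-syntax)
open import Data.Rational.Unnormalised using (_/_; ½)
open import Defs
open import Function using (it)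
open import Relation.Binary.PropositionalEquality using (refl; sym; subst; cong; _≡_; _≢_)
open import Relation.Nullary using (contradiction)
open LowerBound
open MinimumSize
open UpperBound
open Arithmetic
open Reals

module _ {N : ℕ} (s t : Fin N) (s≢t : s ≢ t) .{{_ : NonZero ∣ others s t ∣}} where

  private
    n = ∣ others s t ∣
    a₀ = fromℕ< (ℕ.>-nonZero⁻¹ n)

  minimum-𝒫≤ : ∀ l → ∃[ m ] IsMinimumSize s t (𝒫≤ s t l) m
  minimum-𝒫≤ l = minimum-exists s t s≢t (𝒫≤ s t l) (𝒫≤? s t s≢t l) (𝒫≤-≐ s t s≢t {l})
    (pebbleNetwork s t s≢t ⌈log₂ l ⌉) (pebbleNetwork-solves s t s≢t ⌈log₂ l ⌉ a₀ l (n≤2^⌈log₂n⌉ l))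

  minimum-𝒫≤-upper : ∀ {l m} → IsMinimumSize s t (𝒫≤ s t l) m → m ≤ n ^ ⌈log₂ l ⌉ + 2
  minimum-𝒫≤-upper {l} min = IsMinimumSize.minimal min
    (pebbleNetwork s t s≢t ⌈log₂ l ⌉) (pebbleNetwork-solves s t s≢t ⌈log₂ l ⌉ a₀ l (n≤2^⌈log₂n⌉ l))

  solves-𝒫≤⇒𝒫 : ∀ {j l} → 1 ≤ j → j ≤ l → ∀ net → Solves s t (𝒫≤ s t l) net → Solves s t (𝒫 s t j) net
  solves-𝒫≤⇒𝒫 1≤j j≤l net (sound , complete) = sound , λ p → complete (_ , 1≤j , j≤l , p)

  minimum-𝒫 : ∀ l → 1 ≤ l → ∃[ m ] IsMinimumSize s t (𝒫 s t l) m
  minimum-𝒫 l 1≤l = minimum-exists s t s≢t (𝒫 s t l) (λ G → 𝒫? s t s≢t {l} {G}) (𝒫-≐ s t s≢t {l})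
    (pebbleNetwork s t s≢t ⌈log₂ l ⌉)
    (solves-𝒫≤⇒𝒫 1≤l ≤-refl (pebbleNetwork s t s≢t ⌈log₂ l ⌉) (pebbleNetwork-solves s t s≢t ⌈log₂ l ⌉ a₀ l (n≤2^⌈log₂n⌉ l)))

  solver-lower : ∀ L .{{_ : NonZero L}} k → 2 ^ k ≤ L → ∀ {m} →
    (∃[ net ] (Solves s t (𝒫 s t (ℕ.suc L)) net × size net ≡ m)) → n ^ ℕ.suc k ≤ 4 * (m * m) * (64 * L ^ 2) ^ ℕ.suc k
  solver-lower L k 2^k≤L (net , solves , refl) = lower-bound s t s≢t L k 2^k≤L net solves

  path-length-part : ∀ l′ → let l = ℕ.suc (ℕ.suc l′); instance pos = /-pos n (64 * (l ∸ 1) ^ 2) in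
    ∃[ m₁ ] ∃[ m₂ ]
      ( IsMinimumSize s t (𝒫 s t l) m₁ × IsMinimumSize s t (𝒫≤ s t l) m₂
      × ½ *ʳ ((+ n / (64 * (l ∸ 1) ^ 2)) ^ᑫ (+ ⌈log₂ l ⌉ / 2)) ≤ʳ fromℕ m₁
      × m₁ ≤ m₂
      × m₂ ≤ n ^ ⌈log₂ l ⌉ + 2 )
  path-length-part l′ =
    let (m₁ , min₁) = minimum-𝒫 l (ℕ.s≤s ℕ.z≤n)
        (m₂ , min₂) = minimum-𝒫≤ l
        (net , solves , size≡) = IsMinimumSize.attained min₂
    in m₁ , m₂ , min₁ , min₂ , power-lower n (64 * L ^ 2) ⌈log₂ l ⌉ m₁ (lower min₁) ,
       subst (m₁ ≤_) size≡ (IsMinimumSize.minimal min₁ net (solves-𝒫≤⇒𝒫 (ℕ.s≤s ℕ.z≤n) ≤-refl net solves)) ,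
       minimum-𝒫≤-upper min₂
    where
    L = ℕ.suc l′
    l = ℕ.suc L
    lower : ∀ {m} → IsMinimumSize s t (𝒫 s t l) m → n ^ ⌈log₂ l ⌉ ≤ 4 * (m * m) * (64 * L ^ 2) ^ ⌈log₂ l ⌉
    -- The exponent is `suc k` with `2 ^ k < l`, that is, `2 ^ k ≤ L`: just what `k` pebbles must
    -- not be able to cross.
    lower {m} min = let (k , log≡ , 2^k<l) = ⌈log₂⌉-suc {l} (ℕ.s≤s (ℕ.s≤s ℕ.z≤n)) in
      subst (λ r → n ^ r ≤ 4 * (m * m) * (64 * L ^ 2) ^ r) (sym log≡)
        (solver-lower L k (ℕ.s≤s⁻¹ 2^k<l) (IsMinimumSize.attained min))

  all-paths-part : 
    ∃[ m ]
      ( IsMinimumSize s t (𝒫≤ s t (n + 1)) m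
      × ½ *ʳ (n ^ʳ ((+ 1 / 16) *ʳ lg n +ʳ fromℚ (-[1+ 2 ] / 4))) ≤ʳ fromℕ m
      × fromℕ m ≤ʳ n ^ʳ (lg n +ʳ fromℕ 1) +ʳ fromℕ 2 )
  all-paths-part = m , min , lower (fourth-root n) , upper (⌈log₂⌉-suc (subst (1 ℕ.<_) (+-comm 1 n) (ℕ.s≤s (ℕ.>-nonZero⁻¹ n))))
    where
    m = proj₁ (minimum-𝒫≤ (n + 1))
    min = proj₂ (minimum-𝒫≤ (n + 1))
    upper : ∃[ k ] (⌈log₂ n + 1 ⌉ ≡ ℕ.suc k × 2 ^ k ℕ.< n + 1) → fromℕ m ≤ʳ n ^ʳ (lg n +ʳ fromℕ 1) +ʳ fromℕ 2
    upper (k , log≡ , 2^k<) = lg-power-upper n m k (ℕ.s≤s⁻¹ (subst (2 ^ k ℕ.<_) (+-comm n 1) 2^k<))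
      (subst (λ r → m ≤ n ^ r + 2) log≡ (minimum-𝒫≤-upper min))
    lower : ∃[ w ] (w ^ 4 ≤ n × n ℕ.< ℕ.suc w ^ 4) → ½ *ʳ (n ^ʳ ((+ 1 / 16) *ʳ lg n +ʳ fromℚ (-[1+ 2 ] / 4))) ≤ʳ fromℕ m
    lower (ℕ.zero , _ , n<1) = contradiction (ℕ.s≤s⁻¹ n<1) (<⇒≱ (ℕ.>-nonZero⁻¹ n))
    -- Paths of length `w + 1` belong to the family because `w ≤ w ^ 4 ≤ n`, and `n < (w + 1) ^ 4`
    -- gives `lg n ≤ 4 ⌈ lg (w + 1) ⌉`.
    lower (w@(ℕ.suc w-1) , w⁴≤n , n<l⁴) =
      let (net , solves , size≡) = IsMinimumSize.attained min
          (k , log≡ , 2^k<l) = ⌈log₂⌉-suc {ℕ.suc w} (ℕ.s≤s (ℕ.s≤s ℕ.z≤n))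
      in lg-power-lower n w (ℕ.suc k) m {{it}} {{subst NonZero size≡ (size-nonZero net)}} w⁴≤n (n≤2^4r k log≡)
        (solver-lower w k (ℕ.s≤s⁻¹ 2^k<l) (net , solves-𝒫≤⇒𝒫 (ℕ.s≤s ℕ.z≤n) l≤n+1 net solves , size≡))
      where
      l≤n+1 : ℕ.suc w ≤ n + 1
      l≤n+1 = subst (ℕ.suc w ≤_) (+-comm 1 n) (ℕ.s≤s (≤-trans (m≤m*n w (w ^ 3) {{m^n≢0 w 3}}) w⁴≤n))
      n≤2^4r : ∀ k → ⌈log₂ ℕ.suc w ⌉ ≡ ℕ.suc k → n ≤ 2 ^ (4 * ℕ.suc k)
      n≤2^4r k log≡ = begin
        n                           ≤⟨ <⇒≤ n<l⁴ ⟩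
        ℕ.suc w ^ 4                 ≤⟨ ^-monoˡ-≤ 4 (n≤2^⌈log₂n⌉ (ℕ.suc w)) ⟩
        (2 ^ ⌈log₂ ℕ.suc w ⌉) ^ 4   ≡⟨ cong (λ r → (2 ^ r) ^ 4) log≡ ⟩
        (2 ^ ℕ.suc k) ^ 4           ≡⟨ ^-*-assoc 2 (ℕ.suc k) 4 ⟩
        2 ^ (ℕ.suc k * 4)           ≡⟨ cong (2 ^_) (*-comm (ℕ.suc k) 4) ⟩
        2 ^ (4 * ℕ.suc k)           ∎
        where open ≤-Reasoning

theorem1p13 : ∀ (n l : ℕ) .{{_ : NonZero n}} .{{_ : NonTrivial l}} {N : ℕ} (s t : Fin N) → s ≢ t → ∣ ∁ (⁅ s ⁆ ∪ ⁅ t ⁆) ∣ ≡ n →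
    let instance
          64[l-1]²-nonZero = 64[l-1]²≢0 l
          base-positive = /-pos n (64 * (l ∸ 1) ^ 2)
    in
    (∃[ m₁ ] ∃[ m₂ ]
      ( IsMinimumSize s t (𝒫 s t l) m₁ × IsMinimumSize s t (𝒫≤ s t l) m₂
      × ½ *ʳ ((+ n / (64 * (l ∸ 1) ^ 2)) ^ᑫ (+ ⌈log₂ l ⌉ / 2)) ≤ʳ fromℕ m₁
      × m₁ ≤ m₂
      × m₂ ≤ n ^ ⌈log₂ l ⌉ + 2 ))
    ×
    (∃[ m ]
      ( IsMinimumSize s t (𝒫≤ s t (n + 1)) m
      × ½ *ʳ (n ^ʳ ((+ 1 / 16) *ʳ lg n +ʳ fromℚ (-[1+ 2 ] / 4))) ≤ʳ fromℕ m
      × fromℕ m ≤ʳ n ^ʳ (lg n +ʳ fromℕ 1) +ʳ fromℕ 2 ))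
theorem1p13 n (ℕ.2+ l′) s t s≢t refl = path-length-part s t s≢t l′ , all-paths-part s t s≢t
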